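{- Let $\lambda$ be a self-adjoint operator on $\overline V$ whose characteristic polynomial $p_\lambda$ has distinct roots in $\bar k$ (equivalently, a stable functional). Then the element $[\lambda-\lambda_{KW}]$ of $C_\lambda^\vee$ measuring the position of $\lambda$ relative to the Kostant–Weierstrass section is the character defined by $$c_i\mapsto(-1)^{d_i-1}\left(\frac{(-1)^{\lfloor d_i/2\rfloor}}{q}\right)\left(\frac{\eta_i}{q^{d_i}}\right)\prod_{j\ne i}\ \prod_{t=1}^{\gcd(d_i,d_j)}\left(\frac{\delta_i-\delta_j^{q^{t-1}}}{q^{[d_i,d_j]}}\right).$$
   Context: $k$ is a finite field of size $q$ and characteristic $>2$, $k_d$ its extension of degree $d$, $\left(\frac{\cdot}{q^d}\right)$ the quadratic character of $k_d^\times$, $[a,b]$ the least common multiple. $\overline V=k^n$ carries the form $\langle x,y\rangle=x_1y_n+x_2y_{n-1}+\dots+x_ny_1$, with orthogonal group $\mathrm O_n$ acting by conjugation on self-adjoint operators. (In the paper $k=k_F$, and the self-adjoint matrices form the representation $\mathsf V_x$ of $\mathrm O_n$; via the trace form stable functionals on $\mathsf V_x$, i.e. those with finite stabilizer and closed orbit, are the same as self-adjoint matrices with separable characteristic polynomial.) Write $p_\lambda=\prod_{i=1}^mp_i$ with $p_i\in k[T]$ irreducible of degree $d_i$, $k_i=k[T]/p_i(T)\cong k_{d_i}$, and let $\delta_i\in k_{d_i}$ be any root of $p_i$. Then $\overline V=\bigoplus_i\ker p_i(\lambda)$ orthogonally, with $\ker p_i(\lambda)\cong k_i$ as $k[T]$-modules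 ($T$ acting by $\lambda$), and one may write $\langle x,y\rangle=\sum_i\mathrm{Tr}_{k_i/k}(\eta_ix_iy_i)$ with $\eta_i\in k_i^\times$ (well defined modulo squares). The stabilizer of $\lambda$ in $\mathrm O_n$ is $D_\lambda=\mathrm{Res}_{(k[T]/p_\lambda)/k}\,\mu_2$; $C_\lambda=D_\lambda(k)=\prod_i\mu_2(k_i)$, and $c_i\in C_\lambda$ is $-1$ in the $i$-th factor and $1$ elsewhere. $C_\lambda^\vee$ is the character group of $C_\lambda$. *Kostant–Weierstrass section.* $\lambda_{KW}$ is the unique matrix with characteristic polynomial $p_\lambda$ having first row $(a_1,\dots,a_n)$, last column $(a_n,a_{n-1},\dots,a_1)^T$ (top to bottom), ones on the subdiagonal, and zeros elsewhere; it is self-adjoint, and it is conjugate to $\lambda$ under $\mathrm{SO}_n(\bar k)$. Choose $g\in\mathrm{SO}_n(\bar k)$ with $\lambda=g\lambda_{KW}g^{ -1}$; the cocycle $\sigma\mapsto g^{ -1}\sigma(g)$ defines a class in $H^1(k,D_\lambda)=\prod_ik_i^\times/k_i^{\times2}$ (the stabilizers of $\lambda$ and $\lambda_{KW}$ being canonically identified). Tate duality over the finite field gives $H^1(k,D_\lambda)\cong H^0(k,D_\lambda)^\vee=C_\lambda^\vee$, under which $(a_i)_i$ corresponds to the character $c_i\mapsto\left(\frac{a_i}{q^{d_i}}\right)$. The resulting element of $C_\lambda^\vee$ is $[\lambda-\lambda_{KW}]$. -}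

module Defs where

open import Algebra.Bundles using (AbelianGroup; CommutativeRing; Semiring)
import Algebra.Definitions.RawMagma as RawMagmaDefs
import Algebra.Definitions.RawMonoid as RawMonoidDefs
import Algebra.Definitions.RawSemiring as RawSemiringDefs
open import Algebra.Module.Bundles.Raw using (RawLeftModule)
open import Algebra.Morphism.Structures
  using (module RingMorphisms; module GroupMorphisms)
import Algebra.Morphism.Construct.Composition as Composition
import Algebra.Properties.AbelianGroup as AbelianGroupProperties
import Algebra.Properties.Ring as RingProperties
open import Data.Bool.Base using (if_then_else_)
open import Data.Fin.Base using (Fin; zero; suc; toℕ; opposite; punchIn)
import Data.Fin.Properties as Fin
open import Data.List.Base as List using (List; []; _∷_)
open import Data.List.Relation.Unary.All using (All)
open import Data.Nat.Base as ℕ using (ℕ; zero; suc; _<_; _∸_; _≡ᵇ_; ⌊_/2⌋)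
open import Data.Nat.GCD using (gcd)
open import Data.Nat.LCM using (lcm)
open import Data.Product.Base using (Σ; _×_; _,_; proj₁; proj₂; ∃-syntax)
open import Data.Sign.Base as Sign using (Sign)
import Data.Sign.Properties as Sign
open import Data.Sum.Base using (_⊎_; inj₁; inj₂)
open import Data.Vec.Functional using (Vector)
open import Function.Base using (_∘_; case_of_)
open import Function.Bundles using (Inverse)
open import Level using (Level; _⊔_) renaming (suc to lsuc)
open import Relation.Binary.Core using (Rel)
open import Relation.Binary.Definitions using (Decidable)
open import Relation.Binary.PropositionalEquality as ≡ using (_≡_)
import Relation.Binary.Reasoning.Setoid as SetoidReasoning
open import Relation.Nullary using (¬_; Dec; yes; no; does)

private
  variable
    c ℓ c′ ℓ′ : Level

------------------------------------------------------------------------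

record Field c ℓ : Set (lsuc (c ⊔ ℓ)) where
  infix 4 _≟_
  field
    commutativeRing : CommutativeRing c ℓ

  open CommutativeRing commutativeRing public

  field
    1≉0     : ¬ (1# ≈ 0#)
    _≟_     : Decidable _≈_
    inverse : ∀ x → ¬ (x ≈ 0#) → ∃[ y ] y * x ≈ 1#

HasSize : Field c ℓ → ℕ → Set _
HasSize k q = Inverse (Field.setoid k) (≡.setoid (Fin q))

-- Positive characteristics only: p is the additive order of 1.
record HasCharacteristic (k : Field c ℓ) (p : ℕ) : Set ℓ where
  open Field k hiding (zero)
  open RawSemiringDefs (Semiring.rawSemiring semiring) using () renaming (_×_ to _×ₙ_)
  field
    positive  : 0 < p
    vanishes  : p ×ₙ 1# ≈ 0#
    minimal   : ∀ m → 0 < m → m < p → ¬ (m ×ₙ 1# ≈ 0#)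

------------------------------------------------------------------------

module Matrices (R : CommutativeRing c ℓ) where
  open CommutativeRing R hiding (zero)
  open RawSemiringDefs (Semiring.rawSemiring semiring) using (sum; _^_)

  Matrix : ℕ → Set c
  Matrix n = Vector (Vector Carrier n) n

  infix 4 _≋_
  infixl 7 _*ᴹ_ _*ᵛ_

  _≋_ : ∀ {n} → Rel (Matrix n) ℓ
  A ≋ B = ∀ i j → A i j ≈ B i j

  1ᴹ : ∀ {n} → Matrix n
  1ᴹ i j = if does (i Fin.≟ j) then 1# else 0#

  _*ᴹ_ : ∀ {n} → Matrix n → Matrix n → Matrix n
  (A *ᴹ B) i j = sum λ l → A i l * B l j

  _*ᵛ_ : ∀ {n} → Matrix n → Vector Carrier n → Vector Carrier n
  (A *ᵛ x) i = sum λ l → A i l * x l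

  trace : ∀ {n} → Matrix n → Carrier
  trace A = sum λ i → A i i

  det : ∀ {n} → Matrix n → Carrier
  det {zero}  A = 1#
  det {suc n} A =
    sum λ j → (- 1#) ^ toℕ j * A zero j * det (λ r s → A (suc r) (punchIn j s))

  -- ⟨ x , y ⟩ = x₁yₙ + x₂yₙ₋₁ + ⋯ + xₙy₁
  ⟨_,_⟩ : ∀ {n} → Vector Carrier n → Vector Carrier n → Carrier
  ⟨ x , y ⟩ = sum λ i → x i * y (opposite i)

  SelfAdjoint : ∀ {n} → Matrix n → Set (c ⊔ ℓ)
  SelfAdjoint A = ∀ x y → ⟨ A *ᵛ x , y ⟩ ≈ ⟨ x , A *ᵛ y ⟩

  record SO (n : ℕ) : Set (c ⊔ ℓ) where
    field
      mat inv    : Matrix n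
      inverseˡ   : inv *ᴹ mat ≋ 1ᴹ
      inverseʳ   : mat *ᴹ inv ≋ 1ᴹ
      orthogonal : ∀ x y → ⟨ mat *ᵛ x , mat *ᵛ y ⟩ ≈ ⟨ x , y ⟩
      det≈1      : det mat ≈ 1#

  -- First row (a₁,…,aₙ), last column (aₙ,…,a₁) from top to bottom, ones on
  -- the subdiagonal, zeros elsewhere; the index i of `a` stands for aᵢ₊₁.
  kostantWeierstrass : ∀ {n} → Vector Carrier n → Matrix n
  kostantWeierstrass {n} a i j =
    if toℕ i ≡ᵇ 0 then a j else
    if suc (toℕ j) ≡ᵇ n then a (opposite i) else
    if toℕ i ≡ᵇ suc (toℕ j) then 1# else 0#

------------------------------------------------------------------------
-- Polynomials in one variable T: lists of coefficients, constant term
-- first, two lists being equal when they agree up to trailing zeros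

module Polynomials (R : CommutativeRing c ℓ) where
  open CommutativeRing R hiding (zero)
  open RingProperties ring using (-0#≈0#)
  open SetoidReasoning setoid
  private module M = Matrices R

  Poly : Set c
  Poly = List Carrier

  coeff : Poly → ℕ → Carrier
  coeff []      n       = 0#
  coeff (a ∷ f) zero    = a
  coeff (a ∷ f) (suc n) = coeff f n

  infix 4 _≈ₚ_
  record _≈ₚ_ (f g : Poly) : Set ℓ where
    constructor mk≈ₚ
    field coeff≈ : ∀ n → coeff f n ≈ coeff g n

  open _≈ₚ_ public

  infixl 6 _+ₚ_
  infixl 7 _*ₚ_ _·ₚ_

  _+ₚ_ : Poly → Poly → Poly
  []      +ₚ g       = g
  (a ∷ f) +ₚ []      = a ∷ f
  (a ∷ f) +ₚ (b ∷ g) = a + b ∷ f +ₚ g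

  -ₚ_ : Poly → Poly
  -ₚ f = List.map (λ a → - a) f

  _·ₚ_ : Carrier → Poly → Poly
  a ·ₚ f = List.map (a *_) f

  _*ₚ_ : Poly → Poly → Poly
  []      *ₚ g = []
  (a ∷ f) *ₚ g = a ·ₚ g +ₚ (0# ∷ f *ₚ g)

  const : Carrier → Poly
  const a = a ∷ []

  T : Poly
  T = 0# ∷ 1# ∷ []

  MonicOfDegree : ℕ → Poly → Set ℓ
  MonicOfDegree d f = coeff f d ≈ 1# × (∀ e → d < e → coeff f e ≈ 0#)

  eval : Poly → Carrier → Carrier
  eval []      x = 0#
  eval (a ∷ f) x = a + x * eval f x

  evalᴹ : ∀ {n} → Poly → M.Matrix n → M.Matrix n
  evalᴹ []      A i j = 0#
  evalᴹ (a ∷ f) A i j = a * M.1ᴹ i j + (A M.*ᴹ evalᴹ f A) i j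

  -- For p monic of degree d, the matrix of multiplication by T on R[T]/(p)
  -- in the basis 1, T, …, Tᵈ⁻¹.
  companion : ∀ {d} → Poly → M.Matrix d
  companion {d} p i j =
    if suc (toℕ j) ≡ᵇ d then - coeff p (toℕ i) else
    if toℕ i ≡ᵇ suc (toℕ j) then 1# else 0#

  -- For p monic of degree d, the trace of R[T]/(p) over R: `evalᴹ f (companion p)`
  -- is the matrix of multiplication by f.
  Tr : (d : ℕ) → Poly → Poly → Carrier
  Tr d p f = M.trace (evalᴹ f (companion {d} p))

  -- The ring structure is transported from power series, whose product
  -- is the following convolution.
  private
    Seq : Set c
    Seq = ℕ → Carrier

    _≗_ : Rel Seq ℓ
    u ≗ v = ∀ n → u n ≈ v n

    conv : Seq → Seq → Seq
    conv u v zero    = u 0 * v 0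
    conv u v (suc n) = u 0 * v (suc n) + conv (u ∘ suc) v n

    conv-cong : ∀ {u u′ v v′} → u ≗ u′ → v ≗ v′ → conv u v ≗ conv u′ v′
    conv-cong p r zero    = *-cong (p 0) (r 0)
    conv-cong p r (suc n) =
      +-cong (*-cong (p 0) (r (suc n))) (conv-cong (p ∘ suc) r n)

    interchange : ∀ a b x y → (a + b) + (x + y) ≈ (a + x) + (b + y)
    interchange a b x y = begin
      (a + b) + (x + y)  ≈⟨ +-assoc a b (x + y) ⟩
      a + (b + (x + y))  ≈⟨ +-congˡ (sym (+-assoc b x y)) ⟩
      a + ((b + x) + y)  ≈⟨ +-congˡ (+-congʳ (+-comm b x)) ⟩
      a + ((x + b) + y)  ≈⟨ +-congˡ (+-assoc x b y) ⟩
      a + (x + (b + y))  ≈⟨ sym (+-assoc a x (b + y)) ⟩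
      (a + x) + (b + y)  ∎

    conv-distribʳ : ∀ u v w → conv (λ n → u n + v n) w ≗ λ n → conv u w n + conv v w n
    conv-distribʳ u v w zero    = distribʳ (w 0) (u 0) (v 0)
    conv-distribʳ u v w (suc n) = begin
      (u 0 + v 0) * w (suc n) + conv (λ i → u (suc i) + v (suc i)) w n
        ≈⟨ +-cong (distribʳ _ _ _) (conv-distribʳ (u ∘ suc) (v ∘ suc) w n) ⟩
      (u 0 * w (suc n) + v 0 * w (suc n)) + (conv (u ∘ suc) w n + conv (v ∘ suc) w n)
        ≈⟨ interchange _ _ _ _ ⟩
      conv u w (suc n) + conv v w (suc n) ∎

    conv-scale : ∀ a u v → conv (λ n → a * u n) v ≗ λ n → a * conv u v n
    conv-scale a u v zero    = *-assoc _ _ _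
    conv-scale a u v (suc n) = begin
      a * u 0 * v (suc n) + conv (λ i → a * u (suc i)) v n
        ≈⟨ +-cong (*-assoc _ _ _) (conv-scale a (u ∘ suc) v n) ⟩
      a * (u 0 * v (suc n)) + a * conv (u ∘ suc) v n
        ≈⟨ sym (distribˡ _ _ _) ⟩
      a * conv u v (suc n) ∎

    conv-last : ∀ u v n → conv u v (suc n) ≈ conv u (v ∘ suc) n + u (suc n) * v 0
    conv-last u v zero    = refl
    conv-last u v (suc n) = begin
      u 0 * v (suc (suc n)) + conv (u ∘ suc) v (suc n)
        ≈⟨ +-congˡ (conv-last (u ∘ suc) v n) ⟩
      u 0 * v (suc (suc n)) + (conv (u ∘ suc) (v ∘ suc) n + u (suc (suc n)) * v 0)
        ≈⟨ sym (+-assoc _ _ _) ⟩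
      conv u (v ∘ suc) (suc n) + u (suc (suc n)) * v 0 ∎

    conv-comm : ∀ u v → conv u v ≗ conv v u
    conv-comm u v zero    = *-comm _ _
    conv-comm u v (suc n) = begin
      u 0 * v (suc n) + conv (u ∘ suc) v n
        ≈⟨ +-cong (*-comm _ _) (conv-comm (u ∘ suc) v n) ⟩
      v (suc n) * u 0 + conv v (u ∘ suc) n
        ≈⟨ +-comm _ _ ⟩
      conv v (u ∘ suc) n + v (suc n) * u 0
        ≈⟨ sym (conv-last v u n) ⟩
      conv v u (suc n) ∎

    conv-assoc : ∀ u v w → conv (conv u v) w ≗ conv u (conv v w)
    conv-assoc u v w zero    = *-assoc _ _ _
    conv-assoc u v w (suc n) = begin
      u 0 * v 0 * w (suc n) + conv (conv u v ∘ suc) w n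
        ≈⟨ +-congˡ (conv-distribʳ (λ i → u 0 * v (suc i)) (conv (u ∘ suc) v) w n) ⟩
      u 0 * v 0 * w (suc n) +
        (conv (λ i → u 0 * v (suc i)) w n + conv (conv (u ∘ suc) v) w n)
        ≈⟨ +-cong (*-assoc _ _ _)
             (+-cong (conv-scale (u 0) (v ∘ suc) w n) (conv-assoc (u ∘ suc) v w n)) ⟩
      u 0 * (v 0 * w (suc n)) +
        (u 0 * conv (v ∘ suc) w n + conv (u ∘ suc) (conv v w) n)
        ≈⟨ sym (+-assoc _ _ _) ⟩
      (u 0 * (v 0 * w (suc n)) + u 0 * conv (v ∘ suc) w n) + conv (u ∘ suc) (conv v w) n
        ≈⟨ +-congʳ (sym (distribˡ _ _ _)) ⟩
      conv u (conv v w) (suc n) ∎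

    conv-0 : ∀ v → conv (λ _ → 0#) v ≗ λ _ → 0#
    conv-0 v zero    = zeroˡ _
    conv-0 v (suc n) = trans (+-cong (zeroˡ _) (conv-0 v n)) (+-identityˡ _)

  coeff-+ : ∀ f g n → coeff (f +ₚ g) n ≈ coeff f n + coeff g n
  coeff-+ []      g       n       = sym (+-identityˡ _)
  coeff-+ (a ∷ f) []      n       = sym (+-identityʳ _)
  coeff-+ (a ∷ f) (b ∷ g) zero    = refl
  coeff-+ (a ∷ f) (b ∷ g) (suc n) = coeff-+ f g n

  coeff-- : ∀ f n → coeff (-ₚ f) n ≈ - coeff f n
  coeff-- []      n       = sym -0#≈0#
  coeff-- (a ∷ f) zero    = refl
  coeff-- (a ∷ f) (suc n) = coeff-- f n

  coeff-· : ∀ a f n → coeff (a ·ₚ f) n ≈ a * coeff f n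
  coeff-· a []      n       = sym (zeroʳ a)
  coeff-· a (b ∷ f) zero    = refl
  coeff-· a (b ∷ f) (suc n) = coeff-· a f n

  private
    coeff-* : ∀ f g n → coeff (f *ₚ g) n ≈ conv (coeff f) (coeff g) n
    coeff-* []      g n       = sym (conv-0 (coeff g) n)
    coeff-* (a ∷ f) g zero    = begin
      coeff (a ·ₚ g +ₚ (0# ∷ f *ₚ g)) 0  ≈⟨ coeff-+ (a ·ₚ g) _ 0 ⟩
      coeff (a ·ₚ g) 0 + 0#              ≈⟨ +-identityʳ _ ⟩
      coeff (a ·ₚ g) 0                   ≈⟨ coeff-· a g 0 ⟩
      a * coeff g 0                      ∎
    coeff-* (a ∷ f) g (suc n) = begin
      coeff (a ·ₚ g +ₚ (0# ∷ f *ₚ g)) (suc n)       ≈⟨ coeff-+ (a ·ₚ g) _ (suc n) ⟩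
      coeff (a ·ₚ g) (suc n) + coeff (f *ₚ g) n     ≈⟨ +-cong (coeff-· a g (suc n)) (coeff-* f g n) ⟩
      conv (coeff (a ∷ f)) (coeff g) (suc n)        ∎

    *ₚ-comm : ∀ f g → (f *ₚ g) ≈ₚ (g *ₚ f)
    *ₚ-comm f g = mk≈ₚ λ n → begin
      coeff (f *ₚ g) n            ≈⟨ coeff-* f g n ⟩
      conv (coeff f) (coeff g) n  ≈⟨ conv-comm (coeff f) (coeff g) n ⟩
      conv (coeff g) (coeff f) n  ≈⟨ sym (coeff-* g f n) ⟩
      coeff (g *ₚ f) n            ∎

    ≈ₚ-trans : ∀ {f g h} → f ≈ₚ g → g ≈ₚ h → f ≈ₚ h
    ≈ₚ-trans p r = mk≈ₚ λ n → trans (coeff≈ p n) (coeff≈ r n)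

    *ₚ-identityˡ : ∀ f → (const 1# *ₚ f) ≈ₚ f
    *ₚ-identityˡ f = mk≈ₚ λ n → begin
      coeff (const 1# *ₚ f) n                    ≈⟨ coeff-+ (1# ·ₚ f) (0# ∷ []) n ⟩
      coeff (1# ·ₚ f) n + coeff (0# ∷ []) n      ≈⟨ +-cong (coeff-· 1# f n) (zeros n) ⟩
      1# * coeff f n + 0#                        ≈⟨ +-identityʳ _ ⟩
      1# * coeff f n                             ≈⟨ *-identityˡ _ ⟩
      coeff f n                                  ∎
      where
      zeros : ∀ n → coeff (0# ∷ []) n ≈ 0#
      zeros zero    = refl
      zeros (suc n) = refl

    *ₚ-distribʳ : ∀ h f g → ((f +ₚ g) *ₚ h) ≈ₚ (f *ₚ h +ₚ g *ₚ h)
    *ₚ-distribʳ h f g = mk≈ₚ λ n → begin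
      coeff ((f +ₚ g) *ₚ h) n
        ≈⟨ coeff-* (f +ₚ g) h n ⟩
      conv (coeff (f +ₚ g)) (coeff h) n
        ≈⟨ conv-cong (coeff-+ f g) (λ _ → refl) n ⟩
      conv (λ i → coeff f i + coeff g i) (coeff h) n
        ≈⟨ conv-distribʳ (coeff f) (coeff g) (coeff h) n ⟩
      conv (coeff f) (coeff h) n + conv (coeff g) (coeff h) n
        ≈⟨ +-cong (sym (coeff-* f h n)) (sym (coeff-* g h n)) ⟩
      coeff (f *ₚ h) n + coeff (g *ₚ h) n
        ≈⟨ sym (coeff-+ (f *ₚ h) (g *ₚ h) n) ⟩
      coeff (f *ₚ h +ₚ g *ₚ h) n ∎

    +ₚ-cong : ∀ {f f′ g g′} → f ≈ₚ f′ → g ≈ₚ g′ → (f +ₚ g) ≈ₚ (f′ +ₚ g′)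
    +ₚ-cong {f} {f′} {g} {g′} p r = mk≈ₚ λ n →
      trans (coeff-+ f g n) (trans (+-cong (coeff≈ p n) (coeff≈ r n)) (sym (coeff-+ f′ g′ n)))

    +ₚ-assoc : ∀ f g h → ((f +ₚ g) +ₚ h) ≈ₚ (f +ₚ (g +ₚ h))
    +ₚ-assoc f g h = mk≈ₚ λ n → begin
      coeff (f +ₚ g +ₚ h) n                  ≈⟨ coeff-+ (f +ₚ g) h n ⟩
      coeff (f +ₚ g) n + coeff h n           ≈⟨ +-congʳ (coeff-+ f g n) ⟩
      coeff f n + coeff g n + coeff h n      ≈⟨ +-assoc _ _ _ ⟩
      coeff f n + (coeff g n + coeff h n)    ≈⟨ +-congˡ (sym (coeff-+ g h n)) ⟩
      coeff f n + coeff (g +ₚ h) n           ≈⟨ sym (coeff-+ f (g +ₚ h) n) ⟩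
      coeff (f +ₚ (g +ₚ h)) n                ∎

    +ₚ-comm : ∀ f g → (f +ₚ g) ≈ₚ (g +ₚ f)
    +ₚ-comm f g = mk≈ₚ λ n →
      trans (coeff-+ f g n) (trans (+-comm _ _) (sym (coeff-+ g f n)))

    +ₚ-identityʳ : ∀ f → (f +ₚ []) ≈ₚ f
    +ₚ-identityʳ f = mk≈ₚ λ n → trans (coeff-+ f [] n) (+-identityʳ _)

    -ₚ-inverseˡ : ∀ f → ((-ₚ f) +ₚ f) ≈ₚ []
    -ₚ-inverseˡ f = mk≈ₚ λ n →
      trans (coeff-+ (-ₚ f) f n) (trans (+-congʳ (coeff-- f n)) (-‿inverseˡ _))

    *ₚ-cong : ∀ {f f′ g g′} → f ≈ₚ f′ → g ≈ₚ g′ → (f *ₚ g) ≈ₚ (f′ *ₚ g′)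
    *ₚ-cong {f} {f′} {g} {g′} p r = mk≈ₚ λ n →
      trans (coeff-* f g n) (trans (conv-cong (coeff≈ p) (coeff≈ r) n) (sym (coeff-* f′ g′ n)))

    *ₚ-assoc : ∀ f g h → ((f *ₚ g) *ₚ h) ≈ₚ (f *ₚ (g *ₚ h))
    *ₚ-assoc f g h = mk≈ₚ λ n → begin
      coeff (f *ₚ g *ₚ h) n
        ≈⟨ coeff-* (f *ₚ g) h n ⟩
      conv (coeff (f *ₚ g)) (coeff h) n
        ≈⟨ conv-cong (coeff-* f g) (λ _ → refl) n ⟩
      conv (conv (coeff f) (coeff g)) (coeff h) n
        ≈⟨ conv-assoc (coeff f) (coeff g) (coeff h) n ⟩
      conv (coeff f) (conv (coeff g) (coeff h)) n
        ≈⟨ conv-cong (λ _ → refl) (λ i → sym (coeff-* g h i)) n ⟩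
      conv (coeff f) (coeff (g *ₚ h)) n
        ≈⟨ sym (coeff-* f (g *ₚ h) n) ⟩
      coeff (f *ₚ (g *ₚ h)) n ∎

  polyRing : CommutativeRing c ℓ
  polyRing = record
    { Carrier = Poly
    ; _≈_ = _≈ₚ_
    ; _+_ = _+ₚ_
    ; _*_ = _*ₚ_
    ; -_  = -ₚ_
    ; 0#  = []
    ; 1#  = const 1#
    ; isCommutativeRing = record
      { isRing = record
        { +-isAbelianGroup = record
          { isGroup = record
            { isMonoid = record
              { isSemigroup = record
                { isMagma = record
                  { isEquivalence = record
                    { refl  = mk≈ₚ λ _ → refl
                    ; sym   = λ p → mk≈ₚ λ n → sym (coeff≈ p n)
                    ; trans = ≈ₚ-trans
                    }
                  ; ∙-cong = +ₚ-cong
                  }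
                ; assoc = +ₚ-assoc
                }
              ; identity = (λ f → mk≈ₚ λ _ → refl) , +ₚ-identityʳ
              }
            ; inverse = -ₚ-inverseˡ ,
                λ f → ≈ₚ-trans (+ₚ-comm f (-ₚ f)) (-ₚ-inverseˡ f)
            ; ⁻¹-cong = λ {f} {g} p → mk≈ₚ λ n →
                trans (coeff-- f n) (trans (-‿cong (coeff≈ p n)) (sym (coeff-- g n)))
            }
          ; comm = +ₚ-comm
          }
        ; *-cong = *ₚ-cong
        ; *-assoc = *ₚ-assoc
        ; *-identity = *ₚ-identityˡ ,
            λ f → ≈ₚ-trans (*ₚ-comm f (const 1#)) (*ₚ-identityˡ f)
        ; distrib =
            (λ f g h → ≈ₚ-trans (*ₚ-comm f (g +ₚ h))
              (≈ₚ-trans (*ₚ-distribʳ f g h) (+ₚ-cong (*ₚ-comm g f) (*ₚ-comm h f))))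
          , *ₚ-distribʳ
        }
      ; *-comm = *ₚ-comm
      }
    }

  charPoly : ∀ {n} → M.Matrix n → Poly
  charPoly A = Mₚ.det λ i j → T *ₚ Mₚ.1ᴹ i j +ₚ (-ₚ const (A i j))
    where module Mₚ = Matrices polyRing

------------------------------------------------------------------------

module _ (R : CommutativeRing c ℓ) (p : CommutativeRing.Carrier R) where
  open CommutativeRing R hiding (zero)
  open RawSemiringDefs (Semiring.rawSemiring semiring) using (_∣_)
  open RawMagmaDefs (Semiring.*-rawMagma semiring) using (_,_)
  open RingProperties ring using (-‿distribˡ-*)
  open AbelianGroupProperties +-abelianGroup using (⁻¹-∙-comm; ⁻¹-involutive)
  open SetoidReasoning setoid

  record _≈_mod (x y : Carrier) : Set (c ⊔ ℓ) where
    constructor mkMod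
    field divides : p ∣ (x - y)

  open _≈_mod public

  private
    ≡-refl′ : ∀ {x y} → x ≈ y → x ≈ y mod
    ≡-refl′ {x} {y} e = mkMod (0# , (begin
      0# * p  ≈⟨ zeroˡ p ⟩
      0#      ≈⟨ sym (-‿inverseʳ y) ⟩
      y - y   ≈⟨ +-congʳ (sym e) ⟩
      x - y   ∎))

    ≡-sym : ∀ {x y} → x ≈ y mod → y ≈ x mod
    ≡-sym {x} {y} (mkMod (h , e)) = mkMod (- h , (begin
      - h * p        ≈⟨ sym (-‿distribˡ-* h p) ⟩
      - (h * p)      ≈⟨ -‿cong e ⟩
      - (x - y)      ≈⟨ sym (⁻¹-∙-comm x (- y)) ⟩
      - x - - y      ≈⟨ +-congˡ (⁻¹-involutive y) ⟩
      - x + y        ≈⟨ +-comm (- x) y ⟩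
      y - x          ∎))

    cancel : ∀ x y z → (x - y) + (y - z) ≈ x - z
    cancel x y z = begin
      (x - y) + (y - z)      ≈⟨ +-assoc x (- y) (y - z) ⟩
      x + (- y + (y - z))    ≈⟨ +-congˡ (sym (+-assoc (- y) y (- z))) ⟩
      x + ((- y + y) - z)    ≈⟨ +-congˡ (+-congʳ (-‿inverseˡ y)) ⟩
      x + (0# - z)           ≈⟨ +-congˡ (+-identityˡ (- z)) ⟩
      x - z                  ∎

    ≡-trans : ∀ {x y z} → x ≈ y mod → y ≈ z mod → x ≈ z mod
    ≡-trans {x} {y} {z} (mkMod (h , e)) (mkMod (h′ , e′)) = mkMod (h + h′ , (begin
      (h + h′) * p         ≈⟨ distribʳ p h h′ ⟩
      h * p + h′ * p       ≈⟨ +-cong e e′ ⟩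
      (x - y) + (y - z)    ≈⟨ cancel x y z ⟩
      x - z                ∎))

    +-congˡ-mod : ∀ {x y} z → x ≈ y mod → (x + z) ≈ (y + z) mod
    +-congˡ-mod {x} {y} z (mkMod (h , e)) = mkMod (h , (begin
      h * p                  ≈⟨ e ⟩
      x - y                  ≈⟨ sym (cancel x (- z) y) ⟩
      (x - - z) + (- z - y)  ≈⟨ +-congʳ (+-congˡ (⁻¹-involutive z)) ⟩
      (x + z) + (- z - y)    ≈⟨ +-congˡ (+-comm (- z) (- y)) ⟩
      (x + z) + (- y - z)    ≈⟨ +-congˡ (⁻¹-∙-comm y z) ⟩
      (x + z) - (y + z)      ∎))

    *-congˡ-mod : ∀ {x y} z → x ≈ y mod → (x * z) ≈ (y * z) mod
    *-congˡ-mod {x} {y} z (mkMod (h , e)) = mkMod (z * h , (begin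
      z * h * p            ≈⟨ *-assoc z h p ⟩
      z * (h * p)          ≈⟨ *-congˡ e ⟩
      z * (x - y)          ≈⟨ *-comm z (x - y) ⟩
      (x - y) * z          ≈⟨ distribʳ z x (- y) ⟩
      x * z + - y * z      ≈⟨ +-congˡ (sym (-‿distribˡ-* y z)) ⟩
      x * z - y * z        ∎))

    +-cong-mod : ∀ {x y u v} → x ≈ y mod → u ≈ v mod → (x + u) ≈ (y + v) mod
    +-cong-mod {x} {y} {u} {v} r s = ≡-trans (+-congˡ-mod u r)
      (≡-trans (≡-refl′ (+-comm y u)) (≡-trans (+-congˡ-mod y s) (≡-refl′ (+-comm v y))))

    *-cong-mod : ∀ {x y u v} → x ≈ y mod → u ≈ v mod → (x * u) ≈ (y * v) mod
    *-cong-mod {x} {y} {u} {v} r s = ≡-trans (*-congˡ-mod u r)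
      (≡-trans (≡-refl′ (*-comm y u)) (≡-trans (*-congˡ-mod y s) (≡-refl′ (*-comm v y))))

    neg-cong-mod : ∀ {x y} → x ≈ y mod → (- x) ≈ (- y) mod
    neg-cong-mod {x} {y} r with ≡-sym r
    ... | mkMod (h , e) = mkMod (h , (begin
      h * p        ≈⟨ e ⟩
      y - x        ≈⟨ +-comm y (- x) ⟩
      - x + y      ≈⟨ +-congˡ (sym (⁻¹-involutive y)) ⟩
      - x - - y    ∎))

  quotient : CommutativeRing c (c ⊔ ℓ)
  quotient = record
    { Carrier = Carrier
    ; _≈_ = _≈_mod
    ; _+_ = _+_
    ; _*_ = _*_
    ; -_  = -_
    ; 0#  = 0#
    ; 1#  = 1#
    ; isCommutativeRing = record
      { isRing = record
        { +-isAbelianGroup = record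
          { isGroup = record
            { isMonoid = record
              { isSemigroup = record
                { isMagma = record
                  { isEquivalence = record
                    { refl = ≡-refl′ refl ; sym = ≡-sym ; trans = ≡-trans }
                  ; ∙-cong = +-cong-mod
                  }
                ; assoc = λ x y z → ≡-refl′ (+-assoc x y z)
                }
              ; identity = (λ x → ≡-refl′ (+-identityˡ x)) , (λ x → ≡-refl′ (+-identityʳ x))
              }
            ; inverse = (λ x → ≡-refl′ (-‿inverseˡ x)) , (λ x → ≡-refl′ (-‿inverseʳ x))
            ; ⁻¹-cong = neg-cong-mod
            }
          ; comm = λ x y → ≡-refl′ (+-comm x y)
          }
        ; *-cong = *-cong-mod
        ; *-assoc = λ x y z → ≡-refl′ (*-assoc x y z)
        ; *-identity = (λ x → ≡-refl′ (*-identityˡ x)) , (λ x → ≡-refl′ (*-identityʳ x))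
        ; distrib = (λ x y z → ≡-refl′ (distribˡ x y z)) , (λ x y z → ≡-refl′ (distribʳ x y z))
        }
      ; *-comm = λ x y → ≡-refl′ (*-comm x y)
      }
    }

IsUnit : (R : CommutativeRing c ℓ) → CommutativeRing.Carrier R → Set (c ⊔ ℓ)
IsUnit R x = ∃[ y ] y * x ≈ 1#
  where open CommutativeRing R

------------------------------------------------------------------------

module _ (R : CommutativeRing c ℓ) where
  open CommutativeRing R hiding (zero)
  open RingProperties ring using (-1*x≈-x; -‿involutive)
  open SetoidReasoning setoid

  private
    square-∙ : ∀ x y → x * x ≈ 1# → y * y ≈ 1# → (x * y) * (x * y) ≈ 1#
    square-∙ x y ex ey = begin
      (x * y) * (x * y)  ≈⟨ *-congʳ (*-comm x y) ⟩
      (y * x) * (x * y)  ≈⟨ *-assoc y x (x * y) ⟩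
      y * (x * (x * y))  ≈⟨ *-congˡ (sym (*-assoc x x y)) ⟩
      y * ((x * x) * y)  ≈⟨ *-congˡ (*-congʳ ex) ⟩
      y * (1# * y)       ≈⟨ *-congˡ (*-identityˡ y) ⟩
      y * y              ≈⟨ ey ⟩
      1#                 ∎

  μ₂ : AbelianGroup (c ⊔ ℓ) ℓ
  μ₂ = record
    { Carrier = ∃[ x ] x * x ≈ 1#
    ; _≈_ = λ x y → proj₁ x ≈ proj₁ y
    ; _∙_ = λ (x , ex) (y , ey) → x * y , square-∙ x y ex ey
    ; ε   = 1# , *-identityˡ 1#
    ; _⁻¹ = λ x → x
    ; isAbelianGroup = record
      { isGroup = record
        { isMonoid = record
          { isSemigroup = record
            { isMagma = record
              { isEquivalence = record { refl = refl ; sym = sym ; trans = trans }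
              ; ∙-cong = *-cong
              }
            ; assoc = λ x y z → *-assoc (proj₁ x) (proj₁ y) (proj₁ z)
            }
          ; identity = (λ x → *-identityˡ (proj₁ x)) , (λ x → *-identityʳ (proj₁ x))
          }
        ; inverse = proj₂ , proj₂
        ; ⁻¹-cong = λ e → e
        }
      ; comm = λ x y → *-comm (proj₁ x) (proj₁ y)
      }
    }

  minusOne : AbelianGroup.Carrier μ₂
  minusOne = - 1# , trans (-1*x≈-x (- 1#)) (-‿involutive 1#)

∏ᴳ : ∀ {m} → (Fin m → AbelianGroup c ℓ) → AbelianGroup c ℓ
∏ᴳ G = record
  { Carrier = ∀ i → Carrier (G i)
  ; _≈_ = λ x y → ∀ i → _≈_ (G i) (x i) (y i)
  ; _∙_ = λ x y i → _∙_ (G i) (x i) (y i)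
  ; ε   = λ i → ε (G i)
  ; _⁻¹ = λ x i → _⁻¹ (G i) (x i)
  ; isAbelianGroup = record
    { isGroup = record
      { isMonoid = record
        { isSemigroup = record
          { isMagma = record
            { isEquivalence = record
              { refl  = λ i → refl (G i)
              ; sym   = λ e i → sym (G i) (e i)
              ; trans = λ e e′ i → trans (G i) (e i) (e′ i)
              }
            ; ∙-cong = λ e e′ i → ∙-cong (G i) (e i) (e′ i)
            }
          ; assoc = λ x y z i → assoc (G i) (x i) (y i) (z i)
          }
        ; identity = (λ x i → identityˡ (G i) (x i)) , (λ x i → identityʳ (G i) (x i))
        }
      ; inverse = (λ x i → inverseˡ (G i) (x i)) , (λ x i → inverseʳ (G i) (x i))
      ; ⁻¹-cong = λ e i → ⁻¹-cong (G i) (e i)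
      }
    ; comm = λ x y i → comm (G i) (x i) (y i)
    }
  }
  where open AbelianGroup

-- Characters of a group killed by 2 take values in {±1}.
-- (`Sign.*-1-rawGroup` is not used: its inverse is `opposite`.)
record Character (G : AbelianGroup c ℓ) : Set (c ⊔ ℓ) where
  open AbelianGroup G using (Carrier; rawGroup)
  open GroupMorphisms rawGroup (AbelianGroup.rawGroup Sign.*-abelianGroup)
  field
    ⟦_⟧                 : Carrier → Sign
    isGroupHomomorphism : IsGroupHomomorphism ⟦_⟧

------------------------------------------------------------------------

record AlgebraicClosure (k : Field c ℓ) c′ ℓ′ : Set (c ⊔ ℓ ⊔ lsuc (c′ ⊔ ℓ′)) where
  private module k = Field k
  field
    field̄ : Field c′ ℓ′

  open Field field̄ public
  open RingMorphisms k.rawRing rawRing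

  private
    module P  = Polynomials k.commutativeRing
    module P̄ = Polynomials commutativeRing

  field
    ι                 : k.Carrier → Carrier
    ι-isHomomorphism  : IsRingHomomorphism ι
    algebraic         : ∀ x → ∃[ d ] ∃[ f ]
                          P.MonicOfDegree d f × P̄.eval (List.map ι f) x ≈ 0#
    closed            : ∀ d f → P̄.MonicOfDegree (suc d) f → ∃[ x ] P̄.eval f x ≈ 0#

module Galois (k : Field c ℓ) (k̄ : AlgebraicClosure k c′ ℓ′) where
  private module k = Field k
  open AlgebraicClosure k̄ hiding (zero)
  open RingMorphisms rawRing rawRing

  record Gal : Set (c ⊔ c′ ⊔ ℓ′) where
    field
      ⟦_⟧               : Carrier → Carrier
      isRingIsomorphism : IsRingIsomorphism ⟦_⟧
      fixes             : ∀ a → ⟦ ι a ⟧ ≈ ι a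

    open IsRingIsomorphism isRingIsomorphism public using (⟦⟧-cong)

  open Gal public

  infixr 9 _⊚_
  _⊚_ : Gal → Gal → Gal
  σ ⊚ τ = record
    { ⟦_⟧ = ⟦ σ ⟧ ∘ ⟦ τ ⟧
    ; isRingIsomorphism =
        Composition.isRingIsomorphism trans (isRingIsomorphism τ) (isRingIsomorphism σ)
    ; fixes = λ a → trans (⟦⟧-cong σ (fixes τ a)) (fixes σ a)
    }

------------------------------------------------------------------------
-- Finite fields: k has q elements, and its extension k_d of degree d is
-- the subfield of fixed points of x ↦ x^(q^d) in k̄

module QuadraticCharacter (k : Field c ℓ) (q : ℕ) (k̄ : AlgebraicClosure k c′ ℓ′) where
  open AlgebraicClosure k̄ hiding (zero)
  open Polynomials commutativeRing using (eval; MonicOfDegree)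
  open RawSemiringDefs (Semiring.rawSemiring semiring) using (_^_)
  open RingProperties ring using (x[y-z]≈xy-xz; -‿distribˡ-*; -‿involutive)
  open AbelianGroupProperties +-abelianGroup using (inverseˡ-unique)
  open import Algebra.Properties.CommutativeSemiring.Exp commutativeSemiring
    using (^-congˡ)
  open SetoidReasoning setoid

  SquareIn : ℕ → Carrier → Set (c′ ⊔ ℓ′)
  SquareIn d x = ∃[ y ] y ^ (q ℕ.^ d) ≈ y × y * y ≈ x

  private
    squareRoot : ∀ x → ∃[ y ] y * y ≈ x
    squareRoot x with closed 1 (- x ∷ 0# ∷ 1# ∷ []) (refl , high)
      where
      high : ∀ e → 2 < e → Polynomials.coeff commutativeRing (- x ∷ 0# ∷ 1# ∷ []) e ≈ 0#
      high (suc (suc (suc e))) (ℕ.s≤s (ℕ.s≤s (ℕ.s≤s _))) = refl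
    ... | y , e = y , (begin
      y * y                            ≈⟨ *-congˡ (sym (*-identityʳ y)) ⟩
      y * (y * 1#)                     ≈⟨ *-congˡ (*-congˡ (sym (+-identityʳ 1#))) ⟩
      y * (y * (1# + 0#))              ≈⟨ *-congˡ (*-congˡ (+-congˡ (sym (zeroʳ y)))) ⟩
      y * (y * (1# + y * 0#))          ≈⟨ *-congˡ (sym (+-identityˡ _)) ⟩
      y * (0# + y * (1# + y * 0#))     ≈⟨ inverseˡ-unique _ _ (trans (+-comm _ _) e) ⟩
      - - x                            ≈⟨ -‿involutive x ⟩
      x                                ∎)

    noZeroDivisors : ∀ x y → x * y ≈ 0# → x ≈ 0# ⊎ y ≈ 0#
    noZeroDivisors x y e with x ≟ 0#
    ... | yes x≈0 = inj₁ x≈0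
    ... | no  x≉0 with inverse x x≉0
    ...   | x⁻¹ , i = inj₂ (begin
      y              ≈⟨ sym (*-identityˡ y) ⟩
      1# * y         ≈⟨ *-congʳ (sym i) ⟩
      x⁻¹ * x * y    ≈⟨ *-assoc x⁻¹ x y ⟩
      x⁻¹ * (x * y)  ≈⟨ *-congˡ e ⟩
      x⁻¹ * 0#       ≈⟨ zeroʳ x⁻¹ ⟩
      0#             ∎)

    equalSquares : ∀ z y → z * z ≈ y * y → z ≈ y ⊎ z ≈ - y
    equalSquares z y e with noZeroDivisors (z + y) (z - y) (begin
      (z + y) * (z - y)                    ≈⟨ x[y-z]≈xy-xz (z + y) z y ⟩
      (z + y) * z - (z + y) * y            ≈⟨ +-cong (distribʳ z z y) (-‿cong (distribʳ y z y)) ⟩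
      (z * z + y * z) - (z * y + y * y)    ≈⟨ +-cong (+-comm _ _) (-‿cong (+-cong (*-comm z y) (sym e))) ⟩
      (y * z + z * z) - (y * z + z * z)    ≈⟨ -‿inverseʳ _ ⟩
      0#                                   ∎)
    ... | inj₁ s = inj₂ (inverseˡ-unique z y s)
    ... | inj₂ s = inj₁ (trans (inverseˡ-unique z (- y) s) (-‿involutive y))

  squareIn? : ∀ d x → Dec (SquareIn d x)
  squareIn? d x with squareRoot x
  ... | y , y²≈x with y ^ (q ℕ.^ d) ≟ y | (- y) ^ (q ℕ.^ d) ≟ - y
  ...   | yes r | _     = yes (y , r , y²≈x)
  ...   | no _  | yes r = yes (- y , r , trans (trans (sym (-‿distribˡ-* y (- y)))
                            (-‿cong (trans (*-comm y (- y)) (sym (-‿distribˡ-* y y)))))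
                            (trans (-‿involutive (y * y)) y²≈x))
  ...   | no ¬r | no ¬s = no λ (z , r , z²≈x) →
    case equalSquares z y (trans z²≈x (sym y²≈x)) of λ
      { (inj₁ z≈y)  → ¬r (trans (^-congˡ (q ℕ.^ d) (sym z≈y)) (trans r z≈y))
      ; (inj₂ z≈-y) → ¬s (trans (^-congˡ (q ℕ.^ d) (sym z≈-y)) (trans r z≈-y))
      }

  -- The quadratic character of k_d^×; only meaningful for 0 ≉ x ∈ k_d.
  legendre : ℕ → Carrier → Sign
  legendre d x = if does (squareIn? d x) then Sign.+ else Sign.-

------------------------------------------------------------------------
-- The factors kᵢ = k[T]/(Pᵢ), with Pᵢ monic of degree dᵢ and δᵢ a root of Pᵢ

module Factors
  (k : Field c ℓ) (q : ℕ) (k̄ : AlgebraicClosure k c′ ℓ′)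
  {m : ℕ} (P : Fin m → Polynomials.Poly (Field.commutativeRing k))
  (d : Fin m → ℕ) (δ : Fin m → AlgebraicClosure.Carrier k̄)
  where
  private module k = Field k
  open Matrices k.commutativeRing using (Matrix; _*ᵛ_)
  open Polynomials k.commutativeRing using (Poly; polyRing; _*ₚ_; evalᴹ)
  open AlgebraicClosure k̄ hiding (zero)
  open Polynomials commutativeRing using (eval)
  open RawSemiringDefs (Semiring.rawSemiring semiring) using (_^_)
  open RawMonoidDefs Sign.*-1-rawMonoid using ()
    renaming (sum to ∏ˢ; _×_ to power)
  open QuadraticCharacter k q k̄ using (legendre)

  kᵢ : Fin m → CommutativeRing c (c ⊔ ℓ)
  kᵢ i = quotient polyRing (P i)

  -- The isomorphism of kᵢ with k_{dᵢ} ⊆ k̄ sending T to δᵢ.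
  atδ : Fin m → Poly → Carrier
  atδ i f = eval (List.map ι f) (δ i)

  -- k^n with T acting by Λ
  operatorModule : ∀ {n} → Matrix n → RawLeftModule Poly c ℓ
  operatorModule {n} Λ = record
    { Carrierᴹ = Vector k.Carrier n
    ; _≈ᴹ_ = λ x y → ∀ i → x i k.≈ y i
    ; _+ᴹ_ = λ x y i → x i k.+ y i
    ; _*ₗ_ = λ f x → evalᴹ f Λ *ᵛ x
    ; 0ᴹ   = λ _ → k.0#
    ; -ᴹ_  = λ x i → k.- x i
    }

  ⊕kᵢ : RawLeftModule Poly c (c ⊔ ℓ)
  ⊕kᵢ = record
    { Carrierᴹ = Fin m → Poly
    ; _≈ᴹ_ = λ x y → ∀ i → CommutativeRing._≈_ (kᵢ i) (x i) (y i)
    ; _+ᴹ_ = λ x y i → CommutativeRing._+_ (kᵢ i) (x i) (y i)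
    ; _*ₗ_ = λ f x i → f *ₚ x i
    ; 0ᴹ   = λ i → CommutativeRing.0# (kᵢ i)
    ; -ᴹ_  = λ x i → CommutativeRing.-_ (kᵢ i) (x i)
    }

  C : AbelianGroup (c ⊔ ℓ) (c ⊔ ℓ)
  C = ∏ᴳ (λ i → μ₂ (kᵢ i))

  cᵢ : Fin m → AbelianGroup.Carrier C
  cᵢ i j = if does (i Fin.≟ j) then minusOne (kᵢ j) else AbelianGroup.ε (μ₂ (kᵢ j))

  -- "χ is the character defined by cᵢ ↦ sᵢ"
  DefinedBy : Character C → (Fin m → Sign) → Set
  DefinedBy χ s = ∀ i → Character.⟦_⟧ χ (cᵢ i) ≡ s i

  -- The character attached by duality to the class of (aᵢ) in ∏ kᵢ^× / kᵢ^×²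
  TateDual : (Fin m → Poly) → Character C → Set
  TateDual a χ = DefinedBy χ λ i → legendre (d i) (atδ i (a i))

  positionSign : (η : Fin m → Poly) → Fin m → Sign
  positionSign η i =
    power (d i ∸ 1) Sign.-
      Sign.* legendre 1 ((- 1#) ^ ⌊ d i /2⌋)
      Sign.* legendre (d i) (atδ i (η i))
      Sign.* ∏ˢ λ j → if does (j Fin.≟ i) then Sign.+ else
               ∏ˢ λ (t : Fin (gcd (d i) (d j))) →  -- toℕ t runs over 0, …, gcd − 1
                 legendre (lcm (d i) (d j)) (δ i - δ j ^ (q ℕ.^ toℕ t))

------------------------------------------------------------------------
-- H¹(k, D) for D = Res_{(k[T]/p)/k} μ₂, as continuous cocycles up to
-- coboundaries

module Cohomology
  (k : Field c ℓ) (k̄ : AlgebraicClosure k c′ ℓ′)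
  (p : Polynomials.Poly (Field.commutativeRing k))
  where
  open AlgebraicClosure k̄ hiding (zero)
  open Galois k k̄
  open Polynomials commutativeRing using (Poly; polyRing)
  private module k[T] = Polynomials (Field.commutativeRing k)

  -- k̄ ⊗ k[T]/(p)
  L̄ : CommutativeRing c′ (c′ ⊔ ℓ′)
  L̄ = quotient polyRing (List.map ι p)

  private module L̄ = CommutativeRing L̄

  -- D(k̄)
  D : AbelianGroup (c′ ⊔ ℓ′) (c′ ⊔ ℓ′)
  D = μ₂ L̄

  private module D = AbelianGroup D

  -- Gal acts on L̄ through the coefficients.
  infixr 8 _∙_
  _∙_ : Gal → Poly → Poly
  σ ∙ f = List.map ⟦ σ ⟧ f

  -- The neighbourhoods of σ in the Krull topology are given by the
  -- automorphisms agreeing with σ on a finite set of elements of k̄.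
  record Cocycle : Set (c ⊔ c′ ⊔ ℓ′) where
    field
      at         : Gal → D.Carrier
      cocycle    : ∀ σ τ → proj₁ (at (σ ⊚ τ)) L̄.≈ proj₁ (at σ) L̄.* (σ ∙ proj₁ (at τ))
      continuous : ∀ σ → ∃[ xs ] ∀ τ → All (λ x → ⟦ τ ⟧ x ≈ ⟦ σ ⟧ x) xs → at τ D.≈ at σ

  open Cocycle public

  Cohomologous : Cocycle → Cocycle → Set (c ⊔ c′ ⊔ ℓ′)
  Cohomologous z w = ∃[ m ] ∀ σ →
    proj₁ (at z σ) L̄.≈ proj₁ (m D.⁻¹) L̄.* proj₁ (at w σ) L̄.* (σ ∙ proj₁ m)

  -- For p = ∏ Pᵢ, so that L̄ = ∏ k̄ ⊗ kᵢ: κ is a cocycle σ ↦ b⁻¹ σ(b) with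
  -- b ∈ L̄^× and b² = (aᵢ) ∈ ∏ kᵢ^×.
  Kummer : ∀ {m} (P a : Fin m → k[T].Poly) → Cocycle → Set _
  Kummer P a κ = Σ Poly λ b → IsUnit L̄ b
    × (∀ i → CommutativeRing._≈_ (quotient polyRing (List.map ι (P i))) (b L̄.* b) (List.map ι (a i)))
    × (∀ σ → b L̄.* proj₁ (at κ σ) L̄.≈ σ ∙ b)

------------------------------------------------------------------------
-- "χ = [Λ − Λ_KW]", for p = ∏ Pᵢ the characteristic polynomial of Λ and
-- Λ_KW, and Λ = g Λ_KW g⁻¹

module _
  (k : Field c ℓ) (q : ℕ) (k̄ : AlgebraicClosure k c′ ℓ′)
  {m : ℕ} (p : Polynomials.Poly (Field.commutativeRing k))
  (P : Fin m → Polynomials.Poly (Field.commutativeRing k))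
  (d : Fin m → ℕ) (δ : Fin m → AlgebraicClosure.Carrier k̄)
  {n : ℕ} (Λ-KW : Matrices.Matrix (Field.commutativeRing k) n)
  (g : Matrices.SO (AlgebraicClosure.commutativeRing k̄) n)
  where
  open AlgebraicClosure k̄ hiding (zero)
  open Galois k k̄
  open Matrices commutativeRing
  open SO g
  open Polynomials commutativeRing using (evalᴹ)
  open Factors k q k̄ P d δ
  open Cohomology k k̄ p

  record RelativePosition (χ : Character C) : Set (c ⊔ ℓ ⊔ c′ ⊔ ℓ′) where
    field
      z           : Cocycle
      -- D(k̄) is identified with the stabilizer of Λ-KW by f ↦ f(Λ-KW).
      z-position  : ∀ σ → evalᴹ (proj₁ (at z σ)) (λ i j → ι (Λ-KW i j))
                            ≋ inv *ᴹ (λ i j → ⟦ σ ⟧ (mat i j))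
      a           : Fin m → Polynomials.Poly (Field.commutativeRing k)
      a-unit      : ∀ i → IsUnit (kᵢ i) (a i)
      κ           : Cocycle
      κ-kummer    : Kummer P a κ
      z∼κ         : Cohomologous z κ
      duality     : TateDual a χ

{-# OPTIONS --safe #-}

-- Everything is computed at the roots ρ = δᵢ ^ (q ^ t) of p in k̄. Evaluating Φ
-- at them yields left eigenvectors φ_ρ of Λ with ⟨x,y⟩ = Σ ηᵢ(ρ) φ_ρ(x) φ_ρ(y).
-- Composed with g they become left eigenvectors of Λ_KW, each of which is
-- determined by its first entry s_ρ. For F = p / (T − ρ), which is monic of
-- degree n − 1, the number ⟨F(Λ_KW) e₁ , e₁⟩ is 1, and in terms of the
-- eigenvectors it is ηᵢ(ρ) p′(ρ) s_ρ². Hence σ ↦ g⁻¹ σ(g) is the Kummer cocycle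
-- of the class (ηᵢ p′).
--
-- By Euler's criterion the symbols (x / qᵉ) are the powers x ^ ((qᵉ − 1) / 2).
-- In p′(δᵢ) = Pᵢ′(δᵢ) ∏ Pⱼ(δᵢ), each Pⱼ(δᵢ) is a product of gcd(dᵢ, dⱼ) norms from
-- the field of degree [dᵢ, dⱼ], and the norm of Pᵢ′(δᵢ) to k is, up to the sign
-- (−1) ^ (dᵢ (dᵢ − 1) / 2), the square of the Vandermonde product V of the
-- conjugates of δᵢ, where V ^ q = (−1) ^ (dᵢ − 1) V.

module Submission where

open import Defs
open import Algebra.Bundles using (AbelianGroup; CommutativeMonoid; CommutativeRing; RawMonoid; RawRing; Semiring)
import Algebra.Definitions.RawMagma as RawMagmaDefs
import Algebra.Definitions.RawMonoid as RawMonoidDefs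
import Algebra.Definitions.RawSemiring as RawSemiringDefs
open import Algebra.Module.Morphism.Structures using (module LeftModuleMorphisms)
open import Algebra.Morphism.Structures using (module RingMorphisms)
import Algebra.Properties.AbelianGroup as AbelianGroupProperties
import Algebra.Properties.CommutativeMonoid.Sum as MonoidSum
import Algebra.Properties.CommutativeSemiring.Exp as Exp
import Algebra.Properties.Group as GroupProperties
import Algebra.Properties.Monoid.Mult as MonoidMult
import Algebra.Properties.Ring as RingProperties
import Algebra.Properties.Semiring.Mult as SemiringMult
import Algebra.Properties.Semiring.Sum as SemiringSum
import Algebra.Solver.Ring as RingSolver
open import Algebra.Solver.Ring.AlmostCommutativeRing using (fromCommutativeRing; _-Raw-AlmostCommutative⟶_)
open import Data.Bool.Base as 𝔹 using (if_then_else_; true; false)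
open import Data.Empty using (⊥-elim)
open import Data.Fin.Base using (Fin; zero; suc; toℕ; fromℕ; fromℕ<; inject₁; opposite)
open import Data.Fin.Permutation using (Permutation)
import Data.Fin.Properties as Fin
open import Data.List.Base as List using (List; []; _∷_)
open import Data.List.Relation.Unary.All using (All; []; _∷_)
import Data.Maybe.Base as Maybe
open import Data.Nat.Base as ℕ using (ℕ; zero; suc; _≤_; _<_; z≤n; s≤s)
open import Data.Nat.Divisibility using (_∣_)
open import Data.Nat.DivMod using (_%_; _/_; m≡m%n+[m/n]*n; m%n<n)
open import Data.Nat.GCD using (gcd; gcd-GCD; gcd[m,n]∣m; gcd[m,n]∣n; module Bézout)
open import Data.Nat.Induction using (<-rec)
open import Data.Nat.LCM using (lcm; gcd*lcm; m∣lcm[m,n]; n∣lcm[m,n])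
import Data.Nat.Properties as ℕ
open import Data.Nat.Solver using (module +-*-Solver)
open import Data.Product.Base using (_×_; _,_; proj₁; proj₂; ∃-syntax)
open import Data.Sign.Base as Sign using (Sign)
import Data.Sign.Properties as Sign
open import Data.Sum.Base using (_⊎_; inj₁; inj₂)
open import Data.Vec.Functional using (Vector)
open import Function.Base using (_∘_)
open import Function.Bundles using (Inverse; mk↔ₛ′)
open import Relation.Binary.Consequences using (dec⇒weaklyDec)
open import Relation.Binary.Definitions using (tri<; tri≈; tri>)
open import Relation.Binary.PropositionalEquality as ≡ using (_≡_; _≢_)
import Relation.Binary.Reasoning.Setoid as SetoidReasoning
open import Relation.Nullary using (Dec; yes; no; does; ¬_)
open import Relation.Nullary.Decidable using (_×-dec_)
open import Relation.Unary using (Decidable)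

-- The cocycle is Kummer for the following reason. Let u_ρ be the row φ_ρ g. Then u_ρ g⁻¹ σ(g) = φ_ρ
-- σ(g) is the σ-image of the row belonging to the root σ⁻¹ρ. As Λ_KW has entries in k, this image
-- is again a left eigenvector for ρ, hence a multiple of u_ρ, and first entries give the factor
-- σ(s) / s. Its square is 1 because s² is the inverse of the value of a polynomial over k. The
-- derivative enters because p / (T - ρ) takes the value p′(ρ) at ρ and 0 at the other roots, so
-- that a sum over all eigenvectors collapses to one term. Two obstacles shape the rest. The fields
-- k_d are given only as fixed points of Frobenius powers in k̄, and even the additivity of x ↦ x ^
-- q has to be extracted from the number of elements of k. And a cocycle value is a polynomial
-- modulo p, while the argument produces its values at the roots; interpolation leads back.

-- The ring solver with coefficients the formal differences of naturals,
-- which, unlike those of R itself, can be compared.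
module Solver {c ℓ} (R : CommutativeRing c ℓ) where
  open CommutativeRing R
  open RingProperties ring using (-‿distribˡ-*; -‿distribʳ-*; -‿involutive; -0#≈0#)
  open AbelianGroupProperties +-abelianGroup using (⁻¹-∙-comm; x∙y⁻¹≈ε⇒x≈y)
  open MonoidMult +-monoid using (×-homo-+) renaming (_×_ to _×ₙ_)
  open SemiringMult semiring using (×1-homo-*)
  open SetoidReasoning setoid

  private
    interchange : ∀ a b x y → (a + b) + (x + y) ≈ (a + x) + (b + y)
    interchange a b x y = begin
      (a + b) + (x + y)  ≈⟨ +-assoc a b (x + y) ⟩
      a + (b + (x + y))  ≈⟨ +-congˡ (sym (+-assoc b x y)) ⟩
      a + ((b + x) + y)  ≈⟨ +-congˡ (+-congʳ (+-comm b x)) ⟩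
      a + ((x + b) + y)  ≈⟨ +-congˡ (+-assoc x b y) ⟩
      a + (x + (b + y))  ≈⟨ sym (+-assoc a x (b + y)) ⟩
      (a + x) + (b + y)  ∎

    differences : RawRing _ _
    differences = record
      { Carrier = ℕ × ℕ
      ; _≈_ = _≡_
      ; _+_ = λ (a , b) (c , d) → a ℕ.+ c , b ℕ.+ d
      ; _*_ = λ (a , b) (c , d) → a ℕ.* c ℕ.+ b ℕ.* d , a ℕ.* d ℕ.+ b ℕ.* c
      ; -_  = λ (a , b) → b , a
      ; 0#  = 0 , 0
      ; 1#  = 1 , 0
      }

    difference : ℕ → ℕ → Carrier
    difference a b = a ×ₙ 1# - b ×ₙ 1#

    -- The first two clauses let the solver's constants match 0# and 1#.
    ⟦_⟧ : ℕ × ℕ → Carrier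
    ⟦ 0 , 0 ⟧ = 0#
    ⟦ 1 , 0 ⟧ = 1#
    ⟦ a , b ⟧ = difference a b

    ⟦⟧≈difference : ∀ a b → ⟦ a , b ⟧ ≈ difference a b
    ⟦⟧≈difference 0                   0         = sym (-‿inverseʳ 0#)
    ⟦⟧≈difference 1                   0         =
      sym (trans (+-cong (+-identityʳ 1#) -0#≈0#) (+-identityʳ 1#))
    ⟦⟧≈difference (ℕ.suc (ℕ.suc a))   0         = refl
    ⟦⟧≈difference 0                   (ℕ.suc b) = refl
    ⟦⟧≈difference 1                   (ℕ.suc b) = refl
    ⟦⟧≈difference (ℕ.suc (ℕ.suc a))   (ℕ.suc b) = refl

    +-homo : ∀ a b c d → difference (a ℕ.+ c) (b ℕ.+ d) ≈ difference a b + difference c d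
    +-homo a b c d = begin
      (a ℕ.+ c) ×ₙ 1# - (b ℕ.+ d) ×ₙ 1#
        ≈⟨ +-cong (×-homo-+ 1# a c) (-‿cong (×-homo-+ 1# b d)) ⟩
      (a ×ₙ 1# + c ×ₙ 1#) - (b ×ₙ 1# + d ×ₙ 1#)
        ≈⟨ +-congˡ (sym (⁻¹-∙-comm _ _)) ⟩
      (a ×ₙ 1# + c ×ₙ 1#) + (- (b ×ₙ 1#) + - (d ×ₙ 1#))
        ≈⟨ interchange _ _ _ _ ⟩
      difference a b + difference c d ∎

    foil : ∀ a b x y → (a - b) * (x - y) ≈ (a * x + b * y) - (a * y + b * x)
    foil a b x y = begin
      (a - b) * (x - y)
        ≈⟨ distribʳ _ _ _ ⟩
      a * (x - y) + - b * (x - y)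
        ≈⟨ +-cong (distribˡ _ _ _) (distribˡ _ _ _) ⟩
      (a * x + a * - y) + (- b * x + - b * - y)
        ≈⟨ +-cong (+-congˡ (sym (-‿distribʳ-* a y)))
             (+-cong (sym (-‿distribˡ-* b x))
               (trans (sym (-‿distribˡ-* b (- y)))
                 (trans (-‿cong (sym (-‿distribʳ-* b y))) (-‿involutive _)))) ⟩
      (a * x + - (a * y)) + (- (b * x) + b * y)
        ≈⟨ +-congˡ (+-comm _ _) ⟩
      (a * x + - (a * y)) + (b * y + - (b * x))
        ≈⟨ interchange _ _ _ _ ⟩
      (a * x + b * y) + (- (a * y) + - (b * x))
        ≈⟨ +-congˡ (⁻¹-∙-comm _ _) ⟩
      (a * x + b * y) - (a * y + b * x) ∎

    ×-foil : ∀ a b c d → (a ℕ.* c ℕ.+ b ℕ.* d) ×ₙ 1# ≈ a ×ₙ 1# * c ×ₙ 1# + b ×ₙ 1# * d ×ₙ 1#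
    ×-foil a b c d = trans (×-homo-+ 1# (a ℕ.* c) (b ℕ.* d)) (+-cong (×1-homo-* a c) (×1-homo-* b d))

    morphism : differences -Raw-AlmostCommutative⟶ fromCommutativeRing R
    morphism = record
      { ⟦_⟧    = ⟦_⟧
      ; +-homo = λ (a , b) (c , d) →
          trans (⟦⟧≈difference (a ℕ.+ c) (b ℕ.+ d)) (trans (+-homo a b c d)
            (sym (+-cong (⟦⟧≈difference a b) (⟦⟧≈difference c d))))
      ; *-homo = λ (a , b) (c , d) →
          trans (⟦⟧≈difference (a ℕ.* c ℕ.+ b ℕ.* d) (a ℕ.* d ℕ.+ b ℕ.* c))
            (trans (+-cong (×-foil a b c d) (-‿cong (×-foil a b d c)))
              (trans (sym (foil _ _ _ _))
                (sym (*-cong (⟦⟧≈difference a b) (⟦⟧≈difference c d)))))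
      ; -‿homo = λ (a , b) →
          trans (⟦⟧≈difference b a)
            (trans (trans (+-comm _ _) (trans (+-congˡ (sym (-‿involutive _))) (⁻¹-∙-comm _ _)))
              (-‿cong (sym (⟦⟧≈difference a b))))
      ; 0-homo = refl
      ; 1-homo = refl
      }

    -- Cross sums decide equality of the differences as integers, which every ring inherits; no
    -- refutation is asked for, since different integers may agree in R.
    equal : ∀ x y → Maybe.Maybe (⟦ x ⟧ ≈ ⟦ y ⟧)
    equal (a , b) (c , d) = Maybe.map sound (dec⇒weaklyDec ℕ._≟_ (a ℕ.+ d) (c ℕ.+ b))
      where
      sound : a ℕ.+ d ≡ c ℕ.+ b → ⟦ a , b ⟧ ≈ ⟦ c , d ⟧
      sound e = trans (⟦⟧≈difference a b) (trans (x∙y⁻¹≈ε⇒x≈y _ _ (begin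
        difference a b - difference c d
          ≈⟨ +-congˡ (trans (sym (⁻¹-∙-comm _ _)) (trans (+-congˡ (-‿involutive _)) (+-comm _ _))) ⟩
        difference a b + difference d c
          ≈⟨ sym (+-homo a b d c) ⟩
        (a ℕ.+ d) ×ₙ 1# - (b ℕ.+ c) ×ₙ 1#
          ≡⟨ ≡.cong₂ (λ m n → m ×ₙ 1# - n ×ₙ 1#) e (ℕ.+-comm b c) ⟩
        (c ℕ.+ b) ×ₙ 1# - (c ℕ.+ b) ×ₙ 1#
          ≈⟨ -‿inverseʳ _ ⟩
        0# ∎)) (sym (⟦⟧≈difference c d)))

  open RingSolver differences (fromCommutativeRing R) morphism equal public
    using (solve; _:+_; _:*_; _:-_; :-_; con; _:=_)

  infix 9 :0 :1
  :0 :1 : ∀ {n} → RingSolver.Polynomial differences (fromCommutativeRing R) morphism equal n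
  :0 = con (0 , 0)
  :1 = con (1 , 0)

-- Polynomials

module _ {c ℓ} (M : CommutativeMonoid c ℓ) where
  open CommutativeMonoid M
  open RawMonoidDefs rawMonoid using (sum)
  open MonoidSum M using (sum-cong-≋; sum-replicate-zero)

  sum-cong : ∀ n {f g : Vector Carrier n} → (∀ i → f i ≈ g i) → sum f ≈ sum g
  sum-cong n = sum-cong-≋

  sum-ε : ∀ {n} (f : Vector Carrier n) → (∀ i → f i ≈ ε) → sum f ≈ ε
  sum-ε {n} f f≈ε = trans (sum-cong-≋ f≈ε) (sum-replicate-zero n)

  sum-single : ∀ {n} (f : Vector Carrier n) j → (∀ i → i ≢ j → f i ≈ ε) → sum f ≈ f j
  sum-single f zero    f≈ε = trans (∙-congˡ (sum-ε (f ∘ suc) λ i → f≈ε (suc i) λ ())) (identityʳ _)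
  sum-single f (suc j) f≈ε = trans (∙-cong (f≈ε zero λ ())
    (sum-single (f ∘ suc) j λ i i≢j → f≈ε (suc i) λ { ≡.refl → i≢j ≡.refl })) (identityˡ _)

module _ {a ℓ b ℓ′} {A : RawMonoid a ℓ} (B : CommutativeMonoid b ℓ′) where
  private
    module A = RawMonoid A
    module B = CommutativeMonoid B

  -- One statement serves sums and products, of numbers, polynomials and signs alike: a product is
  -- the sum of the multiplicative monoid.
  sum-homo : (h : A.Carrier → B.Carrier) → h A.ε B.≈ B.ε → (∀ x y → h (x A.∙ y) B.≈ h x B.∙ h y) →
    ∀ {n} (f : Vector A.Carrier n) → h (RawMonoidDefs.sum A f) B.≈ RawMonoidDefs.sum B.rawMonoid (h ∘ f)
  sum-homo h ε-homo ∙-homo {zero}  f = ε-homo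
  sum-homo h ε-homo ∙-homo {suc n} f =
    B.trans (∙-homo _ _) (B.∙-congˡ (sum-homo h ε-homo ∙-homo (f ∘ suc)))

module PolynomialProperties {c ℓ} (R : CommutativeRing c ℓ) where
  open CommutativeRing R hiding (zero)
  open RawSemiringDefs (Semiring.rawSemiring semiring) using (product)
  open Polynomials R public
  open Solver R
  open RingProperties ring using (-0#≈0#)
  open GroupProperties +-group using () renaming (x∙y⁻¹≈ε⇒x≈y to x-y≈0⇒x≈y)
  open SetoidReasoning setoid
  module Poly = CommutativeRing polyRing
  open RawMagmaDefs (Semiring.*-rawMagma Poly.semiring) using () renaming (_,_ to _,∣_)
  private k[T] = Semiring.rawSemiring Poly.semiring

  productₚ : ∀ {n} → Vector Poly n → Poly
  productₚ = RawSemiringDefs.product k[T]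

  -- Degree less than n. It is stated through coefficients because a list may end in zeros; the
  -- second half of `MonicOfDegree d` is `Below (suc d)`.
  Below : ℕ → Poly → Set ℓ
  Below n f = ∀ e → n ≤ e → coeff f e ≈ 0#

  ∷-cong : ∀ {a b f g} → a ≈ b → f ≈ₚ g → (a ∷ f) ≈ₚ (b ∷ g)
  ∷-cong p q = mk≈ₚ λ { zero → p ; (suc n) → coeff≈ q n }

  tail-cong : ∀ {a b f g} → (a ∷ f) ≈ₚ (b ∷ g) → f ≈ₚ g
  tail-cong p = mk≈ₚ (coeff≈ p ∘ suc)

  eval-0 : ∀ f x → f ≈ₚ [] → eval f x ≈ 0#
  eval-0 []      x p = refl
  eval-0 (a ∷ f) x p = trans (+-cong (coeff≈ p 0)
    (trans (*-congˡ (eval-0 f x (mk≈ₚ (coeff≈ p ∘ suc)))) (zeroʳ x))) (+-identityʳ 0#)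

  eval-congʳ : ∀ f {x y} → x ≈ y → eval f x ≈ eval f y
  eval-congʳ []      p = refl
  eval-congʳ (a ∷ f) p = +-congˡ (*-cong p (eval-congʳ f p))

  eval-congˡ : ∀ f g x → f ≈ₚ g → eval f x ≈ eval g x
  eval-congˡ []      g       x p = sym (eval-0 g x (Poly.sym p))
  eval-congˡ (a ∷ f) []      x p = eval-0 (a ∷ f) x p
  eval-congˡ (a ∷ f) (b ∷ g) x p =
    +-cong (coeff≈ p 0) (*-congˡ (eval-congˡ f g x (tail-cong p)))

  eval-+ : ∀ f g x → eval (f +ₚ g) x ≈ eval f x + eval g x
  eval-+ []      g       x = sym (+-identityˡ _)
  eval-+ (a ∷ f) []      x = sym (+-identityʳ _)
  eval-+ (a ∷ f) (b ∷ g) x = trans (+-congˡ (*-congˡ (eval-+ f g x)))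
    (solve 5 (λ a b x F G → (a :+ b) :+ x :* (F :+ G) := (a :+ x :* F) :+ (b :+ x :* G)) refl
      a b x (eval f x) (eval g x))

  eval-neg : ∀ f x → eval (-ₚ f) x ≈ - eval f x
  eval-neg []      x = sym -0#≈0#
  eval-neg (a ∷ f) x = trans (+-congˡ (*-congˡ (eval-neg f x)))
    (solve 3 (λ a x F → :- a :+ x :* :- F := :- (a :+ x :* F)) refl a x (eval f x))

  eval-- : ∀ f g x → eval (f +ₚ (-ₚ g)) x ≈ eval f x - eval g x
  eval-- f g x = trans (eval-+ f (-ₚ g) x) (+-congˡ (eval-neg g x))

  eval-· : ∀ a f x → eval (a ·ₚ f) x ≈ a * eval f x
  eval-· a []      x = sym (zeroʳ a)
  eval-· a (b ∷ f) x = trans (+-congˡ (*-congˡ (eval-· a f x)))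
    (solve 4 (λ a b x F → a :* b :+ x :* (a :* F) := a :* (b :+ x :* F)) refl a b x (eval f x))

  eval-* : ∀ f g x → eval (f *ₚ g) x ≈ eval f x * eval g x
  eval-* []      g x = sym (zeroˡ _)
  eval-* (a ∷ f) g x = begin
    eval (a ·ₚ g +ₚ (0# ∷ f *ₚ g)) x               ≈⟨ eval-+ (a ·ₚ g) _ x ⟩
    eval (a ·ₚ g) x + (0# + x * eval (f *ₚ g) x)   ≈⟨ +-cong (eval-· a g x) (+-congˡ (*-congˡ (eval-* f g x))) ⟩
    a * eval g x + (0# + x * (eval f x * eval g x))
      ≈⟨ solve 4 (λ a x F G → a :* G :+ (:0 :+ x :* (F :* G)) := (a :+ x :* F) :* G) refl
           a x (eval f x) (eval g x) ⟩
    eval (a ∷ f) x * eval g x                      ∎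

  eval-const : ∀ a x → eval (const a) x ≈ a
  eval-const a x = solve 2 (λ a x → a :+ x :* :0 := a) refl a x

  eval-T : ∀ x → eval T x ≈ x
  eval-T x = solve 1 (λ x → :0 :+ x :* (:1 :+ x :* :0) := x) refl x

  eval-product : ∀ {n} (f : Vector Poly n) x → eval (productₚ f) x ≈ product (λ i → eval (f i) x)
  eval-product f x = sum-homo {A = Poly.*-rawMonoid} *-commutativeMonoid
    (λ g → eval g x) (eval-const 1# x) (λ f g → eval-* f g x) f

  -- The quotient of f by T − x.
  synthetic : Poly → Carrier → Poly
  synthetic []      x = []
  synthetic (a ∷ f) x = eval f x ∷ synthetic f x

  -- Horner's scheme: the intermediate values in the evaluation at x are the coefficients of the
  -- quotient, and the final one is the remainder.
  eval-synthetic : ∀ f x y → eval f y ≈ (y - x) * eval (synthetic f x) y + eval f x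
  eval-synthetic []      x y = sym (trans (+-identityʳ _) (zeroʳ _))
  eval-synthetic (a ∷ f) x y = trans (+-congˡ (*-congˡ (eval-synthetic f x y)))
    (solve 5 (λ a x y S F → a :+ y :* ((y :- x) :* S :+ F)
        := (y :- x) :* (F :+ y :* S) :+ (a :+ x :* F)) refl
      a x y (eval (synthetic f x) y) (eval f x))

  -- Comparison of coefficients in f = (T - x) S + f(x). With `coeff₀-synthetic` this rebuilds f
  -- from its quotient S and its value at x.
  coeff-synthetic : ∀ f x n →
    coeff f (suc n) ≈ coeff (synthetic f x) n - x * coeff (synthetic f x) (suc n)
  coeff-synthetic []          x n       = sym
      (trans (+-congˡ (trans (-‿cong (zeroʳ x)) -0#≈0#)) (+-identityʳ 0#))
  coeff-synthetic (a ∷ [])    x zero    = solve 1 (λ x → :0 := :0 :- x :* :0) refl x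
  coeff-synthetic (a ∷ b ∷ f) x zero    =
    solve 3 (λ b x F → b := (b :+ x :* F) :- x :* F) refl b x (eval f x)
  coeff-synthetic (a ∷ f)     x (suc n) = coeff-synthetic f x n

  coeff₀-synthetic : ∀ f x → coeff f 0 ≈ eval f x - x * coeff (synthetic f x) 0
  coeff₀-synthetic []      x = solve 1 (λ x → :0 := :0 :- x :* :0) refl x
  coeff₀-synthetic (a ∷ f) x = solve 3 (λ a x F → a := (a :+ x :* F) :- x :* F) refl a x (eval f x)

  Below-0 : ∀ {f} → Below 0 f → f ≈ₚ []
  Below-0 p = mk≈ₚ λ n → p n z≤n

  Below-synthetic : ∀ n f x → Below (suc n) f → Below n (synthetic f x)
  Below-synthetic n       []      x p e       n≤e       = refl
  Below-synthetic zero    (a ∷ f) x p zero    n≤e       = eval-0 f x (mk≈ₚ λ n → p (suc n) (s≤s z≤n))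
  Below-synthetic zero    (a ∷ f) x p (suc e) n≤e       =
    Below-synthetic zero f x (λ e′ _ → p (suc e′) (s≤s z≤n)) e z≤n
  Below-synthetic (suc n) (a ∷ f) x p (suc e) (s≤s n≤e) =
    Below-synthetic n f x (λ e′ n≤e′ → p (suc e′) (s≤s n≤e′)) e n≤e

  Monic-synthetic : ∀ n f x → MonicOfDegree (suc n) f → MonicOfDegree n (synthetic f x)
  Monic-synthetic n f x (lead , high) = (begin
    coeff S n
      ≈⟨ solve 2 (λ s t → s := (s :- t) :+ t) refl _ (x * coeff S (suc n)) ⟩
    coeff S n - x * coeff S (suc n) + x * coeff S (suc n)
      ≈⟨ +-cong (sym (coeff-synthetic f x n)) (*-congˡ (below (suc n) ℕ.≤-refl)) ⟩
    coeff f (suc n) + x * 0#                        ≈⟨ +-cong lead (zeroʳ x) ⟩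
    1# + 0#                                         ≈⟨ +-identityʳ 1# ⟩
    1#                                              ∎) , below
    where
    S = synthetic f x
    below : Below (suc n) S
    below = Below-synthetic (suc n) f x high

  Below-+ : ∀ n {f g} → Below n f → Below n g → Below n (f +ₚ g)
  Below-+ n {f} {g} p r e n≤e =
    trans (coeff-+ f g e) (trans (+-cong (p e n≤e) (r e n≤e)) (+-identityʳ 0#))

  Below-- : ∀ n {f g} → Below n f → Below n g → Below n (f +ₚ (-ₚ g))
  Below-- n {f} {g} p r = Below-+ n {f} {(-ₚ g)} p λ e n≤e →
    trans (coeff-- g e) (trans (-‿cong (r e n≤e)) -0#≈0#)

  Below-· : ∀ n a {f} → Below n f → Below n (a ·ₚ f)
  Below-· n a {f} p e n≤e = trans (coeff-· a f e) (trans (*-congˡ (p e n≤e)) (zeroʳ a))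

  Below-mono : ∀ {m n f} → m ≤ n → Below m f → Below n f
  Below-mono m≤n p e n≤e = p e (ℕ.≤-trans m≤n n≤e)

  Below-cong : ∀ {n f g} → f ≈ₚ g → Below n f → Below n g
  Below-cong f≈g p e n≤e = trans (sym (coeff≈ f≈g e)) (p e n≤e)

  Monic-cong : ∀ {n f g} → f ≈ₚ g → MonicOfDegree n f → MonicOfDegree n g
  Monic-cong {n} {f} {g} f≈g (lead , high) =
    trans (sym (coeff≈ f≈g n)) lead , Below-cong {suc n} {f} {g} f≈g high

  Monic-difference : ∀ n {f g} → MonicOfDegree n f → MonicOfDegree n g → Below n (f +ₚ (-ₚ g))
  Monic-difference n {f} {g} (fₙ , f>n) (gₙ , g>n) e n≤e with ℕ.m≤n⇒m<n∨m≡n n≤e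
  ... | inj₁ n<e    = Below-- (suc n) {f} {g} f>n g>n e n<e
  ... | inj₂ ≡.refl = trans (coeff-+ f (-ₚ g) n)
      (trans (+-cong fₙ (trans (coeff-- g n) (-‿cong gₙ))) (-‿inverseʳ 1#))

  ≈ₚ-from-difference : ∀ f g → (f +ₚ (-ₚ g)) ≈ₚ [] → f ≈ₚ g
  ≈ₚ-from-difference f g p = mk≈ₚ λ n → x-y≈0⇒x≈y _ _
      (trans (sym (trans (coeff-+ f (-ₚ g) n) (+-congˡ (coeff-- g n)))) (coeff≈ p n))

  ∷-* : ∀ a f g n → coeff ((a ∷ f) *ₚ g) (suc n) ≈ a * coeff g (suc n) + coeff (f *ₚ g) n
  ∷-* a f g n = trans (coeff-+ (a ·ₚ g) _ (suc n)) (+-congʳ (coeff-· a g (suc n)))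

  ∷-*₀ : ∀ a f g → coeff ((a ∷ f) *ₚ g) 0 ≈ a * coeff g 0
  ∷-*₀ a f g = trans (coeff-+ (a ·ₚ g) _ 0) (trans (+-identityʳ _) (coeff-· a g 0))

  Monic-* : ∀ m n f g → MonicOfDegree m f → MonicOfDegree n g → MonicOfDegree (m ℕ.+ n) (f *ₚ g)
  Monic-* m n [] g (lead , _) _ = lead , λ _ _ → refl
  Monic-* zero n (a ∷ f) g (a≈1 , high) g-monic = Monic-cong {n} {g} {(a ∷ f) *ₚ g} (Poly.sym (Poly.trans
    (Poly.*-congʳ {g} {a ∷ f} {const 1#} (∷-cong {f = f} {[]} a≈1 (mk≈ₚ λ i → high (suc i) (s≤s z≤n))))
        (Poly.*-identityˡ g))) g-monic
  Monic-* (suc m) n (a ∷ f) g (lead , high) g-monic@(_ , g-high) = step-lead , step-high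
    where
    fg : MonicOfDegree (m ℕ.+ n) (f *ₚ g)
    fg = Monic-* m n f g (lead , λ i m<i → high (suc i) (s≤s m<i)) g-monic
    step : ∀ i → n ≤ i → coeff ((a ∷ f) *ₚ g) (suc i) ≈ coeff (f *ₚ g) i
    step i n≤i = trans (∷-* a f g i)
        (trans (+-congʳ (trans (*-congˡ (g-high (suc i) (s≤s n≤i))) (zeroʳ a))) (+-identityˡ _))
    step-lead : coeff ((a ∷ f) *ₚ g) (suc (m ℕ.+ n)) ≈ 1#
    step-lead = trans (step (m ℕ.+ n) (ℕ.m≤n+m n m)) (proj₁ fg)
    step-high : Below (suc (suc (m ℕ.+ n))) ((a ∷ f) *ₚ g)
    step-high (suc i) (s≤s m+n<i) = trans (step i (ℕ.≤-trans (ℕ.m≤n+m n m) (ℕ.<⇒≤ m+n<i))) (proj₂ fg i m+n<i)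

  Monic-product : ∀ G D (f : Fin G → Poly) →
      (∀ t → MonicOfDegree D (f t)) → MonicOfDegree (G ℕ.* D) (productₚ f)
  Monic-product zero    D f f-monic = refl , λ { (suc _) _ → refl }
  Monic-product (suc G) D f f-monic =
    Monic-* D (G ℕ.* D) (f zero) _ (f-monic zero) (Monic-product G D (f ∘ suc) (f-monic ∘ suc))

  Monic-productₚ : ∀ {n} (ρ : Vector Carrier n) → MonicOfDegree n (productₚ λ i → T +ₚ (-ₚ const (ρ i)))
  Monic-productₚ {zero}  ρ = refl , λ { (suc e) _ → refl }
  Monic-productₚ {suc n} ρ = Monic-* 1 n (T +ₚ (-ₚ const (ρ zero))) (productₚ λ i → T +ₚ (-ₚ const (ρ (suc i))))
    (refl , λ { (suc zero) (s≤s ()) ; (suc (suc e)) _ → refl }) (Monic-productₚ (ρ ∘ suc))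

  eval-linear : ∀ x y → eval (T +ₚ (-ₚ const x)) y ≈ y - x
  eval-linear x y = solve 2 (λ x y → (:0 :- x) :+ y :* (:1 :+ y :* :0) := y :- x) refl x y

  eval-productₚ : ∀ {n} (ρ : Vector Carrier n) y →
    eval (productₚ λ i → T +ₚ (-ₚ const (ρ i))) y ≈ product λ i → y - ρ i
  eval-productₚ ρ y = trans (eval-product (λ i → T +ₚ (-ₚ const (ρ i))) y)
    (sum-cong *-commutativeMonoid _ λ i → eval-linear (ρ i) y)

  -- In a g + T f g the coefficients above n come from f g alone, so f = 0 by induction; the
  -- coefficient at n is then a, as g is monic.
  monic-*-Below : ∀ n g → MonicOfDegree n g → ∀ f → Below n (f *ₚ g) → f ≈ₚ []
  monic-*-Below n g m@(lead , high) []      p = Poly.refl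
  monic-*-Below n g m@(lead , high) (a ∷ f) p = mk≈ₚ λ { zero → a≈0 ; (suc i) → coeff≈ f≈0 i }
    where
    f≈0 : f ≈ₚ []
    f≈0 = monic-*-Below n g m f λ e n≤e → begin
      coeff (f *ₚ g) e                           ≈⟨ sym (+-identityˡ _) ⟩
      0# + coeff (f *ₚ g) e
        ≈⟨ +-congʳ (sym (trans (*-congˡ (high (suc e) (s≤s n≤e))) (zeroʳ a))) ⟩
      a * coeff g (suc e) + coeff (f *ₚ g) e     ≈⟨ sym (∷-* a f g e) ⟩
      coeff ((a ∷ f) *ₚ g) (suc e)               ≈⟨ p (suc e) (ℕ.m≤n⇒m≤1+n n≤e) ⟩
      0#                                         ∎
    top : ∀ n → coeff ((a ∷ f) *ₚ g) n ≈ a * coeff g n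
    top zero    = ∷-*₀ a f g
    top (suc n) = trans (∷-* a f g n)
      (trans (+-congˡ (coeff≈ (Poly.trans (Poly.*-congʳ f≈0) (Poly.zeroˡ g)) n)) (+-identityʳ _))
    a≈0 : a ≈ 0#
    a≈0 = begin
      a                          ≈⟨ sym (*-identityʳ a) ⟩
      a * 1#                     ≈⟨ *-congˡ (sym lead) ⟩
      a * coeff g n              ≈⟨ sym (top n) ⟩
      coeff ((a ∷ f) *ₚ g) n     ≈⟨ p n ℕ.≤-refl ⟩
      0#                         ∎

  -- If f = q g + s, then a + T f = (T q) g + (a + T s), where a + T s has degree at most n; its
  -- coefficient t at n is removed by subtracting t g, g being monic.
  divMod : ∀ n g → MonicOfDegree n g → ∀ f → ∃[ q ] ∃[ s ] Below n s × f ≈ₚ (q *ₚ g +ₚ s)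
  divMod n g m []      = [] , [] , (λ _ _ → refl) , Poly.refl
  divMod n g m@(lead , high) (a ∷ f) with divMod n g m f
  ... | q , s , s<n , f≈ = t ∷ q , s′ +ₚ (-ₚ (t ·ₚ g)) , below , eq
    where
    s′ = a ∷ s
    t = coeff s′ n
    below : Below n (s′ +ₚ (-ₚ (t ·ₚ g)))
    below e n≤e = trans (trans (coeff-+ s′ (-ₚ (t ·ₚ g)) e)
        (+-congˡ (trans (coeff-- (t ·ₚ g) e) (-‿cong (coeff-· t g e)))))
      (case e n≤e (ℕ.m≤n⇒m<n∨m≡n n≤e))
      where
      case : ∀ e → n ≤ e → n < e ⊎ n ≡ e → coeff s′ e - t * coeff g e ≈ 0#
      case e       _ (inj₂ ≡.refl)    = trans (+-congˡ (-‿cong (trans (*-congˡ lead) (*-identityʳ t))))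
          (-‿inverseʳ t)
      case (suc e) _ (inj₁ (s≤s n≤e)) = trans
          (+-cong (s<n e n≤e) (-‿cong (trans (*-congˡ (high (suc e) (s≤s n≤e))) (zeroʳ t)))) (-‿inverseʳ 0#)
    eq : (a ∷ f) ≈ₚ ((t ∷ q) *ₚ g +ₚ (s′ +ₚ (-ₚ (t ·ₚ g))))
    eq = mk≈ₚ λ i → trans (shape i) (sym (trans (coeff-+ ((t ∷ q) *ₚ g) _ i) (+-cong
        (trans (coeff-+ (t ·ₚ g) _ i) (+-congʳ (coeff-· t g i)))
        (trans (coeff-+ s′ (-ₚ (t ·ₚ g)) i) (+-congˡ (trans (coeff-- (t ·ₚ g) i) (-‿cong (coeff-· t g i))))))))
      where
      shape : ∀ i → coeff (a ∷ f) i ≈ (t * coeff g i + coeff (0# ∷ q *ₚ g) i) + (coeff s′ i - t * coeff g i)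
      shape zero    = solve 2 (λ a x → a := (x :+ :0) :+ (a :- x)) refl a (t * coeff g 0)
      shape (suc i) = trans (trans (coeff≈ f≈ i) (coeff-+ (q *ₚ g) s i))
        (solve 3 (λ u s x → u :+ s := (x :+ u) :+ (s :- x)) refl (coeff (q *ₚ g) i) (coeff s i)
            (t * coeff g (suc i)))

  multiple⇒≈mod : ∀ M f g → ∃[ u ] (u *ₚ M) ≈ₚ (f +ₚ (-ₚ g)) → CommutativeRing._≈_ (quotient polyRing M) f g
  multiple⇒≈mod M f g (u , e) = mkMod (u ,∣ e)

  ≈mod⇒multiple : ∀ M f g → CommutativeRing._≈_ (quotient polyRing M) f g → ∃[ u ] (u *ₚ M) ≈ₚ (f +ₚ (-ₚ g))
  ≈mod⇒multiple M f g (mkMod (u ,∣ e)) = u , e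

  -- Leibniz' rule for a + T f. In this form no integer multiples of coefficients occur, and the
  -- properties follow by induction along the list.
  derivative : Poly → Poly
  derivative []      = []
  derivative (a ∷ f) = f +ₚ (0# ∷ derivative f)

  derivative-0 : ∀ f x → f ≈ₚ [] → eval (derivative f) x ≈ 0#
  derivative-0 []      x p = refl
  derivative-0 (a ∷ f) x p = begin
    eval (f +ₚ (0# ∷ derivative f)) x         ≈⟨ eval-+ f _ x ⟩
    eval f x + (0# + x * eval (derivative f) x)
      ≈⟨ +-cong (eval-0 f x f≈0) (+-congˡ (*-congˡ (derivative-0 f x f≈0))) ⟩
    0# + (0# + x * 0#)                        ≈⟨ solve 1 (λ x → :0 :+ (:0 :+ x :* :0) := :0) refl x ⟩
    0#                                        ∎
    where
    f≈0 : f ≈ₚ []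
    f≈0 = mk≈ₚ (coeff≈ p ∘ suc)

  derivative-cong : ∀ f g x → f ≈ₚ g → eval (derivative f) x ≈ eval (derivative g) x
  derivative-cong []      g       x p = sym (derivative-0 g x (Poly.sym p))
  derivative-cong (a ∷ f) []      x p = derivative-0 (a ∷ f) x p
  derivative-cong (a ∷ f) (b ∷ g) x p = trans (eval-+ f _ x) (trans
    (+-cong (eval-congˡ f g x (tail-cong p)) (+-congˡ (*-congˡ (derivative-cong f g x (tail-cong p)))))
    (sym (eval-+ g _ x)))

  derivative-+ : ∀ f g x → eval (derivative (f +ₚ g)) x ≈ eval (derivative f) x + eval (derivative g) x
  derivative-+ []      g       x = sym (+-identityˡ _)
  derivative-+ (a ∷ f) []      x = sym (+-identityʳ _)
  derivative-+ (a ∷ f) (b ∷ g) x = begin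
    eval (f +ₚ g +ₚ (0# ∷ derivative (f +ₚ g))) x
      ≈⟨ trans (eval-+ (f +ₚ g) _ x) (+-cong (eval-+ f g x) (+-congˡ (*-congˡ (derivative-+ f g x)))) ⟩
    (eval f x + eval g x) + (0# + x * (eval (derivative f) x + eval (derivative g) x))
      ≈⟨ solve 5 (λ x F G F′ G′ → (F :+ G) :+ (:0 :+ x :* (F′ :+ G′))
           := (F :+ (:0 :+ x :* F′)) :+ (G :+ (:0 :+ x :* G′))) refl
           x (eval f x) (eval g x) (eval (derivative f) x) (eval (derivative g) x) ⟩
    (eval f x + (0# + x * eval (derivative f) x)) + (eval g x + (0# + x * eval (derivative g) x))
      ≈⟨ sym (+-cong (eval-+ f _ x) (eval-+ g _ x)) ⟩
    eval (derivative (a ∷ f)) x + eval (derivative (b ∷ g)) x ∎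

  derivative-· : ∀ a f x → eval (derivative (a ·ₚ f)) x ≈ a * eval (derivative f) x
  derivative-· a []      x = sym (zeroʳ a)
  derivative-· a (b ∷ f) x = begin
    eval (a ·ₚ f +ₚ (0# ∷ derivative (a ·ₚ f))) x
      ≈⟨ trans (eval-+ (a ·ₚ f) _ x) (+-cong (eval-· a f x) (+-congˡ (*-congˡ (derivative-· a f x)))) ⟩
    a * eval f x + (0# + x * (a * eval (derivative f) x))
      ≈⟨ solve 4 (λ a x F F′ → a :* F :+ (:0 :+ x :* (a :* F′)) := a :* (F :+ (:0 :+ x :* F′))) refl
           a x (eval f x) (eval (derivative f) x) ⟩
    a * (eval f x + (0# + x * eval (derivative f) x))
      ≈⟨ *-congˡ (sym (eval-+ f _ x)) ⟩
    a * eval (derivative (b ∷ f)) x ∎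

  derivative-* : ∀ f g x → eval (derivative (f *ₚ g)) x ≈
    eval (derivative f) x * eval g x + eval f x * eval (derivative g) x
  derivative-* []      g x = solve 2 (λ G G′ → :0 := :0 :* G :+ :0 :* G′) refl (eval g x)
      (eval (derivative g) x)
  derivative-* (a ∷ f) g x = begin
    eval (derivative (a ·ₚ g +ₚ (0# ∷ f *ₚ g))) x
      ≈⟨ trans (derivative-+ (a ·ₚ g) (0# ∷ f *ₚ g) x) (+-cong (derivative-· a g x) (trans (eval-+ (f *ₚ g) _ x)
           (+-cong (eval-* f g x) (+-congˡ (*-congˡ (derivative-* f g x)))))) ⟩
    a * G′ + (F * G + (0# + x * (F′ * G + F * G′)))
      ≈⟨ solve 6 (λ a x F G F′ G′ → a :* G′ :+ (F :* G :+ (:0 :+ x :* (F′ :* G :+ F :* G′)))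
           := (F :+ (:0 :+ x :* F′)) :* G :+ (a :+ x :* F) :* G′) refl a x F G F′ G′ ⟩
    (F + (0# + x * F′)) * G + (a + x * F) * G′
      ≈⟨ +-congʳ (*-congʳ (sym (eval-+ f _ x))) ⟩
    eval (derivative (a ∷ f)) x * G + eval (a ∷ f) x * G′ ∎
    where
    F = eval f x
    G = eval g x
    F′ = eval (derivative f) x
    G′ = eval (derivative g) x

  derivative-linear : ∀ x y → eval (derivative (T +ₚ (-ₚ const x))) y ≈ 1#
  derivative-linear x y = solve 1 (λ y → (:1 :+ :0) :+ y :* (:0 :+ y :* :0) := :1) refl y

-- Ring homomorphisms acting on coefficients

module Homomorphism {c ℓ c′ ℓ′} (R : CommutativeRing c ℓ) (S : CommutativeRing c′ ℓ′)
  (h : CommutativeRing.Carrier R → CommutativeRing.Carrier S)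
  (isRingHomomorphism : RingMorphisms.IsRingHomomorphism
    (CommutativeRing.rawRing R) (CommutativeRing.rawRing S) h)
  where
  private
    module R where
      open CommutativeRing R public
      open PolynomialProperties R public
      open RawSemiringDefs (Semiring.rawSemiring semiring) public using (sum; product; _^_)
    module S where
      open CommutativeRing S public
      open PolynomialProperties S public
      open RawSemiringDefs (Semiring.rawSemiring semiring) public using (sum; product; _^_)
  open RingMorphisms.IsRingHomomorphism isRingHomomorphism public
    using (⟦⟧-cong; +-homo; *-homo; -‿homo; 0#-homo; 1#-homo)

  sum-homomorphic : ∀ {n} (f : Vector R.Carrier n) → h (R.sum f) S.≈ S.sum (h ∘ f)
  sum-homomorphic = sum-homo {A = R.+-rawMonoid} S.+-commutativeMonoid h 0#-homo +-homo

  product-homomorphic : ∀ {n} (f : Vector R.Carrier n) → h (R.product f) S.≈ S.product (h ∘ f)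
  product-homomorphic = sum-homo {A = R.*-rawMonoid} S.*-commutativeMonoid h 1#-homo *-homo

  ^-homomorphic : ∀ x n → h (x R.^ n) S.≈ h x S.^ n
  ^-homomorphic x zero    = 1#-homo
  ^-homomorphic x (suc n) = S.trans (*-homo _ _) (S.*-congˡ (^-homomorphic x n))

  difference-homo : ∀ x y → h (x R.- y) S.≈ h x S.- h y
  difference-homo x y = S.trans (+-homo _ _) (S.+-congˡ (-‿homo y))

  coeff-map : ∀ f n → S.coeff (List.map h f) n S.≈ h (R.coeff f n)
  coeff-map []      n       = S.sym 0#-homo
  coeff-map (a ∷ f) zero    = S.refl
  coeff-map (a ∷ f) (suc n) = coeff-map f n

  map-cong : ∀ {f g} → f R.≈ₚ g → List.map h f S.≈ₚ List.map h g
  map-cong {f} {g} p = S.mk≈ₚ λ n →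
    S.trans (coeff-map f n) (S.trans (⟦⟧-cong (R.coeff≈ p n)) (S.sym (coeff-map g n)))

  map-+ : ∀ f g → List.map h (f R.+ₚ g) S.≈ₚ (List.map h f S.+ₚ List.map h g)
  map-+ []      g       = S.Poly.refl
  map-+ (a ∷ f) []      = S.Poly.refl
  map-+ (a ∷ f) (b ∷ g) = S.∷-cong (+-homo a b) (map-+ f g)

  map-neg : ∀ f → List.map h (R.-ₚ f) S.≈ₚ (S.-ₚ List.map h f)
  map-neg []      = S.Poly.refl
  map-neg (a ∷ f) = S.∷-cong (-‿homo a) (map-neg f)

  map-difference : ∀ f g → List.map h (f R.+ₚ (R.-ₚ g)) S.≈ₚ (List.map h f S.+ₚ (S.-ₚ List.map h g))
  map-difference f g = S.Poly.trans (map-+ f (R.-ₚ g)) (S.Poly.+-congˡ {List.map h f} (map-neg g))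

  map-· : ∀ a f → List.map h (a R.·ₚ f) S.≈ₚ (h a S.·ₚ List.map h f)
  map-· a []      = S.Poly.refl
  map-· a (b ∷ f) = S.∷-cong (*-homo a b) (map-· a f)

  map-* : ∀ f g → List.map h (f R.*ₚ g) S.≈ₚ (List.map h f S.*ₚ List.map h g)
  map-* []      g = S.Poly.refl
  map-* (a ∷ f) g = S.Poly.trans (map-+ (a R.·ₚ g) _)
    (S.Poly.+-cong (map-· a g) (S.∷-cong 0#-homo (map-* f g)))

  map-product : ∀ {n} (f : Vector R.Poly n) →
    List.map h (R.productₚ f) S.≈ₚ S.productₚ (λ i → List.map h (f i))
  map-product = sum-homo {A = R.Poly.*-rawMonoid} S.Poly.*-commutativeMonoid (List.map h)
    (S.∷-cong 1#-homo S.Poly.refl) map-*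

  eval-map : ∀ f x → S.eval (List.map h f) (h x) S.≈ h (R.eval f x)
  eval-map []      x = S.sym 0#-homo
  eval-map (a ∷ f) x = S.trans (S.+-congˡ (S.*-congˡ (eval-map f x)))
    (S.sym (S.trans (+-homo _ _) (S.+-congˡ (*-homo _ _))))

  derivative-map : ∀ f → List.map h (R.derivative f) S.≈ₚ S.derivative (List.map h f)
  derivative-map []      = S.Poly.refl
  derivative-map (a ∷ f) = S.Poly.trans (map-+ f _)
    (S.Poly.+-congˡ {List.map h f} (S.∷-cong 0#-homo (derivative-map f)))

  Monic-map : ∀ n {f} → R.MonicOfDegree n f → S.MonicOfDegree n (List.map h f)
  Monic-map n {f} (lead , high) =
      S.trans (coeff-map f n) (S.trans (⟦⟧-cong lead) 1#-homo)
    , λ e n<e → S.trans (coeff-map f e) (S.trans (⟦⟧-cong (high e n<e)) 0#-homo)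

-- Polynomials over a field and their roots

module FieldProperties {c ℓ} (F : Field c ℓ) where
  open Field F hiding (zero)
  open RawSemiringDefs (Semiring.rawSemiring semiring) using (product; _^_)
  open PolynomialProperties commutativeRing
  open Solver commutativeRing
  open GroupProperties +-group public using () renaming (x∙y⁻¹≈ε⇒x≈y to x-y≈0⇒x≈y; x≈y⇒x∙y⁻¹≈ε to x≈y⇒x-y≈0)
  open SetoidReasoning setoid

  product-cong : ∀ n {f g : Vector Carrier n} → (∀ i → f i ≈ g i) → product f ≈ product g
  product-cong = sum-cong *-commutativeMonoid

  *-cancel-0 : ∀ x y → ¬ x ≈ 0# → x * y ≈ 0# → y ≈ 0#
  *-cancel-0 x y x≉0 e with inverse x x≉0
  ... | x⁻¹ , i = begin
      y              ≈⟨ sym (*-identityˡ y) ⟩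
      1# * y         ≈⟨ *-congʳ (sym i) ⟩
      x⁻¹ * x * y    ≈⟨ *-assoc x⁻¹ x y ⟩
      x⁻¹ * (x * y)  ≈⟨ *-congˡ e ⟩
      x⁻¹ * 0#       ≈⟨ zeroʳ x⁻¹ ⟩
      0#             ∎

  *-cancelˡ : ∀ x {y z} → ¬ x ≈ 0# → x * y ≈ x * z → y ≈ z
  *-cancelˡ x {y} {z} x≉0 e = x-y≈0⇒x≈y y z (*-cancel-0 x (y - z) x≉0 (begin
    x * (y - z)      ≈⟨ solve 3 (λ x y z → x :* (y :- z) := x :* y :- x :* z) refl x y z ⟩
    x * y - x * z    ≈⟨ x≈y⇒x-y≈0 e ⟩
    0#               ∎))

  *-nonzero : ∀ {x y} → ¬ x ≈ 0# → ¬ y ≈ 0# → ¬ x * y ≈ 0#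
  *-nonzero {x} {y} x≉0 y≉0 e = y≉0 (*-cancel-0 x y x≉0 e)

  ^-nonzero : ∀ {x} n → ¬ x ≈ 0# → ¬ x ^ n ≈ 0#
  ^-nonzero zero    x≉0 = 1≉0
  ^-nonzero (suc n) x≉0 = *-nonzero x≉0 (^-nonzero n x≉0)

  unit-nonzero : ∀ {x y} → x * y ≈ 1# → ¬ y ≈ 0#
  unit-nonzero xy≈1 y≈0 = 1≉0 (trans (sym xy≈1) (trans (*-congˡ y≈0) (zeroʳ _)))

  product-zero : ∀ {n} (f : Vector Carrier n) → product f ≈ 0# → ∃[ i ] f i ≈ 0#
  product-zero {zero}  f e = ⊥-elim (1≉0 e)
  product-zero {suc n} f e with f zero ≟ 0#
  ... | yes f₀≈0 = zero , f₀≈0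
  ... | no  f₀≉0 with product-zero (f ∘ suc) (*-cancel-0 _ _ f₀≉0 e)
  ...   | i , fᵢ≈0 = suc i , fᵢ≈0

  product-nonzero : ∀ {n} (f : Vector Carrier n) → (∀ i → ¬ f i ≈ 0#) → ¬ product f ≈ 0#
  product-nonzero f f≉0 e with product-zero f e
  ... | i , fᵢ≈0 = f≉0 i fᵢ≈0

  zero-product : ∀ {n} (f : Vector Carrier n) i → f i ≈ 0# → product f ≈ 0#
  zero-product f zero    e = trans (*-congʳ e) (zeroˡ _)
  zero-product f (suc i) e = trans (*-congˡ (zero-product (f ∘ suc) i e)) (zeroʳ _)

  Distinct : ∀ {n} → Vector Carrier n → Set ℓ
  Distinct ρ = ∀ i j → ρ i ≈ ρ j → i ≡ j

  -- The quotient by T - ρ₀ vanishes at the remaining roots, so it is zero by induction; f is then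
  -- the constant f(ρ₀) = 0, as the coefficient formulas for `synthetic` express.
  vanishing : ∀ n f (ρ : Vector Carrier n) → Distinct ρ → Below n f →
    (∀ i → eval f (ρ i) ≈ 0#) → f ≈ₚ []
  vanishing zero    f ρ distinct f<n f≈0 = Below-0 {f} f<n
  vanishing (suc n) f ρ distinct f<n f≈0 = mk≈ₚ λ
    { zero → trans (coeff₀-synthetic f x) (trans
        (+-cong (f≈0 zero) (-‿cong (*-congˡ (coeff≈ g≈0 0)))) (0-x*0 x))
    ; (suc e) → trans (coeff-synthetic f x e) (trans
        (+-cong (coeff≈ g≈0 e) (-‿cong (*-congˡ (coeff≈ g≈0 (suc e))))) (0-x*0 x))
    }
    where
    x = ρ zero
    0-x*0 : ∀ x → 0# - x * 0# ≈ 0#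
    0-x*0 x = solve 1 (λ x → :0 :- x :* :0 := :0) refl x
    g≈0 : synthetic f x ≈ₚ []
    g≈0 = vanishing n (synthetic f x) (ρ ∘ suc) (λ i j e → Fin.suc-injective (distinct (suc i) (suc j) e))
      (Below-synthetic n f x f<n) λ i → *-cancel-0 (ρ (suc i) - x) _
        (λ e → Fin.0≢1+n (≡.sym (distinct (suc i) zero (x-y≈0⇒x≈y _ _ e))))
        (begin
          (ρ (suc i) - x) * eval (synthetic f x) (ρ (suc i))
            ≈⟨ sym (trans (+-congˡ (f≈0 zero)) (+-identityʳ _)) ⟩
          (ρ (suc i) - x) * eval (synthetic f x) (ρ (suc i)) + eval f x
            ≈⟨ sym (eval-synthetic f x (ρ (suc i))) ⟩
          eval f (ρ (suc i))
            ≈⟨ f≈0 (suc i) ⟩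
          0# ∎)

  agreeing : ∀ n f g (ρ : Vector Carrier n) → Distinct ρ → Below n (f +ₚ (-ₚ g)) →
    (∀ i → eval f (ρ i) ≈ eval g (ρ i)) → f ≈ₚ g
  agreeing n f g ρ distinct f-g<n f≈g = ≈ₚ-from-difference f g
    (vanishing n _ ρ distinct f-g<n λ i → trans (eval-- f g (ρ i)) (x≈y⇒x-y≈0 (f≈g i)))

  monic-agreeing : ∀ n f g (ρ : Vector Carrier n) → Distinct ρ →
    MonicOfDegree n f → MonicOfDegree n g → (∀ i → eval f (ρ i) ≈ eval g (ρ i)) → f ≈ₚ g
  monic-agreeing n f g ρ distinct f-monic g-monic =
    agreeing n f g ρ distinct (Monic-difference n {f} {g} f-monic g-monic)

  factorization : ∀ n f (ρ : Vector Carrier n) → Distinct ρ →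
    MonicOfDegree n f → (∀ i → eval f (ρ i) ≈ 0#) → f ≈ₚ productₚ λ i → T +ₚ (-ₚ const (ρ i))
  factorization n f ρ distinct f-monic f≈0 =
    monic-agreeing n f _ ρ distinct f-monic (Monic-productₚ ρ) λ i →
      trans (f≈0 i) (sym (trans (eval-productₚ ρ (ρ i)) (zero-product _ i (-‿inverseʳ (ρ i)))))

  vanishing-divisible : ∀ n g (ρ : Vector Carrier n) → Distinct ρ →
    MonicOfDegree n g → (∀ i → eval g (ρ i) ≈ 0#) →
    ∀ f → (∀ i → eval f (ρ i) ≈ 0#) → ∃[ q ] (q *ₚ g) ≈ₚ f
  vanishing-divisible n g ρ distinct g-monic g≈0 f f≈0 with divMod n g g-monic f
  ... | q , s , s<n , f≈ = q , Poly.sym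
      (Poly.trans f≈ (Poly.trans (Poly.+-congˡ {q *ₚ g} s≈0) (Poly.+-identityʳ _)))
    where
    s≈0 : s ≈ₚ []
    s≈0 = vanishing n s ρ distinct s<n λ i → begin
      eval s (ρ i)
        ≈⟨ sym (trans (+-congʳ (trans (*-congˡ (g≈0 i)) (zeroʳ _))) (+-identityˡ _)) ⟩
      eval q (ρ i) * eval g (ρ i) + eval s (ρ i)
        ≈⟨ sym (trans (eval-+ (q *ₚ g) s (ρ i)) (+-congʳ (eval-* q g (ρ i)))) ⟩
      eval (q *ₚ g +ₚ s) (ρ i)                ≈⟨ sym (eval-congˡ f _ (ρ i) f≈) ⟩
      eval f (ρ i)                            ≈⟨ f≈0 i ⟩
      0#                                      ∎

  -- The remainder of the difference has degree below n and n distinct roots. Equality modulo g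
  -- thereby reduces to values, which is how the identities in the algebra `L̄` are checked.
  agreeing-mod : ∀ n g (ρ : Vector Carrier n) → Distinct ρ →
    MonicOfDegree n g → (∀ i → eval g (ρ i) ≈ 0#) →
    ∀ f f′ → (∀ i → eval f (ρ i) ≈ eval f′ (ρ i)) → CommutativeRing._≈_ (quotient polyRing g) f f′
  agreeing-mod n g ρ distinct g-monic g≈0 f f′ e = multiple⇒≈mod g f f′
    (vanishing-divisible n g ρ distinct g-monic g≈0 (f +ₚ (-ₚ f′))
      λ i → trans (eval-- f f′ (ρ i)) (x≈y⇒x-y≈0 (e i)))

  -- The value at x of the derivative of f = (T - x) S + f(x); there `synthetic` and `derivative`
  -- satisfy the same recursion.
  eval-synthetic-derivative : ∀ f x → eval (synthetic f x) x ≈ eval (derivative f) x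
  eval-synthetic-derivative []      x = refl
  eval-synthetic-derivative (a ∷ f) x = trans
    (+-congˡ (trans (*-congˡ (eval-synthetic-derivative f x)) (sym (+-identityˡ _))))
    (sym (eval-+ f _ x))

  eval-synthetic-other : ∀ f x y → eval f x ≈ 0# → eval f y ≈ 0# → ¬ y ≈ x → eval (synthetic f x) y ≈ 0#
  eval-synthetic-other f x y fx≈0 fy≈0 y≉x = *-cancel-0 (y - x) _ (y≉x ∘ x-y≈0⇒x≈y y x) (begin
    (y - x) * eval (synthetic f x) y              ≈⟨ sym (trans (+-congˡ fx≈0) (+-identityʳ _)) ⟩
    (y - x) * eval (synthetic f x) y + eval f x   ≈⟨ sym (eval-synthetic f x y) ⟩
    eval f y                                      ≈⟨ fy≈0 ⟩
    0#                                            ∎)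

  -- The omitted factor is replaced by 1, so that the index set stays `Fin n`, just as the product
  -- over j ≠ i is encoded in `positionSign`.
  except : ∀ {n} → Fin n → Vector Carrier n → Vector Carrier n
  except i f j = if does (j Fin.≟ i) then 1# else f j

  -- By Leibniz' rule only the term that differentiates `f i` survives: every other one keeps the
  -- factor f_i(x) = 0.
  derivative-product : ∀ {n} (f : Vector Poly n) i x → eval (f i) x ≈ 0# →
    eval (derivative (productₚ f)) x ≈
      eval (derivative (f i)) x * product (except i λ j → eval (f j) x)
  derivative-product f zero x e = begin
    eval (derivative (f zero *ₚ productₚ (f ∘ suc))) x
      ≈⟨ derivative-* (f zero) _ x ⟩
    eval (derivative (f zero)) x * eval (productₚ (f ∘ suc)) x + eval (f zero) x * _
      ≈⟨ +-cong (*-congˡ (eval-product (f ∘ suc) x)) (trans (*-congʳ e) (zeroˡ _)) ⟩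
    eval (derivative (f zero)) x * product (λ j → eval (f (suc j)) x) + 0#
      ≈⟨ solve 2 (λ a b → a :* b :+ :0 := a :* (:1 :* b)) refl _ _ ⟩
    eval (derivative (f zero)) x * product (except zero λ j → eval (f j) x) ∎
  derivative-product f (suc i) x e = begin
    eval (derivative (f zero *ₚ productₚ (f ∘ suc))) x
      ≈⟨ derivative-* (f zero) _ x ⟩
    _ * eval (productₚ (f ∘ suc)) x + eval (f zero) x * eval (derivative (productₚ (f ∘ suc))) x
      ≈⟨ +-cong (*-congˡ (trans (eval-product (f ∘ suc) x) (zero-product (λ j → eval (f (suc j)) x) i e)))
           (*-congˡ (derivative-product (f ∘ suc) i x e)) ⟩
    _ * 0# + eval (f zero) x * (eval (derivative (f (suc i))) x * product (except i λ j → eval (f (suc j)) x))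
      ≈⟨ solve 4 (λ a b c d → a :* :0 :+ b :* (c :* d) := c :* (b :* d)) refl _ _ _ _ ⟩
    eval (derivative (f (suc i))) x * product (except (suc i) λ j → eval (f j) x) ∎

  product-except-cong : ∀ {n} i (f g : Vector Carrier n) → (∀ j → f j ≈ g j) →
    product (except i f) ≈ product (except i g)
  product-except-cong i f g f≈g = product-cong _ lemma
    where
    lemma : ∀ j → except i f j ≈ except i g j
    lemma j with does (j Fin.≟ i)
    ... | true  = refl
    ... | false = f≈g j

  derivative-productₚ : ∀ {n} (ρ : Vector Carrier n) i →
    eval (derivative (productₚ λ j → T +ₚ (-ₚ const (ρ j)))) (ρ i) ≈ product (except i λ j → ρ i - ρ j)
  derivative-productₚ ρ i = trans
    (derivative-product (λ j → T +ₚ (-ₚ const (ρ j))) i (ρ i) (trans (eval-linear (ρ i) (ρ i)) (-‿inverseʳ _)))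
    (trans (*-cong (derivative-linear (ρ i) (ρ i))
      (product-except-cong i _ _ λ j → eval-linear (ρ j) (ρ i))) (*-identityˡ _))

  product-except-nonzero : ∀ {n} i (f : Vector Carrier n) → (∀ j → j ≢ i → ¬ f j ≈ 0#) →
    ¬ product (except i f) ≈ 0#
  product-except-nonzero i f f≉0 = product-nonzero (except i f) nonzero
    where
    nonzero : ∀ j → ¬ except i f j ≈ 0#
    nonzero j with j Fin.≟ i
    ... | yes _   = 1≉0
    ... | no  j≢i = f≉0 j j≢i

  derivative-nonzero : ∀ {n} (ρ : Vector Carrier n) → Distinct ρ → ∀ i →
    ¬ eval (derivative (productₚ λ j → T +ₚ (-ₚ const (ρ j)))) (ρ i) ≈ 0#
  derivative-nonzero ρ distinct i e = product-except-nonzero i (λ j → ρ i - ρ j)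
    (λ j j≢i e → j≢i (≡.sym (distinct i j (x-y≈0⇒x≈y _ _ e))))
    (trans (sym (derivative-productₚ ρ i)) e)

-- Finite fields

module FiniteField {c ℓ} (k : Field c ℓ) (q : ℕ) (size : HasSize k q) where
  open Field k hiding (zero)
  open Inverse size using (to; from; to-cong; strictlyInverseˡ; strictlyInverseʳ)
  open RawSemiringDefs (Semiring.rawSemiring semiring) using (product; _^_)
  open Exp commutativeSemiring using (^-congˡ)
  open MonoidSum *-commutativeMonoid using (sum-permute; sum-replicate)
    renaming (∑-distrib-+ to product-distrib-*)
  open FieldProperties k
  open SetoidReasoning setoid

  element : Fin q → Carrier
  element = from

  index : Carrier → Fin q
  index = to

  element-index : ∀ a → element (index a) ≈ a
  element-index = strictlyInverseʳ

  element-distinct : Distinct element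
  element-distinct i j e = ≡.trans (≡.sym (strictlyInverseˡ i)) (≡.trans (to-cong e) (strictlyInverseˡ j))

  1<q : 1 < q
  1<q = case q {element} element-index
    where
    -- With `q` and both maps generalised, q = 0 leaves no index for 0, and q = 1 would identify 0
    -- and 1.
    case : ∀ q {element : Fin q → Carrier} {index : Carrier → Fin q} →
      (∀ a → element (index a) ≈ a) → 1 < q
    case zero {index = index} e with () ← index 0#
    case (suc zero) {element} {index} e = ⊥-elim (1≉0 (trans (sym (e 1#)) (trans (reflexive
      (≡.cong element (only (index 1#) (index 0#)))) (e 0#))))
      where
      only : (i j : Fin 1) → i ≡ j
      only zero zero = ≡.refl
    case (suc (suc q)) e = s≤s (s≤s z≤n)

  0^ : ∀ n → 1 < n → 0# ^ n ≈ 0#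
  0^ (suc n) _ = zeroˡ _

  -- Multiplication by a permutes the nonzero elements, so their product w
  -- satisfies a ^ (q − 1) * w ≈ w; the factors for 0 are replaced by 1.
  fermat : ∀ a → a ^ q ≈ a
  fermat a with a ≟ 0#
  ... | yes a≈0 = trans (^-congˡ q a≈0) (trans (0^ q 1<q) (sym a≈0))
  ... | no  a≉0 with inverse a a≉0
  ...   | a⁻¹ , a⁻¹a≈1 = begin
    a ^ q                                     ≈⟨ sym (sum-replicate q) ⟩
    product {q} (λ _ → a)                     ≈⟨ product-cong q split ⟩
    product (λ i → atNonzero a i * atZero i)  ≈⟨ product-distrib-* (atNonzero a) atZero ⟩
    product (atNonzero a) * product atZero    ≈⟨ *-cong product≈1 product-atZero ⟩
    1# * a                                    ≈⟨ *-identityˡ a ⟩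
    a                                         ∎
    where
    atNonzero : Carrier → Fin q → Carrier
    atNonzero x i = if does (element i ≟ 0#) then 1# else x

    atZero : Fin q → Carrier
    atZero i = if does (element i ≟ 0#) then a else 1#

    g : Fin q → Carrier
    g i = atNonzero (element i) i

    -- a ^ q has one factor a for each element of k; the one belonging to 0 is split off, which
    -- turns the exponent q - 1 into q.
    split : ∀ i → a ≈ atNonzero a i * atZero i
    split i with does (element i ≟ 0#)
    ... | true  = sym (*-identityˡ a)
    ... | false = sym (*-identityʳ a)

    product-atZero : product atZero ≈ a
    product-atZero = trans (sum-single *-commutativeMonoid atZero (index 0#) other) at0
      where
      at0 : atZero (index 0#) ≈ a
      at0 with element (index 0#) ≟ 0#
      ... | yes _ = refl
      ... | no ¬p = ⊥-elim (¬p (element-index 0#))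
      other : ∀ i → i ≢ index 0# → atZero i ≈ 1#
      other i i≢ with element i ≟ 0#
      ... | yes p = ⊥-elim (i≢ (element-distinct i _ (trans p (sym (element-index 0#)))))
      ... | no _  = refl

    mult : Carrier → Fin q → Fin q
    mult x i = index (x * element i)

    mult-inverse : ∀ x y → x * y ≈ 1# → ∀ i → mult x (mult y i) ≡ i
    mult-inverse x y xy≈1 i = element-distinct _ _ (begin
      element (mult x (mult y i))      ≈⟨ element-index _ ⟩
      x * element (index (y * element i)) ≈⟨ *-congˡ (element-index _) ⟩
      x * (y * element i)              ≈⟨ sym (*-assoc _ _ _) ⟩
      x * y * element i                ≈⟨ *-congʳ xy≈1 ⟩
      1# * element i                   ≈⟨ *-identityˡ _ ⟩
      element i                        ∎)

    π : Permutation q q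
    π = mk↔ₛ′ (mult a) (mult a⁻¹)
      (mult-inverse a a⁻¹ (trans (*-comm _ _) a⁻¹a≈1)) (mult-inverse a⁻¹ a a⁻¹a≈1)

    g-mult : ∀ i → g (mult a i) ≈ atNonzero a i * g i
    g-mult i with element (mult a i) ≟ 0# | element i ≟ 0#
    ... | yes _ | yes _ = sym (*-identityˡ _)
    ... | no _  | no _  = element-index _
    ... | yes p | no ¬r = ⊥-elim (*-nonzero a≉0 ¬r (trans (sym (element-index _)) p))
    ... | no ¬p | yes r = ⊥-elim (¬p (trans (element-index _) (trans (*-congˡ r) (zeroʳ a))))

    g-nonzero : ∀ i → ¬ g i ≈ 0#
    g-nonzero i with element i ≟ 0#
    ... | yes _ = 1≉0
    ... | no ¬p = ¬p

    product≈1 : product (atNonzero a) ≈ 1#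
    product≈1 = *-cancelˡ (product g) (product-nonzero g g-nonzero) (begin
      product g * product (atNonzero a)       ≈⟨ *-comm _ _ ⟩
      product (atNonzero a) * product g       ≈⟨ sym (product-distrib-* (atNonzero a) g) ⟩
      product (λ i → atNonzero a i * g i)     ≈⟨ product-cong q (λ i → sym (g-mult i)) ⟩
      product (λ i → g (mult a i))            ≈⟨ sym (sum-permute g π) ⟩
      product g                               ≈⟨ sym (*-identityʳ _) ⟩
      product g * 1#                          ∎)

module _ {c ℓ} (R : CommutativeRing c ℓ) where
  open CommutativeRing R
  open GroupProperties +-group using (inverseˡ-unique; ∙-cancelʳ)

  -- Additivity alone forces 0 and negatives to be respected, by cancellation in the additive group.
  ringEndomorphism : (h : Carrier → Carrier) → (∀ {x y} → x ≈ y → h x ≈ h y) →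
    (∀ x y → h (x + y) ≈ h x + h y) → (∀ x y → h (x * y) ≈ h x * h y) → h 1# ≈ 1# →
    RingMorphisms.IsRingHomomorphism rawRing rawRing h
  ringEndomorphism h h-cong h-+ h-* h-1 = record
    { isSemiringHomomorphism = record
      { isNearSemiringHomomorphism = record
        { +-isMonoidHomomorphism = record
          { isMagmaHomomorphism = record
            { isRelHomomorphism = record { cong = h-cong }
            ; homo = h-+
            }
          ; ε-homo = h-0
          }
        ; *-homo = h-*
        }
      ; 1#-homo = h-1
      }
    ; -‿homo = λ x → inverseˡ-unique _ _ (trans (sym (h-+ _ _)) (trans (h-cong (-‿inverseˡ x)) h-0))
    }
    where
    h-0 : h 0# ≈ 0#
    h-0 = ∙-cancelʳ (h 0#) _ _ (trans (sym (h-+ _ _)) (trans (h-cong (+-identityˡ 0#)) (sym (+-identityˡ _))))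

-- The Frobenius map of k̄ relative to k

module Frobenius {c ℓ c′ ℓ′} (k : Field c ℓ) (q : ℕ) (size : HasSize k q) (k̄ : AlgebraicClosure k c′ ℓ′) where
  private module k = Field k
  open AlgebraicClosure k̄ hiding (zero)
  open FiniteField k q size using (element; index; element-index; element-distinct; 1<q; fermat)
  open RawSemiringDefs (Semiring.rawSemiring semiring) using (product; _^_)
  open PolynomialProperties commutativeRing
  open FieldProperties field̄
  open Solver commutativeRing
  open Exp commutativeSemiring using (^-congˡ; ^-distrib-*; ^-assocʳ)
  open MonoidSum *-commutativeMonoid using (sum-replicate)
  open SetoidReasoning setoid
  ι[_] : List k.Carrier → Poly
  ι[ f ] = List.map ι f

  module ι = Homomorphism k.commutativeRing commutativeRing ι ι-isHomomorphism

  1^ : ∀ n → 1# ^ n ≈ 1#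
  1^ zero    = refl
  1^ (suc n) = trans (*-identityˡ _) (1^ n)

  ι-zero : ∀ a → ι a ≈ 0# → a k.≈ k.0#
  ι-zero a ιa≈0 with a k.≟ k.0#
  ... | yes a≈0 = a≈0
  ... | no  a≉0 with k.inverse a a≉0
  ...   | a⁻¹ , e = ⊥-elim (1≉0 (begin
    1#            ≈⟨ sym ι.1#-homo ⟩
    ι k.1#        ≈⟨ ι.⟦⟧-cong (k.sym e) ⟩
    ι (a⁻¹ k.* a) ≈⟨ ι.*-homo _ _ ⟩
    ι a⁻¹ * ι a   ≈⟨ *-congˡ ιa≈0 ⟩
    ι a⁻¹ * 0#    ≈⟨ zeroʳ _ ⟩
    0#            ∎))

  ι-injective : ∀ a b → ι a ≈ ι b → a k.≈ b
  ι-injective a b e = FieldProperties.x-y≈0⇒x≈y k a b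
    (ι-zero _ (trans (ι.difference-homo a b) (x≈y⇒x-y≈0 e)))

  rational : Fin q → Carrier
  rational i = ι (element i)

  rational-distinct : Distinct rational
  rational-distinct i j e = element-distinct i j (ι-injective _ _ e)

  rational-index : ∀ a → rational (index a) ≈ ι a
  rational-index a = ι.⟦⟧-cong (element-index a)

  private
    -- L = ∏ (T − a) over a ∈ k; it turns out that L = T^q − T.
    L : Poly
    L = productₚ λ i → T +ₚ (-ₚ const (rational i))

    ℒ : Carrier → Carrier
    ℒ x = product λ i → x - rational i

    ℒ-rational : ∀ a → ℒ (ι a) ≈ 0#
    ℒ-rational a = zero-product _ (index a) (trans (+-congˡ (-‿cong (rational-index a))) (-‿inverseʳ _))

    -- L(T + y), presented through its roots a - y so that it is visibly monic of degree q.
    shifted : Carrier → Poly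
    shifted y = productₚ λ i → T +ₚ (-ₚ const (rational i - y))

    eval-shifted : ∀ y x → eval (shifted y) x ≈ ℒ (x + y)
    eval-shifted y x = trans (eval-productₚ (λ i → rational i - y) x) (product-cong q λ i →
      solve 3 (λ x r y → x :- (r :- y) := (x :+ y) :- r) refl x (rational i) y)

    ℒ-cong : ∀ {x y} → x ≈ y → ℒ x ≈ ℒ y
    ℒ-cong e = product-cong q λ _ → +-congʳ e

    -- Both L(T + a) and L are monic of degree q and vanish on k, which is stable under translation
    -- by a.
    ℒ-periodic : ∀ y a → ℒ (y + ι a) ≈ ℒ y
    ℒ-periodic y a = begin
      ℒ (y + ι a)             ≈⟨ sym (eval-shifted (ι a) y) ⟩
      eval (shifted (ι a)) y
        ≈⟨ eval-congˡ _ _ y (monic-agreeing q (shifted (ι a)) L rational rational-distinct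
             (Monic-productₚ _) (Monic-productₚ _) λ i → trans
             (trans (eval-shifted (ι a) (rational i))
               (trans (ℒ-cong (sym (ι.+-homo _ _))) (ℒ-rational _)))
             (sym (trans (eval-productₚ rational _) (ℒ-rational _)))) ⟩
      eval L y                ≈⟨ eval-productₚ rational y ⟩
      ℒ y                     ∎

    Monic-+-Below : ∀ n f g → MonicOfDegree n f → Below n g → MonicOfDegree n (f +ₚ g)
    Monic-+-Below n f g (lead , high) g<n =
        trans (coeff-+ f g n) (trans (+-cong lead (g<n n ℕ.≤-refl)) (+-identityʳ 1#))
      , Below-+ (suc n) {f} {g} high (Below-mono {n} {suc n} {g} (ℕ.n≤1+n n) g<n)

    const-Below : ∀ x → Below q (const x)
    const-Below x zero    q≤0 = ⊥-elim (ℕ.n≮0 (ℕ.<-≤-trans 1<q q≤0))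
    const-Below x (suc e) _   = refl

    T-Below : Below q T
    T-Below zero          q≤0 = ⊥-elim (ℕ.n≮0 (ℕ.<-≤-trans 1<q q≤0))
    T-Below (suc zero)    q≤1 = ⊥-elim (ℕ.<-irrefl ≡.refl (ℕ.<-≤-trans 1<q q≤1))
    T-Below (suc (suc e)) _   = refl

    -- For fixed y, the polynomials L(T + y) and L + L(y) are monic of degree q and both take the
    -- value L(y) on all of k, by periodicity; q distinct points determine them. Additivity of x ↦ x
    -- ^ q will follow without any binomial coefficients.
    ℒ-additive : ∀ x y → ℒ (x + y) ≈ ℒ x + ℒ y
    ℒ-additive x y = begin
      ℒ (x + y)                    ≈⟨ sym (eval-shifted y x) ⟩
      eval (shifted y) x
        ≈⟨ eval-congˡ _ _ x (monic-agreeing q (shifted y) (L +ₚ const (ℒ y))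
             rational rational-distinct (Monic-productₚ _)
             (Monic-+-Below q L (const (ℒ y)) (Monic-productₚ rational) (const-Below (ℒ y))) λ i →
             trans (eval-shifted y (rational i)) (trans (ℒ-cong (+-comm _ _))
             (trans (ℒ-periodic y _) (sym (trans (eval-L+ (rational i))
             (trans (+-congʳ (ℒ-rational _)) (+-identityˡ _))))))) ⟩
      eval (L +ₚ const (ℒ y)) x    ≈⟨ eval-L+ x ⟩
      ℒ x + ℒ y                    ∎
      where
      eval-L+ : ∀ x → eval (L +ₚ const (ℒ y)) x ≈ ℒ x + ℒ y
      eval-L+ x = trans (eval-+ L (const (ℒ y)) x) (+-cong (eval-productₚ rational x) (eval-const (ℒ y) x))

    -- T ^ q and L + T are monic of degree q and agree on k, where both give the identity by
    -- `fermat`.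
    x^q≈ℒ+x : ∀ x → x ^ q ≈ ℒ x + x
    x^q≈ℒ+x x = trans (sym (eval-T^q x)) (trans
      (eval-congˡ _ _ x (monic-agreeing q T^q (L +ₚ T) rational rational-distinct (Monic-productₚ _)
        (Monic-+-Below q L T (Monic-productₚ rational) T-Below) λ i → trans (eval-T^q (rational i))
          (trans (trans (sym (ι.^-homomorphic _ q)) (ι.⟦⟧-cong (fermat (element i))))
          (sym (trans (eval-L+T (rational i)) (trans (+-congʳ (ℒ-rational _)) (+-identityˡ _)))))))
      (eval-L+T x))
      where
      T^q : Poly
      T^q = productₚ {q} λ _ → T +ₚ (-ₚ const 0#)
      eval-T^q : ∀ x → eval T^q x ≈ x ^ q
      eval-T^q x = trans (eval-productₚ {q} (λ _ → 0#) x) (trans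
        (product-cong q λ _ → solve 1 (λ x → x :- :0 := x) refl x) (sum-replicate q))
      eval-L+T : ∀ x → eval (L +ₚ T) x ≈ ℒ x + x
      eval-L+T x = trans (eval-+ L T x) (+-cong (eval-productₚ rational x) (eval-T x))

  ^q-additive : ∀ x y → (x + y) ^ q ≈ x ^ q + y ^ q
  ^q-additive x y = begin
    (x + y) ^ q              ≈⟨ x^q≈ℒ+x (x + y) ⟩
    ℒ (x + y) + (x + y)      ≈⟨ +-congʳ (ℒ-additive x y) ⟩
    (ℒ x + ℒ y) + (x + y)
      ≈⟨ solve 4 (λ a b x y → (a :+ b) :+ (x :+ y) := (a :+ x) :+ (b :+ y)) refl _ _ x y ⟩
    (ℒ x + x) + (ℒ y + y)    ≈⟨ sym (+-cong (x^q≈ℒ+x x) (x^q≈ℒ+x y)) ⟩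
    x ^ q + y ^ q            ∎

  -- Such an x is a root of L = ∏ (T - a), so some factor x - a vanishes.
  ^q-fixed : ∀ x → x ^ q ≈ x → ∃[ a ] ι a ≈ x
  ^q-fixed x e = find (product-zero (λ i → x - rational i) (begin
    ℒ x              ≈⟨ solve 2 (λ a x → a := (a :+ x) :- x) refl (ℒ x) x ⟩
    (ℒ x + x) - x    ≈⟨ x≈y⇒x-y≈0 (trans (sym (x^q≈ℒ+x x)) e) ⟩
    0#               ∎))
    where
    find : ∃[ i ] x - rational i ≈ 0# → ∃[ a ] ι a ≈ x
    find (i , e) = element i , sym (x-y≈0⇒x≈y _ _ e)

  frobenius : ℕ → Carrier → Carrier
  frobenius t x = x ^ (q ℕ.^ t)

  frobenius-suc : ∀ t x → frobenius (suc t) x ≈ frobenius t (x ^ q)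
  frobenius-suc t x = sym (^-assocʳ x q (q ℕ.^ t))

  frobenius-+ : ∀ s t x → frobenius s (frobenius t x) ≈ frobenius (t ℕ.+ s) x
  frobenius-+ s t x = trans (^-assocʳ x (q ℕ.^ t) (q ℕ.^ s))
    (reflexive (≡.cong (x ^_) (≡.sym (ℕ.^-distribˡ-+-* q t s))))

  frobenius-0 : ∀ x → frobenius 0 x ≈ x
  frobenius-0 x = *-identityʳ x

  frobenius-1 : ∀ x → frobenius 1 x ≈ x ^ q
  frobenius-1 x = reflexive (≡.cong (x ^_) (ℕ.*-identityʳ q))

  frobenius-step : ∀ s x → frobenius (suc s) x ≈ frobenius 1 (frobenius s x)
  frobenius-step s x = sym (trans (frobenius-+ 1 s x) (reflexive (≡.cong (λ t → frobenius t x) (ℕ.+-comm s 1))))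

  frobenius-cong : ∀ t {x y} → x ≈ y → frobenius t x ≈ frobenius t y
  frobenius-cong t = ^-congˡ (q ℕ.^ t)

  frobenius-isRingHomomorphism : ∀ t → RingMorphisms.IsRingHomomorphism rawRing rawRing (frobenius t)
  frobenius-isRingHomomorphism t = ringEndomorphism commutativeRing (frobenius t)
    (frobenius-cong t) (additive t) (λ x y → ^-distrib-* x y (q ℕ.^ t)) (1^ (q ℕ.^ t))
    where
    additive : ∀ t x y → frobenius t (x + y) ≈ frobenius t x + frobenius t y
    additive zero    x y = trans (frobenius-0 _) (sym (+-cong (frobenius-0 x) (frobenius-0 y)))
    additive (suc t) x y = begin
      frobenius (suc t) (x + y)                    ≈⟨ frobenius-suc t _ ⟩
      frobenius t ((x + y) ^ q)                    ≈⟨ frobenius-cong t (^q-additive x y) ⟩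
      frobenius t (x ^ q + y ^ q)                  ≈⟨ additive t _ _ ⟩
      frobenius t (x ^ q) + frobenius t (y ^ q)    ≈⟨ sym (+-cong (frobenius-suc t x) (frobenius-suc t y)) ⟩
      frobenius (suc t) x + frobenius (suc t) y    ∎

  module frobenius t = Homomorphism commutativeRing commutativeRing (frobenius t)
      (frobenius-isRingHomomorphism t)

  frobenius-ι : ∀ t a → frobenius t (ι a) ≈ ι a
  frobenius-ι zero    a = frobenius-0 _
  frobenius-ι (suc t) a = trans (frobenius-suc t (ι a)) (trans
    (frobenius-cong t (trans (sym (ι.^-homomorphic a q)) (ι.⟦⟧-cong (fermat a)))) (frobenius-ι t a))

  frobenius-injective : ∀ t x y → frobenius t x ≈ frobenius t y → x ≈ y
  frobenius-injective t x y e with x ≟ y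
  ... | yes x≈y = x≈y
  ... | no  x≉y = ⊥-elim (^-nonzero (q ℕ.^ t) (x≉y ∘ x-y≈0⇒x≈y x y)
    (trans (frobenius.difference-homo t x y) (x≈y⇒x-y≈0 e)))

  frobenius-eval : ∀ t f x → frobenius t (eval ι[ f ] x) ≈ eval ι[ f ] (frobenius t x)
  frobenius-eval t f x = trans (sym (frobenius.eval-map t ι[ f ] x)) (fixed f)
    where
    fixed : ∀ f → eval (List.map (frobenius t) ι[ f ]) (frobenius t x) ≈ eval ι[ f ] (frobenius t x)
    fixed []      = refl
    fixed (a ∷ f) = +-cong (frobenius-ι t a) (*-congˡ (fixed f))

least : ∀ {p} {P : ℕ → Set p} → Decidable P → ∀ n → P n → ∃[ m ] P m × ∀ j → j < m → ¬ P j
least {P = P} P? = <-rec _ λ n smaller Pn → step n smaller Pn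
  where
  step : ∀ n → (∀ {m} → m < n → P m → ∃[ m ] P m × ∀ j → j < m → ¬ P j) → P n →
    ∃[ m ] P m × ∀ j → j < m → ¬ P j
  step n smaller Pn with ℕ.anyUpTo? P? n
  ... | yes (m , m<n , Pm) = smaller m<n Pm
  ... | no ¬any            = n , Pn , λ j j<n Pj → ¬any (j , j<n , Pj)

-- Conjugates and minimal polynomials over k

module Conjugates {c ℓ c′ ℓ′} (k : Field c ℓ) (q : ℕ) (size : HasSize k q) (k̄ : AlgebraicClosure k c′ ℓ′) where
  private
    module k where
      open Field k public
      open PolynomialProperties commutativeRing public
  open AlgebraicClosure k̄ hiding (zero)
  open Frobenius k q size k̄
  open RawSemiringDefs (Semiring.rawSemiring semiring) using (_^_)
  open PolynomialProperties commutativeRing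
  open FieldProperties field̄
  open SetoidReasoning setoid

  map-ι-injective : ∀ f g → ι[ f ] ≈ₚ ι[ g ] → f k.≈ₚ g
  map-ι-injective f g e = k.mk≈ₚ λ n → ι-injective _ _
    (trans (sym (ι.coeff-map f n)) (trans (coeff≈ e n) (ι.coeff-map g n)))

  Below-ι : ∀ n {f} → k.Below n f → Below n ι[ f ]
  Below-ι n {f} f<n e n≤e = trans (ι.coeff-map f e) (trans (ι.⟦⟧-cong (f<n e n≤e)) ι.0#-homo)

  descend : ∀ f → (∀ n → coeff f n ^ q ≈ coeff f n) → ∃[ f₀ ] ι[ f₀ ] ≈ₚ f
  descend []      _     = [] , Poly.refl
  descend (a ∷ f) fixed = extend (^q-fixed a (fixed 0)) (descend f λ n → fixed (suc n))
    where
    extend : ∃[ a₀ ] ι a₀ ≈ a → ∃[ f₀ ] ι[ f₀ ] ≈ₚ f → ∃[ f₀ ] ι[ f₀ ] ≈ₚ (a ∷ f)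
    extend (a₀ , e) (f₀ , p) = a₀ ∷ f₀ , ∷-cong e p

  descend-Monic : ∀ n f₀ f → ι[ f₀ ] ≈ₚ f → MonicOfDegree n f → k.MonicOfDegree n f₀
  descend-Monic n f₀ f p (lead , high) =
      ι-injective _ _ (trans (at n) (trans lead (sym ι.1#-homo)))
    , λ e n<e → ι-zero _ (trans (at e) (high e n<e))
    where
    at : ∀ e → ι (k.coeff f₀ e) ≈ coeff f e
    at e = trans (sym (ι.coeff-map f₀ e)) (coeff≈ p e)

  -- Here e is the exact length of the Frobenius orbit of δ; only `degree` identifies it with the
  -- degree of an irreducible polynomial that has the root δ.
  module Orbit (δ : Carrier) (e : ℕ) (0<e : 0 < e) (period : frobenius e δ ≈ δ)
    (minimal : ∀ j → 0 < j → j < e → ¬ frobenius j δ ≈ δ)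
    where

    conjugate : Fin e → Carrier
    conjugate t = frobenius (toℕ t) δ

    private
      no-repetition : ∀ s t → s < t → t < e → ¬ frobenius s δ ≈ frobenius t δ
      no-repetition s t s<t t<e r = minimal (t ℕ.∸ s) (ℕ.m<n⇒0<n∸m s<t) (ℕ.≤-<-trans (ℕ.m∸n≤m t s) t<e)
        (frobenius-injective s _ _ (trans (frobenius-+ s (t ℕ.∸ s) δ)
          (trans (reflexive (≡.cong (λ t → frobenius t δ) (ℕ.m∸n+n≡m (ℕ.<⇒≤ s<t)))) (sym r))))

    conjugate-distinct : Distinct conjugate
    conjugate-distinct s t r with ℕ.<-cmp (toℕ s) (toℕ t)
    ... | tri< s<t _ _ = ⊥-elim (no-repetition _ _ s<t (Fin.toℕ<n t) r)
    ... | tri≈ _ s≡t _ = Fin.toℕ-injective s≡t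
    ... | tri> _ _ t<s = ⊥-elim (no-repetition _ _ t<s (Fin.toℕ<n s) (sym r))

    conjugate-of : ∀ s → ∃[ t ] conjugate t ≈ frobenius s δ
    conjugate-of zero    = fromℕ< 0<e , reflexive (≡.cong (λ t → frobenius t δ) (Fin.toℕ-fromℕ< 0<e))
    conjugate-of (suc s) = next (conjugate-of s)
      where
      next : ∃[ t ] conjugate t ≈ frobenius s δ → ∃[ t ] conjugate t ≈ frobenius (suc s) δ
      next (t , r) = choose (ℕ.m≤n⇒m<n∨m≡n (Fin.toℕ<n t))
        where
        shift : frobenius (suc (toℕ t)) δ ≈ frobenius (suc s) δ
        shift = begin
          frobenius (suc (toℕ t)) δ          ≈⟨ frobenius-step (toℕ t) δ ⟩
          frobenius 1 (frobenius (toℕ t) δ)  ≈⟨ frobenius-cong 1 r ⟩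
          frobenius 1 (frobenius s δ)        ≈⟨ sym (frobenius-step s δ) ⟩
          frobenius (suc s) δ                ∎
        choose : suc (toℕ t) < e ⊎ suc (toℕ t) ≡ e → ∃[ t ] conjugate t ≈ frobenius (suc s) δ
        choose (inj₁ t+1<e) = fromℕ< t+1<e ,
          trans (reflexive (≡.cong (λ t → frobenius t δ) (Fin.toℕ-fromℕ< t+1<e))) shift
        choose (inj₂ t+1≡e) = fromℕ< 0<e , (begin
          frobenius (toℕ (fromℕ< 0<e)) δ     ≡⟨ ≡.cong (λ t → frobenius t δ) (Fin.toℕ-fromℕ< 0<e) ⟩
          frobenius 0 δ                      ≈⟨ frobenius-0 δ ⟩
          δ                                  ≈⟨ sym period ⟩
          frobenius e δ                      ≡⟨ ≡.cong (λ t → frobenius t δ) (≡.sym t+1≡e) ⟩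
          frobenius (suc (toℕ t)) δ          ≈⟨ shift ⟩
          frobenius (suc s) δ                ∎)

    orbitPoly : Poly
    orbitPoly = productₚ λ t → T +ₚ (-ₚ const (conjugate t))

    orbitPoly-root : ∀ s → eval orbitPoly (frobenius s δ) ≈ 0#
    orbitPoly-root s = trans (eval-productₚ conjugate (frobenius s δ))
      (zero-product _ (proj₁ (conjugate-of s)) (x≈y⇒x-y≈0 (sym (proj₂ (conjugate-of s)))))

    -- Frobenius permutes the roots. Comparing the two monic polynomials at the images of the
    -- conjugates, rather than at the conjugates themselves, avoids naming the permutation.
    orbitPoly-fixed : List.map (frobenius 1) orbitPoly ≈ₚ orbitPoly
    orbitPoly-fixed = monic-agreeing e _ orbitPoly (λ t → frobenius 1 (conjugate t))
      (λ s t r → conjugate-distinct s t (frobenius-injective 1 _ _ r))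
      (frobenius.Monic-map 1 e {orbitPoly} (Monic-productₚ conjugate)) (Monic-productₚ conjugate)
      λ t → trans (frobenius.eval-map 1 orbitPoly (conjugate t)) (trans
        (trans (frobenius-cong 1 (orbitPoly-root (toℕ t))) (frobenius.0#-homo 1))
        (sym (trans (eval-congʳ orbitPoly (frobenius-+ 1 (toℕ t) δ)) (orbitPoly-root (toℕ t ℕ.+ 1)))))

    minimalPolynomial : ∃[ h ] k.MonicOfDegree e h × ι[ h ] ≈ₚ orbitPoly
    minimalPolynomial = monic (descend orbitPoly (λ n → trans (sym (frobenius-1 _))
      (trans (sym (frobenius.coeff-map 1 orbitPoly n)) (coeff≈ orbitPoly-fixed n))))
      where
      monic : ∃[ h ] ι[ h ] ≈ₚ orbitPoly → ∃[ h ] k.MonicOfDegree e h × ι[ h ] ≈ₚ orbitPoly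
      monic (h , p) = h , descend-Monic e h orbitPoly p (Monic-productₚ conjugate) , p

    root-conjugate : ∀ f → eval ι[ f ] δ ≈ 0# → ∀ t → eval ι[ f ] (conjugate t) ≈ 0#
    root-conjugate f fδ≈0 t = trans (sym (frobenius-eval (toℕ t) f δ))
      (trans (frobenius-cong (toℕ t) fδ≈0) (frobenius.0#-homo (toℕ t)))

    -- A remainder with coefficients in k that vanishes at δ vanishes at all e conjugates, but its
    -- degree is below e.
    vanishing-divisibleₖ : ∀ g → k.MonicOfDegree e g → eval ι[ g ] δ ≈ 0# →
      ∀ f → eval ι[ f ] δ ≈ 0# → ∃[ u ] (u k.*ₚ g) k.≈ₚ f
    vanishing-divisibleₖ g g-monic gδ≈0 f fδ≈0 = exact (k.divMod e g g-monic f)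
      where
      exact : ∃[ u ] ∃[ s ] k.Below e s × f k.≈ₚ (u k.*ₚ g k.+ₚ s) → ∃[ u ] (u k.*ₚ g) k.≈ₚ f
      exact (u , s , s<e , f≈) = u , k.Poly.sym (k.Poly.trans f≈
        (k.Poly.trans (k.Poly.+-congˡ {u k.*ₚ g} s≈0) (k.Poly.+-identityʳ _)))
        where
        s≈0 : s k.≈ₚ []
        s≈0 = map-ι-injective s [] (vanishing e ι[ s ] conjugate conjugate-distinct (Below-ι e {s} s<e)
          (root-conjugate s (begin
            eval ι[ s ] δ
              ≈⟨ sym (trans (+-congʳ (trans (*-congˡ gδ≈0) (zeroʳ _))) (+-identityˡ _)) ⟩
            eval ι[ u ] δ * eval ι[ g ] δ + eval ι[ s ] δ
              ≈⟨ sym (trans (eval-+ (ι[ u ] *ₚ ι[ g ]) ι[ s ] δ) (+-congʳ (eval-* ι[ u ] ι[ g ] δ))) ⟩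
            eval (ι[ u ] *ₚ ι[ g ] +ₚ ι[ s ]) δ
              ≈⟨ sym (eval-congˡ _ _ δ (Poly.trans (ι.map-cong f≈)
                   (Poly.trans (ι.map-+ (u k.*ₚ g) s) (Poly.+-congʳ {ι[ s ]} (ι.map-* u g))))) ⟩
            eval ι[ f ] δ
              ≈⟨ fδ≈0 ⟩
            0# ∎)))

  -- All roots of P occur among the N values of `r`; this is what makes the Frobenius orbit of δ
  -- finite, before anything is known about the degree of k(δ).
  module MinimalPolynomial
    (P : k.Poly) (d : ℕ) (monic : k.MonicOfDegree d P)
    (irreducible : RawSemiringDefs.Irreducible (Semiring.rawSemiring k.Poly.semiring) P)
    (δ : Carrier) (root : eval ι[ P ] δ ≈ 0#)
    (N : ℕ) (r : Fin N → Carrier) (finite : ∀ x → eval ι[ P ] x ≈ 0# → ∃[ l ] r l ≈ x)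
    where
    open RawSemiringDefs.Irreducible irreducible using (split-∣1)
    open RawMagmaDefs (Semiring.*-rawMagma k.Poly.semiring) using (_,_)

    private
      Period : ℕ → Set ℓ′
      Period e = 0 < e × frobenius e δ ≈ δ

      period? : Decidable Period
      period? e = (0 ℕ.<? e) ×-dec (frobenius e δ ≟ δ)

      conjugate-root : ∀ s → eval ι[ P ] (frobenius s δ) ≈ 0#
      conjugate-root s = trans (sym (frobenius-eval s P δ))
          (trans (frobenius-cong s root) (frobenius.0#-homo s))

      position : ∀ s → ∃[ l ] r l ≈ frobenius s δ
      position s = finite _ (conjugate-root s)

      -- Two of the first N + 1 iterates of δ coincide by the pigeonhole principle, and injectivity
      -- of Frobenius strips the common iterations.
      periodic : ∃[ e ] Period e
      periodic = repeated (Fin.pigeonhole (ℕ.n<1+n N) (λ s → proj₁ (position (toℕ s))))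
        where
        repeated : (∃[ s ] ∃[ t ] toℕ {suc N} s < toℕ {suc N} t ×
          proj₁ (position (toℕ s)) ≡ proj₁ (position (toℕ t))) → ∃[ e ] Period e
        repeated (s , t , s<t , same) = toℕ t ℕ.∸ toℕ s , ℕ.m<n⇒0<n∸m s<t ,
          frobenius-injective (toℕ s) _ _ (begin
            frobenius (toℕ s) (frobenius (toℕ t ℕ.∸ toℕ s) δ)  ≈⟨ frobenius-+ (toℕ s) (toℕ t ℕ.∸ toℕ s) δ ⟩
            frobenius (toℕ t ℕ.∸ toℕ s ℕ.+ toℕ s) δ
              ≡⟨ ≡.cong (λ t → frobenius t δ) (ℕ.m∸n+n≡m (ℕ.<⇒≤ s<t)) ⟩
            frobenius (toℕ t) δ                                ≈⟨ sym (proj₂ (position (toℕ t))) ⟩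
            r (proj₁ (position (toℕ t)))                       ≡⟨ ≡.cong r (≡.sym same) ⟩
            r (proj₁ (position (toℕ s)))                       ≈⟨ proj₂ (position (toℕ s)) ⟩
            frobenius (toℕ s) δ                                ∎)

      minimalPeriod : ∃[ e ] Period e × ∀ j → j < e → ¬ Period j
      minimalPeriod = least period? _ (proj₂ periodic)

      -- The orbit polynomial descends to some h over k, and h divides the irreducible P. It is not
      -- a unit, since it has a root; so P and h divide each other, and both are monic.
      degree : ∀ e → (p : Period e) → (∀ j → 0 < j → j < e → ¬ frobenius j δ ≈ δ) → e ≡ d
      degree e (0<e , period) minimal = compare minimalPolynomial
        where
        open Orbit δ e 0<e period minimal
        not-zero : ∀ n f → k.MonicOfDegree n f → ∀ u g → u k.≈ₚ [] → ¬ (u k.*ₚ g) k.≈ₚ f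
        not-zero n f (lead , _) u g u≈0 e = k.1≉0 (k.trans (k.sym lead)
          (k.trans (k.sym (k.coeff≈ e n)) (k.coeff≈ (k.Poly.trans (k.Poly.*-congʳ u≈0) (k.Poly.zeroˡ g)) n)))
        compare : ∃[ h ] k.MonicOfDegree e h × ι[ h ] ≈ₚ orbitPoly → e ≡ d
        compare (h , h-monic , h≈) = factor (vanishing-divisibleₖ h h-monic h-root P root)
          where
          h-root : eval ι[ h ] δ ≈ 0#
          h-root = trans (eval-congˡ _ _ δ h≈)
              (trans (eval-congʳ orbitPoly (sym (frobenius-0 δ))) (orbitPoly-root 0))
          factor : ∃[ u ] (u k.*ₚ h) k.≈ₚ P → e ≡ d
          factor (u , uh≈P) = split (split-∣1 (k.Poly.sym uh≈P))
            where
            split : _ → e ≡ d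
            split (inj₂ (v , vh≈1)) = ⊥-elim (1≉0 (begin
              1#
                ≈⟨ sym (trans (eval-congˡ _ _ δ (ι.map-cong vh≈1)) (trans (eval-const _ δ) ι.1#-homo)) ⟩
              eval ι[ v k.*ₚ h ] δ   ≈⟨ trans (eval-congˡ _ _ δ (ι.map-* v h)) (eval-* ι[ v ] ι[ h ] δ) ⟩
              eval ι[ v ] δ * eval ι[ h ] δ   ≈⟨ trans (*-congˡ h-root) (zeroʳ _) ⟩
              0#                               ∎))
            -- The cofactor u has the inverse v, so v P = h; a nonzero multiple of a monic
            -- polynomial cannot have smaller degree.
            split (inj₁ (v , vu≈1)) = trichotomy (ℕ.<-cmp e d)
              where
              vP≈h : (v k.*ₚ P) k.≈ₚ h
              vP≈h = k.Poly.trans (k.Poly.*-congˡ {v} (k.Poly.sym uh≈P))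
                (k.Poly.trans (k.Poly.sym (k.Poly.*-assoc v u h))
                  (k.Poly.trans (k.Poly.*-congʳ {h} vu≈1) (k.Poly.*-identityˡ h)))
              trichotomy : _ → e ≡ d
              trichotomy (tri≈ _ e≡d _) = e≡d
              trichotomy (tri< e<d _ _) = ⊥-elim (not-zero e h h-monic v P
                (k.monic-*-Below d P monic v (k.Below-cong {d} (k.Poly.sym vP≈h)
                  (λ i d≤i → proj₂ h-monic i (ℕ.<-≤-trans e<d d≤i)))) vP≈h)
              trichotomy (tri> _ _ d<e) = ⊥-elim (not-zero d P monic u h
                (k.monic-*-Below e h h-monic u (k.Below-cong {e} (k.Poly.sym uh≈P)
                  (λ i e≤i → proj₂ monic i (ℕ.<-≤-trans d<e e≤i)))) uh≈P)

      degree-period : Period d × ∀ j → 0 < j → j < d → ¬ frobenius j δ ≈ δ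
      degree-period = transport minimalPeriod
        where
        transport : (∃[ e ] Period e × ∀ j → j < e → ¬ Period j) →
          Period d × ∀ j → 0 < j → j < d → ¬ frobenius j δ ≈ δ
        transport (e , p , minimal) = ≡.subst (λ d → Period d × ∀ j → 0 < j → j < d → ¬ frobenius j δ ≈ δ)
          (degree e p minimal′) (p , minimal′)
          where
          minimal′ : ∀ j → 0 < j → j < e → ¬ frobenius j δ ≈ δ
          minimal′ j 0<j j<e r = minimal j j<e (0<j , r)

    d-positive : 0 < d
    d-positive = proj₁ (proj₁ degree-period)

    d-period : frobenius d δ ≈ δ
    d-period = proj₂ (proj₁ degree-period)

    open Orbit δ d d-positive d-period (proj₂ degree-period) public

    P-factors : ι[ P ] ≈ₚ orbitPoly
    P-factors = factorization d ι[ P ] conjugate conjugate-distinct (ι.Monic-map d {P} monic)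
      (root-conjugate P root)

    root-divisible : ∀ f → eval ι[ f ] δ ≈ 0# → ∃[ u ] (u k.*ₚ P) k.≈ₚ f
    root-divisible = vanishing-divisibleₖ P monic root

    P-root : ∀ x → eval ι[ P ] x ≈ 0# → ∃[ t ] conjugate t ≈ x
    P-root x Px≈0 = conjugate-at (product-zero (λ t → x - conjugate t)
      (trans (sym (trans (eval-congˡ _ _ x P-factors) (eval-productₚ conjugate x))) Px≈0))
      where
      conjugate-at : ∃[ t ] x - conjugate t ≈ 0# → ∃[ t ] conjugate t ≈ x
      conjugate-at (t , e) = t , sym (x-y≈0⇒x≈y _ _ e)

-- The quadratic character

parity : ∀ n → ∃[ h ] (n ≡ h ℕ.+ h ⊎ n ≡ suc (h ℕ.+ h))
parity zero    = 0 , inj₁ ≡.refl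
parity (suc n) with parity n
... | h , inj₁ e = h , inj₂ (≡.cong suc e)
... | h , inj₂ e = suc h , inj₁ (≡.cong suc (≡.trans e (≡.sym (ℕ.+-suc h h))))

-- For b = 2h + 1, the number (bˢ − 1) / 2.
half : ℕ → ℕ → ℕ → ℕ
half b h zero    = 0
half b h (suc s) = h ℕ.+ b ℕ.* half b h s

half-spec : ∀ b h s → b ≡ suc (h ℕ.+ h) → b ℕ.^ s ≡ suc (half b h s ℕ.+ half b h s)
half-spec b h zero    e = ≡.refl
half-spec b h (suc s) e = ≡.trans (≡.cong (b ℕ.*_) (half-spec b h s e))
  (≡.trans (≡.trans (ℕ.*-suc b _) (≡.cong (ℕ._+ b ℕ.* (H ℕ.+ H)) e))
    (solve 3 (λ h b H → (con 1 :+ (h :+ h)) :+ b :* (H :+ H)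
      := con 1 :+ ((h :+ b :* H) :+ (h :+ b :* H))) ≡.refl h b H))
  where
  open +-*-Solver
  H = half b h s

+-double-injective : ∀ m n → suc (m ℕ.+ m) ≡ suc (n ℕ.+ n) → m ≡ n
+-double-injective m n e = ℕ.*-cancelˡ-≡ m n 2
    (≡.trans (double m) (≡.trans (ℕ.suc-injective e) (≡.sym (double n))))
  where
  double : ∀ m → 2 ℕ.* m ≡ m ℕ.+ m
  double m = ≡.cong (m ℕ.+_) (ℕ.+-identityʳ m)

-- Both numbers N satisfy 2 N + 1 = b ^ (s t).
half-* : ∀ b h s t → b ≡ suc (h ℕ.+ h) → half b h (s ℕ.* t) ≡ half (b ℕ.^ s) (half b h s) t
half-* b h s t e = +-double-injective _ _ (≡.trans (≡.sym (half-spec b h (s ℕ.* t) e))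
  (≡.trans (≡.sym (ℕ.^-*-assoc b s t)) (half-spec (b ℕ.^ s) (half b h s) t (half-spec b h s e))))

-- In ℤ / e the multiples of d form the subgroup generated by G = gcd d e, of order D = e / G: they
-- are the d u with u < D, and the t < G represent its cosets. Over ℕ, congruence modulo e is
-- expressed by adding multiples of e on both sides.
residues : ∀ d e → 0 < e → ∀ D → gcd d e ℕ.* D ≡ e → ∀ s →
  ∃[ t ] ∃[ u ] t < gcd d e × u < D × ∃[ m ] ∃[ n ] s ℕ.+ m ℕ.* e ≡ t ℕ.+ d ℕ.* u ℕ.+ n ℕ.* e
residues d e 0<e D GD≡e s = from-bezout bezout
  where
  open ≡.≡-Reasoning
  open +-*-Solver
  G = gcd d e
  instance
    G≢0 : ℕ.NonZero G
    G≢0 = ℕ.>-nonZero (ℕ.n≢0⇒n>0 λ G≡0 → ℕ.<-irrefl ≡.refl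
        (≡.subst (0 <_) (≡.trans (≡.sym GD≡e) (≡.cong (ℕ._* D) G≡0)) 0<e))
    D≢0 : ℕ.NonZero D
    D≢0 = ℕ.>-nonZero (ℕ.n≢0⇒n>0 λ D≡0 → ℕ.<-irrefl ≡.refl
        (≡.subst (0 <_) (≡.trans (≡.sym GD≡e) (≡.trans (≡.cong (G ℕ.*_) D≡0) (ℕ.*-zeroʳ G))) 0<e))
  d′ = _∣_.quotient (gcd[m,n]∣m d e)
  d≡ : d ≡ d′ ℕ.* G
  d≡ = _∣_.equality (gcd[m,n]∣m d e)

  bezout : ∃[ x ] ∃[ A ] ∃[ B ] G ℕ.+ A ℕ.* e ≡ x ℕ.* d ℕ.+ B ℕ.* e
  bezout = case (Bézout.identity (gcd-GCD d e))
    where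
    case : Bézout.Identity G d e → ∃[ x ] ∃[ A ] ∃[ B ] G ℕ.+ A ℕ.* e ≡ x ℕ.* d ℕ.+ B ℕ.* e
    case (Bézout.+- x y eq) = x , y , 0 , ≡.trans eq (≡.sym (ℕ.+-identityʳ _))
    -- Here G ≡ -x d modulo e, and -x is replaced by x (e - 1), which is congruent to it.
    case (Bézout.-+ x y eq) = x ℕ.* ℕ.pred e , x ℕ.* d , y , (begin
      G ℕ.+ x ℕ.* d ℕ.* e                   ≡⟨ ≡.cong (λ e → G ℕ.+ x ℕ.* d ℕ.* e) (≡.sym suc-pred) ⟩
      G ℕ.+ x ℕ.* d ℕ.* suc e-1
        ≡⟨ solve 4 (λ G x d p → G :+ x :* d :* (con 1 :+ p) := (x :* p) :* d :+ (G :+ x :* d)) ≡.refl G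
            x d e-1 ⟩
      (x ℕ.* e-1) ℕ.* d ℕ.+ (G ℕ.+ x ℕ.* d) ≡⟨ ≡.cong ((x ℕ.* e-1) ℕ.* d ℕ.+_) eq ⟩
      (x ℕ.* e-1) ℕ.* d ℕ.+ y ℕ.* e         ∎)
      where
      e-1 = ℕ.pred e
      suc-pred : suc e-1 ≡ e
      suc-pred = ℕ.suc-pred e {{ℕ.>-nonZero 0<e}}

  -- Write s = t + w G, where w G ≡ (x w) d modulo e. The factor x w matters only modulo D, because
  -- d D = d′ G D = d′ e.
  from-bezout : (∃[ x ] ∃[ A ] ∃[ B ] G ℕ.+ A ℕ.* e ≡ x ℕ.* d ℕ.+ B ℕ.* e) →
    ∃[ t ] ∃[ u ] t < gcd d e × u < D × ∃[ m ] ∃[ n ] s ℕ.+ m ℕ.* e ≡ t ℕ.+ d ℕ.* u ℕ.+ n ℕ.* e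
  from-bezout (x , A , B , eq) = s % G , u , m%n<n s G , m%n<n
      (x ℕ.* w) D , w ℕ.* A , w ℕ.* B ℕ.+ d′ ℕ.* v , (begin
    s ℕ.+ w ℕ.* A ℕ.* e
      ≡⟨ ≡.cong (ℕ._+ w ℕ.* A ℕ.* e) (m≡m%n+[m/n]*n s G) ⟩
    t ℕ.+ w ℕ.* G ℕ.+ w ℕ.* A ℕ.* e
      ≡⟨ solve 5 (λ t w G A e → t :+ w :* G :+ w :* A :* e := t :+ w :* (G :+ A :* e)) ≡.refl t w G A e ⟩
    t ℕ.+ w ℕ.* (G ℕ.+ A ℕ.* e)
      ≡⟨ ≡.cong (λ z → t ℕ.+ w ℕ.* z) eq ⟩
    t ℕ.+ w ℕ.* (x ℕ.* d ℕ.+ B ℕ.* e)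
      ≡⟨ solve 6 (λ t w x d B e → t :+ w :* (x :* d :+ B :* e) := t :+ (x :* w) :* d :+ w :* B :* e)
          ≡.refl t w x d B e ⟩
    t ℕ.+ (x ℕ.* w) ℕ.* d ℕ.+ w ℕ.* B ℕ.* e
      ≡⟨ ≡.cong (λ z → t ℕ.+ z ℕ.* d ℕ.+ w ℕ.* B ℕ.* e) (m≡m%n+[m/n]*n (x ℕ.* w) D) ⟩
    t ℕ.+ (u ℕ.+ v ℕ.* D) ℕ.* d ℕ.+ w ℕ.* B ℕ.* e
      ≡⟨ solve 6 (λ t u v D d z → t :+ (u :+ v :* D) :* d :+ z := t :+ d :* u :+ (z :+ d :* (v :* D)))
          ≡.refl t u v D d (w ℕ.* B ℕ.* e) ⟩
    t ℕ.+ d ℕ.* u ℕ.+ (w ℕ.* B ℕ.* e ℕ.+ d ℕ.* (v ℕ.* D))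
      ≡⟨ ≡.cong (λ z → t ℕ.+ d ℕ.* u ℕ.+ (w ℕ.* B ℕ.* e ℕ.+ z)) (≡.trans (≡.cong (ℕ._* (v ℕ.* D)) d≡)
           (solve 4 (λ d′ G v D → d′ :* G :* (v :* D) := d′ :* v :* (G :* D)) ≡.refl d′ G v D)) ⟩
    t ℕ.+ d ℕ.* u ℕ.+ (w ℕ.* B ℕ.* e ℕ.+ d′ ℕ.* v ℕ.* (G ℕ.* D))
      ≡⟨ ≡.cong (λ z → t ℕ.+ d ℕ.* u ℕ.+ (w ℕ.* B ℕ.* e ℕ.+ d′ ℕ.* v ℕ.* z)) GD≡e ⟩
    t ℕ.+ d ℕ.* u ℕ.+ (w ℕ.* B ℕ.* e ℕ.+ d′ ℕ.* v ℕ.* e)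
      ≡⟨ ≡.cong (t ℕ.+ d ℕ.* u ℕ.+_) (≡.sym (ℕ.*-distribʳ-+ e (w ℕ.* B) (d′ ℕ.* v))) ⟩
    t ℕ.+ d ℕ.* u ℕ.+ (w ℕ.* B ℕ.+ d′ ℕ.* v) ℕ.* e ∎)
    where
    t = s % G
    w = s / G
    u = (x ℕ.* w) % D
    v = (x ℕ.* w) / D

lcm-cofactor : ∀ d e D → 0 < gcd d e → gcd d e ℕ.* D ≡ e → lcm d e ≡ d ℕ.* D
lcm-cofactor d e D 0<G GD≡e = ℕ.*-cancelˡ-≡ (lcm d e) (d ℕ.* D) (gcd d e) {{ℕ.>-nonZero 0<G}} (begin
  gcd d e ℕ.* lcm d e         ≡⟨ gcd*lcm d e ⟩
  d ℕ.* e                     ≡⟨ ≡.cong (d ℕ.*_) (≡.sym GD≡e) ⟩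
  d ℕ.* (gcd d e ℕ.* D)       ≡⟨ solve 3 (λ d G D → d :* (G :* D) := G :* (d :* D)) ≡.refl d (gcd d e) D ⟩
  gcd d e ℕ.* (d ℕ.* D)       ∎)
  where
  open ≡.≡-Reasoning
  open +-*-Solver

-- Euler's criterion, discriminants and norms

module QuadraticSymbol {c ℓ c′ ℓ′} (k : Field c ℓ) (q : ℕ) (size : HasSize k q)
  (2≉0 : ¬ Field._≈_ k (Field._+_ k (Field.1# k) (Field.1# k)) (Field.0# k))
  (k̄ : AlgebraicClosure k c′ ℓ′) where
  private
    module k where
      open Field k public
      open PolynomialProperties commutativeRing public
  open AlgebraicClosure k̄ hiding (zero)
  open Frobenius k q size k̄
  open RawSemiringDefs (Semiring.rawSemiring semiring) using (product; _^_)
  open PolynomialProperties commutativeRing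
  open FieldProperties field̄
  open QuadraticCharacter k q k̄ using (SquareIn; squareIn?; legendre)
  open Solver commutativeRing
  open Exp commutativeSemiring using (^-congˡ; ^-distrib-*; ^-assocʳ; ^-homo-*)
  open RingProperties ring using (-‿involutive; -1*x≈-x)
  open SetoidReasoning setoid

  ^-≡ : ∀ x {m n} → m ≡ n → x ^ m ≈ x ^ n
  ^-≡ x e = reflexive (≡.cong (x ^_) e)

  1+1≉0 : ¬ 1# + 1# ≈ 0#
  1+1≉0 e = 2≉0 (ι-zero _ (trans (ι.+-homo _ _) (trans (+-cong ι.1#-homo ι.1#-homo) e)))

  1≉-1 : ¬ 1# ≈ - 1#
  1≉-1 e = 1+1≉0 (trans (+-congˡ e) (-‿inverseʳ 1#))

  -1*-1 : - 1# * - 1# ≈ 1#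
  -1*-1 = trans (-1*x≈-x (- 1#)) (-‿involutive 1#)

  -- q is odd, since (−1) ^ q ≈ −1.
  private
    oddness : ∃[ h ] q ≡ suc (h ℕ.+ h)
    oddness = decide (parity q)
      where
      decide : (∃[ h ] (q ≡ h ℕ.+ h ⊎ q ≡ suc (h ℕ.+ h))) → ∃[ h ] q ≡ suc (h ℕ.+ h)
      decide (h , inj₂ e) = h , e
      decide (h , inj₁ e) = ⊥-elim (1≉-1 (begin
        1#                     ≈⟨ sym (1^ h) ⟩
        1# ^ h                 ≈⟨ ^-congˡ h (sym -1*-1) ⟩
        (- 1# * - 1#) ^ h      ≈⟨ ^-distrib-* (- 1#) (- 1#) h ⟩
        (- 1#) ^ h * (- 1#) ^ h ≈⟨ sym (^-homo-* (- 1#) h h) ⟩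
        (- 1#) ^ (h ℕ.+ h)     ≈⟨ ^-≡ (- 1#) (≡.sym e) ⟩
        (- 1#) ^ q             ≈⟨ sym (frobenius-1 (- 1#)) ⟩
        frobenius 1 (- 1#)     ≈⟨ frobenius.-‿homo 1 1# ⟩
        - frobenius 1 1#       ≈⟨ -‿cong (frobenius.1#-homo 1) ⟩
        - 1#                   ∎))

  h₁ : ℕ
  h₁ = proj₁ oddness

  q≡1+2h₁ : q ≡ suc (h₁ ℕ.+ h₁)
  q≡1+2h₁ = proj₂ oddness

  -- (q ^ d - 1) / 2, the exponent in Euler's criterion for k_d.
  H : ℕ → ℕ
  H = half q h₁

  frobenius-half : ∀ d x → frobenius d x ≈ x * (x ^ H d * x ^ H d)
  frobenius-half d x = trans (^-≡ x (half-spec q h₁ d q≡1+2h₁)) (*-congˡ (^-homo-* x (H d) (H d)))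

  sqrt : ∀ x → ∃[ y ] y * y ≈ x
  sqrt x = root (closed 1 (- x ∷ 0# ∷ 1# ∷ [])
      (refl , λ { (suc (suc (suc e))) _ → refl ; (suc zero) (s≤s ()) ; (suc (suc zero)) (s≤s (s≤s ())) }))
    where
    root : ∃[ y ] eval (- x ∷ 0# ∷ 1# ∷ []) y ≈ 0# → ∃[ y ] y * y ≈ x
    root (y , e) = y , x-y≈0⇒x≈y (y * y) x (trans
      (solve 2 (λ x y → y :* y :- x := :- x :+ y :* (:0 :+ y :* (:1 :+ y :* :0))) refl x y) e)

  -- All symbols are computed as elements of k̄; since 1 ≠ -1 there, equalities of signs may be
  -- tested after `ε`.
  ε : Sign → Carrier
  ε Sign.+ = 1#
  ε Sign.- = - 1#

  ε-* : ∀ s t → ε (s Sign.* t) ≈ ε s * ε t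
  ε-* Sign.+ t      = sym (*-identityˡ _)
  ε-* Sign.- Sign.+ = sym (*-identityʳ _)
  ε-* Sign.- Sign.- = sym -1*-1

  ε-injective : ∀ s t → ε s ≈ ε t → s ≡ t
  ε-injective Sign.+ Sign.+ e = ≡.refl
  ε-injective Sign.+ Sign.- e = ⊥-elim (1≉-1 e)
  ε-injective Sign.- Sign.+ e = ⊥-elim (1≉-1 (sym e))
  ε-injective Sign.- Sign.- e = ≡.refl

  square-one : ∀ x → x * x ≈ 1# → ¬ x ≈ 1# → x ≈ - 1#
  square-one x e x≉1 = x-y≈0⇒x≈y x (- 1#) (*-cancel-0 (x - 1#) (x - - 1#) (x≉1 ∘ x-y≈0⇒x≈y x 1#) (trans
    (solve 1 (λ x → (x :- :1) :* (x :- :- :1) := x :* x :- :1) refl x) (x≈y⇒x-y≈0 e)))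

  half-square : ∀ d x → ¬ x ≈ 0# → frobenius d x ≈ x → x ^ H d * x ^ H d ≈ 1#
  half-square d x x≉0 fixed = *-cancelˡ x x≉0
    (trans (sym (frobenius-half d x)) (trans fixed (sym (*-identityʳ x))))

  -- If x = y² with y in k_d, then x ^ H = y ^ (q ^ d - 1) = 1. Conversely x ^ H is a square root of
  -- 1, and if it is 1, any square root y of x in k̄ satisfies y ^ (q ^ d) = y x ^ H = y and so lies
  -- in k_d.
  euler : ∀ d x → ¬ x ≈ 0# → frobenius d x ≈ x → ε (legendre d x) ≈ x ^ H d
  euler d x x≉0 fixed = decide (squareIn? d x)
    where
    decide : (D : Dec (SquareIn d x)) → ε (if does D then Sign.+ else Sign.-) ≈ x ^ H d
    decide (yes (y , y-fixed , y²≈x)) = sym (begin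
      x ^ H d              ≈⟨ ^-congˡ (H d) (sym y²≈x) ⟩
      (y * y) ^ H d        ≈⟨ ^-distrib-* y y (H d) ⟩
      y ^ H d * y ^ H d
        ≈⟨ half-square d y (λ y≈0 → x≉0 (trans (sym y²≈x) (trans (*-congˡ y≈0) (zeroʳ y)))) y-fixed ⟩
      1#                   ∎)
    decide (no ¬square) = sym (square-one (x ^ H d) (half-square d x x≉0 fixed)
      λ x^H≈1 → ¬square (proj₁ (sqrt x) , (begin
        frobenius d y            ≈⟨ frobenius-half d y ⟩
        y * (y ^ H d * y ^ H d)  ≈⟨ *-congˡ (sym (^-distrib-* y y (H d))) ⟩
        y * (y * y) ^ H d        ≈⟨ *-congˡ (^-congˡ (H d) (proj₂ (sqrt x))) ⟩
        y * x ^ H d              ≈⟨ *-congˡ x^H≈1 ⟩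
        y * 1#                   ≈⟨ *-identityʳ y ⟩
        y                        ∎) , proj₂ (sqrt x)))
      where
      y : Carrier
      y = proj₁ (sqrt x)

  product-^ : ∀ {m} (f : Vector Carrier m) n → product f ^ n ≈ product λ i → f i ^ n
  product-^ f n = sum-homo {A = *-rawMonoid} *-commutativeMonoid (_^ n) (1^ n) (λ x y → ^-distrib-* x y n) f

  -- For b = q ^ d, (b ^ s - 1) / 2 = (1 + b + ... + b ^ (s - 1)) (b - 1) / 2. When z lies in the
  -- field of degree d s, the product on the right is its norm to k_d.
  ^-half : ∀ d s z → z ^ half (q ℕ.^ d) (H d) s ≈ product {s} (λ u → frobenius (d ℕ.* toℕ u) z) ^ H d
  ^-half d zero    z = sym (1^ (H d))
  ^-half d (suc s) z = begin
    z ^ (H d ℕ.+ q ℕ.^ d ℕ.* R)          ≈⟨ ^-homo-* z (H d) _ ⟩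
    z ^ H d * z ^ (q ℕ.^ d ℕ.* R)
      ≈⟨ *-cong (^-congˡ (H d) (sym (trans (^-≡ z (≡.cong (q ℕ.^_) (ℕ.*-zeroʳ d))) (frobenius-0 z))))
           (sym (^-assocʳ z (q ℕ.^ d) R)) ⟩
    frobenius (d ℕ.* 0) z ^ H d * frobenius d z ^ R
      ≈⟨ *-congˡ (^-half d s (frobenius d z)) ⟩
    frobenius (d ℕ.* 0) z ^ H d * product {s} (λ u → frobenius (d ℕ.* toℕ u) (frobenius d z)) ^ H d
      ≈⟨ *-congˡ (^-congˡ (H d) (product-cong s λ u →
           trans (frobenius-+ (d ℕ.* toℕ u) d z)
             (reflexive (≡.cong (λ t → frobenius t z) (≡.sym (ℕ.*-suc d (toℕ u))))))) ⟩
    frobenius (d ℕ.* 0) z ^ H d * product {s} (λ u → frobenius (d ℕ.* suc (toℕ u)) z) ^ H d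
      ≈⟨ sym (^-distrib-* _ _ (H d)) ⟩
    product {suc s} (λ u → frobenius (d ℕ.* toℕ u) z) ^ H d ∎
    where
    R = half (q ℕ.^ d) (H d) s

  frobenius-multiple : ∀ d x → frobenius d x ≈ x → ∀ n → frobenius (n ℕ.* d) x ≈ x
  frobenius-multiple d x fixed zero    = frobenius-0 x
  frobenius-multiple d x fixed (suc n) = trans (sym (frobenius-+ (n ℕ.* d) d x))
    (trans (frobenius-cong (n ℕ.* d) fixed) (frobenius-multiple d x fixed n))

  frobenius-mod : ∀ d x → frobenius d x ≈ x → ∀ s n → frobenius (s ℕ.+ n ℕ.* d) x ≈ frobenius s x
  frobenius-mod d x fixed s n = trans (reflexive (≡.cong (λ t → frobenius t x) (ℕ.+-comm s (n ℕ.* d))))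
    (trans (sym (frobenius-+ s (n ℕ.* d) x)) (frobenius-cong s (frobenius-multiple d x fixed n)))

  vandermonde : ∀ {n} → Vector Carrier n → Carrier
  vandermonde {zero}  a = 1#
  vandermonde {suc n} a = product (λ t → a zero - a (suc t)) * vandermonde (a ∘ suc)

  vandermonde-cong : ∀ n {a b : Vector Carrier n} → (∀ t → a t ≈ b t) → vandermonde a ≈ vandermonde b
  vandermonde-cong zero    e = refl
  vandermonde-cong (suc n) e = *-cong (product-cong n λ t → +-cong (e zero) (-‿cong (e (suc t))))
    (vandermonde-cong n (e ∘ suc))

  vandermonde-nonzero : ∀ n (a : Vector Carrier n) → Distinct a → ¬ vandermonde a ≈ 0#
  vandermonde-nonzero zero    a distinct = 1≉0
  vandermonde-nonzero (suc n) a distinct = *-nonzero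
    (product-nonzero (λ t → a zero - a (suc t)) λ t e → Fin.0≢1+n (distinct _ _ (x-y≈0⇒x≈y _ _ e)))
    (vandermonde-nonzero n (a ∘ suc) λ s t e → Fin.suc-injective (distinct _ _ e))

  -- The product peeled off at the last index instead of the first: Frobenius moves the last
  -- conjugate to the front, so both ends are needed.
  vandermonde-last : ∀ n (a : Vector Carrier (suc n)) → vandermonde a ≈
    vandermonde (a ∘ inject₁) * product {n} (λ t → a (inject₁ t) - a (fromℕ n))
  vandermonde-last zero    a = refl
  vandermonde-last (suc n) a = begin
    product {suc n} (λ t → a zero - a (suc t)) * vandermonde (a ∘ suc)
      ≈⟨ *-cong (product-init-last {n} (λ t → a zero - a (suc t))) (vandermonde-last n (a ∘ suc)) ⟩
    (A * x) * (B * Y)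
      ≈⟨ solve 4 (λ A x B Y → (A :* x) :* (B :* Y) := (A :* B) :* (x :* Y)) refl A x B Y ⟩
    (A * B) * (x * Y) ∎
    where
    open MonoidSum *-commutativeMonoid using () renaming (sum-init-last to product-init-last)
    A = product {n} (λ t → a zero - a (suc (inject₁ t)))
    x = a zero - a (suc (fromℕ n))
    B = vandermonde {n} (λ t → a (suc (inject₁ t)))
    Y = product {n} (λ t → a (suc (inject₁ t)) - a (suc (fromℕ n)))

  product-flip : ∀ n (a : Vector Carrier n) x →
    product (λ t → a t - x) ≈ (- 1#) ^ n * product (λ t → x - a t)
  product-flip zero    a x = sym (*-identityˡ 1#)
  product-flip (suc n) a x = trans (*-congˡ (product-flip n (a ∘ suc) x))
    (solve 4 (λ a x s p → (a :- x) :* (s :* p) := (:- :1 :* s) :* ((x :- a) :* p)) refl (a zero) x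
        ((- 1#) ^ n) _)

  -- The exponent has the parity of d (d - 1) / 2; `sign-suc` is the recursion d (d + 1) / 2 = d + d
  -- (d - 1) / 2.
  sign : ℕ → Carrier
  sign d = (- 1#) ^ ℕ.⌊ d /2⌋

  sign-suc : ∀ n → sign (suc n) ≈ (- 1#) ^ n * sign n
  sign-suc zero          = sym (*-identityˡ 1#)
  sign-suc (suc zero)    = sym (*-identityʳ _)
  sign-suc (suc (suc n)) = trans (*-congˡ (sign-suc n))
    (solve 2 (λ s p → :- :1 :* (p :* s) := (:- :1 :* (:- :1 :* p)) :* (:- :1 :* s)) refl (sign n) ((- 1#) ^ n))

  -- Each unordered pair contributes (a_u - a_t) (a_t - a_u) = -(a_u - a_t)². In the induction, row
  -- 0 gives the product A of the differences a₀ - a_t, and column 0 gives it once more with the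
  -- sign (-1)ⁿ.
  discriminant : ∀ n (a : Vector Carrier n) →
    product (λ u → product (except u λ t → a u - a t)) ≈ sign n * (vandermonde a * vandermonde a)
  discriminant zero    a = solve 0 (:1 := :1 :* (:1 :* :1)) refl
  discriminant (suc n) a = begin
    product (λ u → product (except u λ t → a u - a t))
      ≈⟨ refl ⟩
    1# * A * product (λ u → (a (suc u) - a zero) * product (except u λ t → a (suc u) - a (suc t)))
      ≈⟨ *-congˡ (product-distrib-* (λ u → a (suc u) - a zero) _) ⟩
    1# * A * (product (λ u → a (suc u) - a zero) * product (λ u → product (except u λ t → a (suc u) - a
        (suc t))))
      ≈⟨ *-congˡ (*-cong (product-flip n (a ∘ suc) (a zero)) (discriminant n (a ∘ suc))) ⟩
    1# * A * (((- 1#) ^ n * A) * (sign n * (V * V)))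
      ≈⟨ solve 4 (λ A p s V → :1 :* A :* ((p :* A) :* (s :* (V :* V))) :=
          (p :* s) :* ((A :* V) :* (A :* V))) refl A ((- 1#) ^ n) (sign n) V ⟩
    ((- 1#) ^ n * sign n) * ((A * V) * (A * V))
      ≈⟨ *-congʳ (sym (sign-suc n)) ⟩
    sign (suc n) * (vandermonde a * vandermonde a) ∎
    where
    open MonoidSum *-commutativeMonoid using () renaming (∑-distrib-+ to product-distrib-*)
    A = product {n} (λ t → a zero - a (suc t))
    V = vandermonde (a ∘ suc)

  -- Frobenius permutes the conjugates cyclically.
  vandermonde-orbit : ∀ n (δ : Carrier) → frobenius (suc n) δ ≈ δ →
    let V = vandermonde {suc n} (λ t → frobenius (toℕ t) δ) in frobenius 1 V ≈ (- 1#) ^ n * V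
  vandermonde-orbit n δ period = begin
    frobenius 1 (vandermonde a)                    ≈⟨ vandermonde-homo (suc n) a ⟩
    vandermonde (frobenius 1 ∘ a)                  ≈⟨ vandermonde-last n (frobenius 1 ∘ a) ⟩
    vandermonde (frobenius 1 ∘ a ∘ inject₁) * product {n}
        (λ t → frobenius 1 (a (inject₁ t)) - frobenius 1 (a (fromℕ n)))
      ≈⟨ *-cong (vandermonde-cong n shift)
           (product-cong n λ t → +-cong (shift t) (-‿cong last)) ⟩
    -- The image of the last conjugate is δ, which now stands second in its differences; reversing
    -- these n differences costs (-1)ⁿ.
    vandermonde b * product {n} (λ t → b t - a zero) ≈⟨ *-congˡ (product-flip n b (a zero)) ⟩
    vandermonde b * ((- 1#) ^ n * product {n} (λ t → a zero - b t))
      ≈⟨ solve 3 (λ V p A → V :* (p :* A) := p :* (A :* V)) refl (vandermonde b) ((- 1#) ^ n)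
          (product {n} (λ t → a zero - b t)) ⟩
    (- 1#) ^ n * vandermonde a ∎
    where
    a : Fin (suc n) → Carrier
    a t = frobenius (toℕ t) δ
    b : Fin n → Carrier
    b t = a (suc t)
    shift : ∀ t → frobenius 1 (a (inject₁ t)) ≈ b t
    shift t = trans (sym (frobenius-step (toℕ (inject₁ t)) δ))
      (reflexive (≡.cong (λ t → frobenius (suc t) δ) (Fin.toℕ-inject₁ t)))
    last : frobenius 1 (a (fromℕ n)) ≈ a zero
    last = trans (sym (frobenius-step (toℕ (fromℕ n)) δ))
      (trans (reflexive (≡.cong (λ t → frobenius (suc t) δ) (Fin.toℕ-fromℕ n)))
          (trans period (sym (frobenius-0 δ))))
    vandermonde-homo : ∀ n (a : Vector Carrier n) → frobenius 1 (vandermonde a) ≈ vandermonde (frobenius 1 ∘ a)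
    vandermonde-homo zero    a = frobenius.1#-homo 1
    vandermonde-homo (suc n) a = trans (frobenius.*-homo 1 _ _) (*-cong
      (trans (frobenius.product-homomorphic 1 {n} (λ t → a zero - a (suc t)))
        (product-cong n λ t → frobenius.difference-homo 1 _ _))
      (vandermonde-homo n (a ∘ suc)))

  module _
    (P : k.Poly) (e : ℕ) (monic : k.MonicOfDegree e P)
    (irreducible : RawSemiringDefs.Irreducible (Semiring.rawSemiring k.Poly.semiring) P)
    (δ : Carrier) (root : eval ι[ P ] δ ≈ 0#)
    (N : ℕ) (r : Fin N → Carrier) (finite : ∀ x → eval ι[ P ] x ≈ 0# → ∃[ l ] r l ≈ x)
    where
    open Conjugates k q size k̄ using (module MinimalPolynomial)
    open MinimalPolynomial P e monic irreducible δ root N r finite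

    -- The exponent H e is h₁ times 1 + q + ... + q ^ (e - 1), so the left side is the norm of P′(δ)
    -- to the power h₁ = (q - 1) / 2. There the square of the Vandermonde product contributes V ^ (q
    -- - 1), which is the first sign.
    derivative-half : eval ι[ k.derivative P ] δ ^ H e ≈ (- 1#) ^ (e ℕ.∸ 1) * sign e ^ h₁
    derivative-half = trans (trans (^-≡ z half-e) (^-half 1 e z))
        (case e d-positive d-period conjugate-distinct norm)
      where
      z = eval ι[ k.derivative P ] δ
      half-e : H e ≡ half (q ℕ.^ 1) (H 1) e
      half-e = ≡.trans (≡.cong H (≡.sym (ℕ.*-identityˡ e))) (half-* q h₁ 1 e q≡1+2h₁)
      H1 : H 1 ≡ h₁
      H1 = ≡.trans (≡.cong (h₁ ℕ.+_) (ℕ.*-zeroʳ q)) (ℕ.+-identityʳ h₁)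
      norm : ∀ (u : Fin e) → frobenius (1 ℕ.* toℕ u) z ≈ product (except u λ t → conjugate u - conjugate t)
      norm u = begin
        frobenius (1 ℕ.* toℕ u) z
          ≡⟨ ≡.cong (λ t → frobenius t z) (ℕ.*-identityˡ (toℕ u)) ⟩
        frobenius (toℕ u) z                                ≈⟨ frobenius-eval (toℕ u) (k.derivative P) δ ⟩
        eval ι[ k.derivative P ] (conjugate u)   ≈⟨ eval-congˡ _ _ (conjugate u) (ι.derivative-map P) ⟩
        eval (derivative ι[ P ]) (conjugate u)     ≈⟨ derivative-cong _ _ (conjugate u) P-factors ⟩
        eval (derivative orbitPoly) (conjugate u)          ≈⟨ derivative-productₚ conjugate u ⟩
        product (except u λ t → conjugate u - conjugate t) ∎
      case : ∀ e → 0 < e → frobenius e δ ≈ δ → Distinct (λ (t : Fin e) → frobenius (toℕ t) δ) →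
        (∀ (u : Fin e) → frobenius (1 ℕ.* toℕ u) z
            ≈ product (except u λ t → frobenius (toℕ u) δ - frobenius (toℕ t) δ)) →
        product {e} (λ u → frobenius (1 ℕ.* toℕ u) z) ^ H 1 ≈ (- 1#) ^ (e ℕ.∸ 1) * sign e ^ h₁
      case (suc n) _ period distinct norm = begin
        product {suc n} (λ u → frobenius (1 ℕ.* toℕ u) z) ^ H 1
          ≈⟨ trans (^-congˡ (H 1) (trans (product-cong (suc n) norm) (discriminant (suc n) a))) (^-≡ _ H1) ⟩
        (sign (suc n) * (V * V)) ^ h₁
          ≈⟨ trans (^-distrib-* _ _ h₁) (*-congˡ (trans (^-distrib-* V V h₁) V²)) ⟩
        sign (suc n) ^ h₁ * (- 1#) ^ n
          ≈⟨ *-comm _ _ ⟩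
        (- 1#) ^ n * sign (suc n) ^ h₁ ∎
        where
        a : Fin (suc n) → Carrier
        a t = frobenius (toℕ t) δ
        V = vandermonde a
        V² : V ^ h₁ * V ^ h₁ ≈ (- 1#) ^ n
        V² = *-cancelˡ V (vandermonde-nonzero (suc n) a distinct) (begin
          V * (V ^ h₁ * V ^ h₁)        ≈⟨ *-congˡ (sym (^-homo-* V h₁ h₁)) ⟩
          V * V ^ (h₁ ℕ.+ h₁)          ≈⟨ ^-≡ V (≡.sym q≡1+2h₁) ⟩
          V ^ q                        ≈⟨ sym (frobenius-1 V) ⟩
          frobenius 1 V                ≈⟨ vandermonde-orbit n δ period ⟩
          (- 1#) ^ n * V               ≈⟨ *-comm _ _ ⟩
          V * (- 1#) ^ n               ∎)

    -- Over the field of qᵈ elements, P splits into gcd(d, e) factors,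
    -- whose roots are the orbits of x ↦ x ^ qᵈ.
    orbits : ∀ d D → gcd d e ℕ.* D ≡ e → ∀ x → eval ι[ P ] x ≈
      product {gcd d e} λ t → product {D} λ u → x - frobenius (toℕ t ℕ.+ d ℕ.* toℕ u) δ
    -- Both sides are monic of degree e = G D, so it suffices that each conjugate of δ occurs among
    -- the `ρ t u`; which one it is comes from `residues`.
    orbits d D GD≡e x = trans (eval-congˡ ι[ P ] factors x (monic-agreeing e ι[ P ] factors conjugate
        conjugate-distinct (ι.Monic-map e {P} monic)
        (≡.subst (λ n → MonicOfDegree n factors) GD≡e (Monic-product G D _ λ t → Monic-productₚ (ρ t)))
        λ s → trans (root-conjugate P root s)
            (sym (trans (eval-factors (conjugate s)) (vanish s (residues d e d-positive D GD≡e (toℕ s)))))))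
      (eval-factors x)
      where
      G = gcd d e
      ρ : Fin G → Fin D → Carrier
      ρ t u = frobenius (toℕ t ℕ.+ d ℕ.* toℕ u) δ
      factors : Poly
      factors = productₚ {G} λ t → productₚ {D} λ u → T +ₚ (-ₚ const (ρ t u))
      eval-factors : ∀ x → eval factors x ≈ product {G} λ t → product {D} λ u → x - ρ t u
      eval-factors x = trans (eval-product {G} (λ t → productₚ {D} λ u → T +ₚ (-ₚ const (ρ t u))) x)
        (product-cong G λ t → eval-productₚ (ρ t) x)
      vanish : ∀ s → (∃[ t ] ∃[ u ] t < G × u < D × ∃[ m ] ∃[ n ] toℕ s ℕ.+ m ℕ.* e
          ≡ t ℕ.+ d ℕ.* u ℕ.+ n ℕ.* e) →
        product {G} (λ t → product {D} λ u → conjugate s - ρ t u) ≈ 0#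
      vanish s (t , u , t<G , u<D , m , n , eq) = zero-product _ (fromℕ< t<G) (zero-product _ (fromℕ< u<D)
        (x≈y⇒x-y≈0 (begin
          frobenius (toℕ s) δ                       ≈⟨ sym (frobenius-mod e δ d-period (toℕ s) m) ⟩
          frobenius (toℕ s ℕ.+ m ℕ.* e) δ           ≡⟨ ≡.cong (λ t → frobenius t δ) eq ⟩
          frobenius (t ℕ.+ d ℕ.* u ℕ.+ n ℕ.* e) δ   ≈⟨ frobenius-mod e δ d-period (t ℕ.+ d ℕ.* u) n ⟩
          frobenius (t ℕ.+ d ℕ.* u) δ
            ≡⟨ ≡.sym (≡.cong₂ (λ t u → frobenius (t ℕ.+ d ℕ.* u) δ) (Fin.toℕ-fromℕ< t<G) (Fin.toℕ-fromℕ< u<D)) ⟩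
          ρ (fromℕ< t<G) (fromℕ< u<D)               ∎)))

    norm-half : ∀ d x → frobenius d x ≈ x → eval ι[ P ] x ^ H d ≈
      product {gcd d e} λ t → (x - frobenius (toℕ t) δ) ^ H (lcm d e)
    norm-half d x x-fixed = begin
      eval ι[ P ] x ^ H d
        ≈⟨ ^-congˡ (H d) (orbits d D GD≡e x) ⟩
      product {gcd d e} (λ t → product {D} λ u → x - frobenius (toℕ t ℕ.+ d ℕ.* toℕ u) δ) ^ H d
        ≈⟨ product-^ {gcd d e} _ (H d) ⟩
      product {gcd d e} (λ t → product {D} (λ u → x - frobenius (toℕ t ℕ.+ d ℕ.* toℕ u) δ) ^ H d)
        ≈⟨ product-cong (gcd d e) (λ t → sym (factor t)) ⟩
      product {gcd d e} (λ t → (x - frobenius (toℕ t) δ) ^ H (lcm d e)) ∎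
      where
      D = _∣_.quotient (gcd[m,n]∣n d e)
      GD≡e : gcd d e ℕ.* D ≡ e
      GD≡e = ≡.trans (ℕ.*-comm (gcd d e) D) (≡.sym (_∣_.equality (gcd[m,n]∣n d e)))
      0<G : 0 < gcd d e
      0<G = ℕ.n≢0⇒n>0 λ G≡0 → ℕ.<-irrefl ≡.refl
          (≡.subst (0 <_) (≡.trans (≡.sym GD≡e) (≡.cong (ℕ._* D) G≡0)) d-positive)
      -- Here [d, e] = d D, and x is fixed by the d-th iterate of Frobenius, so only the second term
      -- of x - δ ^ (q ^ t) moves.
      factor : ∀ t → (x - frobenius (toℕ t) δ) ^ H (lcm d e) ≈
        product {D} (λ u → x - frobenius (toℕ t ℕ.+ d ℕ.* toℕ u) δ) ^ H d
      factor t = begin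
        z ^ H (lcm d e)
          ≈⟨ ^-≡ z (≡.trans (≡.cong H (lcm-cofactor d e D 0<G GD≡e)) (half-* q h₁ d D q≡1+2h₁)) ⟩
        z ^ half (q ℕ.^ d) (H d) D            ≈⟨ ^-half d D z ⟩
        product {D} (λ u → frobenius (d ℕ.* toℕ u) z) ^ H d
          ≈⟨ ^-congˡ (H d) (product-cong D λ u → trans (frobenius.difference-homo (d ℕ.* toℕ u) _ _)
               (+-cong (trans (reflexive (≡.cong (λ t → frobenius t x) (ℕ.*-comm d (toℕ u))))
                   (frobenius-multiple d x x-fixed (toℕ u)))
                 (-‿cong (frobenius-+ (d ℕ.* toℕ u) (toℕ t) δ)))) ⟩
        product {D} (λ u → x - frobenius (toℕ t ℕ.+ d ℕ.* toℕ u) δ) ^ H d ∎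
        where
        z = x - frobenius (toℕ t) δ

-- Matrices and eigenvectors

module MatrixProperties {c ℓ} (R : CommutativeRing c ℓ) where
  open CommutativeRing R hiding (zero)
  open RawSemiringDefs (Semiring.rawSemiring semiring) using (sum; _^_)
  open PolynomialProperties R
  open Matrices R
  open SemiringSum semiring using (∑-comm; *-distribˡ-sum; *-distribʳ-sum; ∑-distrib-+; sum-init-last)
  open Solver R
  open SetoidReasoning setoid

  ∑-cong : ∀ n {f g : Vector Carrier n} → (∀ i → f i ≈ g i) → sum f ≈ sum g
  ∑-cong = sum-cong +-commutativeMonoid

  1ᴹ-diagonal : ∀ {n} (i : Fin n) → 1ᴹ i i ≈ 1#
  1ᴹ-diagonal i with i Fin.≟ i
  ... | yes _  = refl
  ... | no i≢i = ⊥-elim (i≢i ≡.refl)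

  1ᴹ-off-diagonal : ∀ {n} {i j : Fin n} → i ≢ j → 1ᴹ i j ≈ 0#
  1ᴹ-off-diagonal {i = i} {j} i≢j with i Fin.≟ j
  ... | yes i≡j = ⊥-elim (i≢j i≡j)
  ... | no _    = refl

  ∑-1ᴹʳ : ∀ {n} (w : Vector Carrier n) j → sum (λ l → w l * 1ᴹ l j) ≈ w j
  ∑-1ᴹʳ w j = trans (sum-single +-commutativeMonoid (λ l → w l * 1ᴹ l j) j
      λ l l≢j → trans (*-congˡ (1ᴹ-off-diagonal l≢j)) (zeroʳ _))
    (trans (*-congˡ (1ᴹ-diagonal j)) (*-identityʳ _))

  ∑-1ᴹˡ : ∀ {n} (w : Vector Carrier n) i → sum (λ l → 1ᴹ i l * w l) ≈ w i
  ∑-1ᴹˡ w i = trans (sum-single +-commutativeMonoid (λ l → 1ᴹ i l * w l) i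
      λ l l≢i → trans (*-congʳ (1ᴹ-off-diagonal (l≢i ∘ ≡.sym))) (zeroˡ _))
    (trans (*-congʳ (1ᴹ-diagonal i)) (*-identityˡ _))

  -- Associativity for row, matrix and column; `A` is rectangular because it also stands for a
  -- family of eigenvectors.
  ∑-assoc : ∀ {m n} (w : Vector Carrier m) (A : Fin m → Fin n → Carrier) (x : Vector Carrier n) →
    sum (λ l → w l * sum (λ j → A l j * x j)) ≈ sum (λ j → sum (λ l → w l * A l j) * x j)
  ∑-assoc {m} {n} w A x = begin
    sum (λ l → w l * sum (λ j → A l j * x j))
      ≈⟨ ∑-cong m (λ l → *-distribˡ-sum (w l) (λ j → A l j * x j)) ⟩
    sum (λ l → sum (λ j → w l * (A l j * x j)))
      ≈⟨ ∑-comm (λ l j → w l * (A l j * x j)) ⟩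
    sum (λ j → sum (λ l → w l * (A l j * x j)))
      ≈⟨ ∑-cong n (λ j → trans (∑-cong m λ l → sym (*-assoc _ _ _))
          (sym (*-distribʳ-sum (x j) (λ l → w l * A l j)))) ⟩
    sum (λ j → sum (λ l → w l * A l j) * x j) ∎

  -- Row vectors, because evaluating `Φ` at a root yields linear functionals; w = 0 is not excluded.
  LeftEigenvector : ∀ {n} → Matrix n → Carrier → Vector Carrier n → Set ℓ
  LeftEigenvector A ρ w = ∀ j → sum (λ l → w l * A l j) ≈ ρ * w j

  evalᴹ-eigenvector : ∀ {n} f (A : Matrix n) ρ w → LeftEigenvector A ρ w →
    LeftEigenvector (evalᴹ f A) (eval f ρ) w
  evalᴹ-eigenvector {n} []      A ρ w e j = trans
      (sum-ε +-commutativeMonoid (λ l → w l * 0#) (λ l → zeroʳ _)) (sym (zeroˡ _))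
  evalᴹ-eigenvector {n} (a ∷ f) A ρ w e j = begin
    sum (λ l → w l * (a * 1ᴹ l j + sum (λ m → A l m * E m j)))
      ≈⟨ trans (∑-cong n λ l → distribˡ _ _ _) (∑-distrib-+ (λ l → w l * (a * 1ᴹ l j)) _) ⟩
    sum (λ l → w l * (a * 1ᴹ l j)) + sum (λ l → w l * sum (λ m → A l m * E m j))
      ≈⟨ +-cong (trans (∑-cong n λ l → trans (sym (*-assoc _ _ _)) (*-congʳ (*-comm _ _)))
          (∑-1ᴹʳ (λ l → a * w l) j))
           (∑-assoc w A (λ m → E m j)) ⟩
    a * w j + sum (λ m → sum (λ l → w l * A l m) * E m j)
      ≈⟨ +-congˡ (∑-cong n λ m → trans (*-congʳ (e m)) (*-assoc _ _ _)) ⟩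
    a * w j + sum (λ m → ρ * (w m * E m j))
      ≈⟨ +-congˡ (sym (*-distribˡ-sum ρ (λ m → w m * E m j))) ⟩
    a * w j + ρ * sum (λ m → w m * E m j)
      ≈⟨ +-congˡ (*-congˡ (evalᴹ-eigenvector f A ρ w e j)) ⟩
    a * w j + ρ * (eval f ρ * w j)
      ≈⟨ solve 4 (λ a ρ F x → a :* x :+ ρ :* (F :* x) := (a :+ ρ :* F) :* x) refl a ρ (eval f ρ) (w j) ⟩
    (a + ρ * eval f ρ) * w j ∎
    where
    E = evalᴹ f A

  evalᴹ-const : ∀ {n} a (A : Matrix n) i j → evalᴹ (const a) A i j ≈ a * 1ᴹ i j
  evalᴹ-const {n} a A i j = trans (+-congˡ (sum-ε +-commutativeMonoid (λ l → A i l * 0#) λ l → zeroʳ _))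
      (+-identityʳ _)

  evalᴹ-T : ∀ {n} (A : Matrix n) → evalᴹ T A ≋ A
  evalᴹ-T {n} A i j = trans (+-cong (zeroˡ _)
      (trans (∑-cong n λ l → *-congˡ (trans (evalᴹ-const 1# A l j) (*-identityˡ _)))
    (∑-1ᴹʳ (A i) j))) (+-identityˡ _)

  *ᴹ-assoc : ∀ {n} (A B C : Matrix n) → (A *ᴹ B) *ᴹ C ≋ A *ᴹ (B *ᴹ C)
  *ᴹ-assoc A B C i j = sym (∑-assoc (A i) B (λ l → C l j))

  *ᴹ-congˡ : ∀ {n} (A : Matrix n) {B C} → B ≋ C → A *ᴹ B ≋ A *ᴹ C
  *ᴹ-congˡ {n} A e i j = ∑-cong n λ l → *-congˡ (e l j)

  *ᴹ-congʳ : ∀ {n} (A : Matrix n) {B C} → B ≋ C → B *ᴹ A ≋ C *ᴹ A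
  *ᴹ-congʳ {n} A e i j = ∑-cong n λ l → *-congʳ (e i l)

  evalᴹ-cong : ∀ {n} f {A B : Matrix n} → A ≋ B → evalᴹ f A ≋ evalᴹ f B
  evalᴹ-cong     []      A≋B i j = refl
  evalᴹ-cong {n} (a ∷ f) A≋B i j = +-congˡ (∑-cong n λ l → *-cong (A≋B i l) (evalᴹ-cong f A≋B l j))

  eval-sum : ∀ n f x → Below n f → eval f x ≈ sum {n} λ i → coeff f (toℕ i) * x ^ toℕ i
  eval-sum zero    f       x f<n = eval-0 f x (Below-0 {f} f<n)
  eval-sum (suc n) []      x f<n = sym
      (sum-ε +-commutativeMonoid {suc n} (λ i → 0# * x ^ toℕ i) λ i → zeroˡ (x ^ toℕ i))
  eval-sum (suc n) (a ∷ f) x f<n = +-cong (sym (*-identityʳ a)) (trans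
    (*-congˡ (eval-sum n f x λ e n≤e → f<n (suc e) (s≤s n≤e)))
    (trans (*-distribˡ-sum x (λ (i : Fin n) → coeff f (toℕ i) * x ^ toℕ i))
      (∑-cong n λ i → solve 3 (λ x a p → x :* (a :* p) := a :* (x :* p)) refl x (coeff f (toℕ i)) (x ^ toℕ i))))

  monomial : ℕ → Poly
  monomial zero    = const 1#
  monomial (suc i) = 0# ∷ monomial i

  eval-monomial : ∀ i x → eval (monomial i) x ≈ x ^ i
  eval-monomial zero    x = eval-const 1# x
  eval-monomial (suc i) x = trans (+-identityˡ _) (*-congˡ (eval-monomial i x))

  coeff-monomial : ∀ i → coeff (monomial i) i ≈ 1#
  coeff-monomial zero    = refl
  coeff-monomial (suc i) = coeff-monomial i

  coeff-monomial-other : ∀ i j → i ≢ j → coeff (monomial i) j ≈ 0#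
  coeff-monomial-other zero    zero    i≢j = ⊥-elim (i≢j ≡.refl)
  coeff-monomial-other zero    (suc j) i≢j = refl
  coeff-monomial-other (suc i) zero    i≢j = refl
  coeff-monomial-other (suc i) (suc j) i≢j = coeff-monomial-other i j (i≢j ∘ ≡.cong suc)

  companion-last : ∀ {d} P (i j : Fin d) → suc (toℕ j) ≡ d → companion P i j ≈ - coeff P (toℕ i)
  companion-last {d} P i j e with suc (toℕ j) ℕ.≡ᵇ d in eq
  ... | true  = refl
  ... | false with () ← ≡.subst 𝔹.T eq (ℕ.≡⇒≡ᵇ (suc (toℕ j)) d e)

  companion-subdiagonal : ∀ {d} P (i j : Fin d) → suc (toℕ j) ≢ d → toℕ i ≡ suc (toℕ j) → companion P i j ≈ 1#
  companion-subdiagonal {d} P i j ne e with suc (toℕ j) ℕ.≡ᵇ d in eq | toℕ i ℕ.≡ᵇ suc (toℕ j) in eq′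
  ... | true  | _     = ⊥-elim (ne (ℕ.≡ᵇ⇒≡ (suc (toℕ j)) d (≡.subst 𝔹.T (≡.sym eq) _)))
  ... | false | true  = refl
  ... | false | false with () ← ≡.subst 𝔹.T eq′ (ℕ.≡⇒≡ᵇ (toℕ i) (suc (toℕ j)) e)

  companion-other : ∀ {d} P (i j : Fin d) → suc (toℕ j) ≢ d → toℕ i ≢ suc (toℕ j) → companion P i j ≈ 0#
  companion-other {d} P i j ne ne′ with suc (toℕ j) ℕ.≡ᵇ d in eq | toℕ i ℕ.≡ᵇ suc (toℕ j) in eq′
  ... | true  | _     = ⊥-elim (ne (ℕ.≡ᵇ⇒≡ (suc (toℕ j)) d (≡.subst 𝔹.T (≡.sym eq) _)))
  ... | false | true  = ⊥-elim (ne′ (ℕ.≡ᵇ⇒≡ (toℕ i) (suc (toℕ j)) (≡.subst 𝔹.T (≡.sym eq′) _)))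
  ... | false | false = refl

  -- On the coordinates of a polynomial modulo P, the row 1, ρ, ρ², ... is evaluation at the root ρ,
  -- which turns multiplication by T into multiplication by ρ.
  companion-eigenvector : ∀ d P ρ → MonicOfDegree d P → eval P ρ ≈ 0# →
    LeftEigenvector (companion {d} P) ρ (λ j → ρ ^ toℕ j)
  companion-eigenvector d P ρ (lead , high) Pρ≈0 j = decide (suc (toℕ j) ℕ.≟ d)
    where
    decide : Dec (suc (toℕ j) ≡ d) → sum {d} (λ i → ρ ^ toℕ i * companion P i j) ≈ ρ * ρ ^ toℕ j
    decide (yes j+1≡d) = begin
      sum {d} (λ i → ρ ^ toℕ i * companion P i j)
        ≈⟨ ∑-cong d (λ i → trans (*-congˡ (companion-last P i j j+1≡d))
            (solve 2 (λ p c → p :* :- c := :- :1 :* (c :* p)) refl (ρ ^ toℕ i) (coeff P (toℕ i)))) ⟩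
      sum {d} (λ i → - 1# * (coeff P (toℕ i) * ρ ^ toℕ i))
        ≈⟨ sym (*-distribˡ-sum (- 1#) (λ (i : Fin d) → coeff P (toℕ i) * ρ ^ toℕ i)) ⟩
      - 1# * S
        ≈⟨ solve 2 (λ s p → :- :1 :* s := p :- (s :+ p)) refl S (ρ ^ d) ⟩
      ρ ^ d - (S + ρ ^ d)
        ≈⟨ +-congˡ (-‿cong S+ρ^d≈0) ⟩
      ρ ^ d - 0#
        ≈⟨ solve 1 (λ p → p :- :0 := p) refl (ρ ^ d) ⟩
      ρ ^ d
        ≡⟨ ≡.cong (ρ ^_) (≡.sym j+1≡d) ⟩
      ρ * ρ ^ toℕ j ∎
      where
      S = sum {d} (λ i → coeff P (toℕ i) * ρ ^ toℕ i)
      S+ρ^d≈0 : S + ρ ^ d ≈ 0#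
      S+ρ^d≈0 = sym (begin
        0#                 ≈⟨ sym Pρ≈0 ⟩
        eval P ρ           ≈⟨ eval-sum (suc d) P ρ high ⟩
        sum {suc d} (λ i → coeff P (toℕ i) * ρ ^ toℕ i)
          ≈⟨ sum-init-last {d} (λ i → coeff P (toℕ i) * ρ ^ toℕ i) ⟩
        sum {d} (λ i → coeff P (toℕ (inject₁ i)) * ρ ^ toℕ (inject₁ i)) + coeff P
            (toℕ (fromℕ d)) * ρ ^ toℕ (fromℕ d)
          ≈⟨ +-cong (∑-cong d λ i → reflexive (≡.cong (λ n → coeff P n * ρ ^ n) (Fin.toℕ-inject₁ i)))
               (reflexive (≡.cong (λ n → coeff P n * ρ ^ n) (Fin.toℕ-fromℕ d))) ⟩
        S + coeff P d * ρ ^ d  ≈⟨ +-congˡ (trans (*-congʳ lead) (*-identityˡ _)) ⟩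
        S + ρ ^ d          ∎)
    decide (no j+1≢d) = trans (sum-single +-commutativeMonoid {d} (λ i → ρ ^ toℕ i * companion P i j) j+1
        λ i i≢j+1 → trans (*-congˡ (companion-other P i j j+1≢d λ e → i≢j+1
            (Fin.toℕ-injective (≡.trans e (≡.sym toℕ-j+1))))) (zeroʳ _))
      (trans (*-cong (reflexive (≡.cong (ρ ^_) toℕ-j+1)) (companion-subdiagonal P j+1 j j+1≢d toℕ-j+1))
          (*-identityʳ _))
      where
      j+1<d : suc (toℕ j) < d
      j+1<d = ℕ.≤∧≢⇒< (Fin.toℕ<n j) j+1≢d
      j+1 : Fin d
      j+1 = fromℕ< j+1<d
      toℕ-j+1 : toℕ j+1 ≡ suc (toℕ j)
      toℕ-j+1 = Fin.toℕ-fromℕ< j+1<d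

module MatrixHomomorphism {c ℓ c′ ℓ′} (R : CommutativeRing c ℓ) (S : CommutativeRing c′ ℓ′)
  (h : CommutativeRing.Carrier R → CommutativeRing.Carrier S)
  (isRingHomomorphism : RingMorphisms.IsRingHomomorphism
    (CommutativeRing.rawRing R) (CommutativeRing.rawRing S) h)
  where
  private
    module R where
      open CommutativeRing R public
      open Polynomials R public
      open Matrices R public
    module S where
      open CommutativeRing S public
      open Polynomials S public
      open Matrices S public
      open MatrixProperties S public using (evalᴹ-cong; ∑-cong)
  open Homomorphism R S h isRingHomomorphism

  1ᴹ-homo : ∀ {n} (i j : Fin n) → h (R.1ᴹ i j) S.≈ S.1ᴹ i j
  1ᴹ-homo i j with does (i Fin.≟ j)
  ... | true  = 1#-homo
  ... | false = 0#-homo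

  *ᴹ-homo : ∀ {n} (A B : R.Matrix n) i j →
      h ((A R.*ᴹ B) i j) S.≈ ((λ i j → h (A i j)) S.*ᴹ (λ i j → h (B i j))) i j
  *ᴹ-homo {n} A B i j = S.trans (sum-homomorphic (λ l → A i l R.* B l j)) (S.∑-cong n λ l → *-homo _ _)

  evalᴹ-homo : ∀ {n} f (A : R.Matrix n) i j →
    h (R.evalᴹ f A i j) S.≈ S.evalᴹ (List.map h f) (λ i j → h (A i j)) i j
  evalᴹ-homo     []      A i j = 0#-homo
  evalᴹ-homo {n} (a ∷ f) A i j = S.trans (+-homo _ _) (S.+-cong
    (S.trans (*-homo _ _) (S.*-congˡ (1ᴹ-homo i j)))
    (S.trans (*ᴹ-homo A (R.evalᴹ f A) i j) (S.∑-cong n λ l → S.*-congˡ (evalᴹ-homo f A l j))))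

  companion-homo : ∀ {d} P (i j : Fin d) → h (R.companion P i j) S.≈ S.companion (List.map h P) i j
  companion-homo {d} P i j with suc (toℕ j) ℕ.≡ᵇ d | toℕ i ℕ.≡ᵇ suc (toℕ j)
  ... | true  | _     = S.trans (-‿homo _) (S.-‿cong (S.sym (coeff-map P (toℕ i))))
  ... | false | true  = 1#-homo
  ... | false | false = 0#-homo

  Tr-homo : ∀ d P f → h (R.Tr d P f) S.≈ S.Tr d (List.map h P) (List.map h f)
  Tr-homo d P f = S.trans (sum-homomorphic {d} _) (S.∑-cong d λ i →
    S.trans (evalᴹ-homo f (R.companion P) i i) (S.evalᴹ-cong (List.map h f) (companion-homo P) i i))

-- Lagrange interpolation and traces as sums over roots

module Lagrange {c ℓ} (F : Field c ℓ) (d : ℕ) (P : Polynomials.Poly (Field.commutativeRing F))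
  (ρ : Vector (Field.Carrier F) d)
  (distinct : FieldProperties.Distinct F ρ)
  (monic : Polynomials.MonicOfDegree (Field.commutativeRing F) d P)
  (root : ∀ t → Field._≈_ F (Polynomials.eval (Field.commutativeRing F) P (ρ t)) (Field.0# F))
  where
  open Field F hiding (zero)
  open RawSemiringDefs (Semiring.rawSemiring semiring) using (sum; _^_)
  open PolynomialProperties commutativeRing
  open FieldProperties F
  open Matrices commutativeRing
  open MatrixProperties commutativeRing
  open SemiringSum semiring using (∑-comm; *-distribˡ-sum)
  open Solver commutativeRing
  open SetoidReasoning setoid

  cofactor : Fin d → Poly
  cofactor t = synthetic P (ρ t)

  private
    P′ : Fin d → Carrier
    P′ t = eval (derivative P) (ρ t)

    P′-nonzero : ∀ t → ¬ P′ t ≈ 0#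
    P′-nonzero t e = derivative-nonzero ρ distinct t (trans
      (sym (derivative-cong P _ (ρ t) (factorization d P ρ distinct monic root))) e)

    P′⁻¹ : Fin d → Carrier
    P′⁻¹ t = proj₁ (inverse (P′ t) (P′-nonzero t))

    cofactor-Below : ∀ t → Below d (cofactor t)
    cofactor-Below t = Below-synthetic d P (ρ t) (proj₂ monic)

    sumₚ : ∀ {n} → Vector Poly n → Poly
    sumₚ = RawSemiringDefs.sum (Semiring.rawSemiring Poly.semiring)

    Below-sumₚ : ∀ {n} m (f : Vector Poly n) → (∀ t → Below m (f t)) → Below m (sumₚ f)
    Below-sumₚ {zero}  m f f<m e m≤e = refl
    Below-sumₚ {suc n} m f f<m = Below-+ m {f zero} {sumₚ (f ∘ suc)} (f<m zero)
        (Below-sumₚ m (f ∘ suc) (f<m ∘ suc))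

    coeff-sumₚ : ∀ {n} (f : Vector Poly n) e → coeff (sumₚ f) e ≈ sum λ t → coeff (f t) e
    coeff-sumₚ f e = sum-homo {A = Poly.+-rawMonoid} +-commutativeMonoid (λ f → coeff f e) refl
        (λ f g → coeff-+ f g e) f

    eval-sumₚ : ∀ {n} (f : Vector Poly n) x → eval (sumₚ f) x ≈ sum λ t → eval (f t) x
    eval-sumₚ f x = sum-homo {A = Poly.+-rawMonoid} +-commutativeMonoid (λ f → eval f x) refl
        (λ f g → eval-+ f g x) f

  cofactor-same : ∀ t → P′⁻¹ t * eval (cofactor t) (ρ t) ≈ 1#
  cofactor-same t = trans (*-congˡ (eval-synthetic-derivative P (ρ t))) (proj₂ (inverse (P′ t) (P′-nonzero t)))

  cofactor-other : ∀ t s → t ≢ s → eval (cofactor t) (ρ s) ≈ 0#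
  cofactor-other t s t≢s = eval-synthetic-other P (ρ t) (ρ s) (root t) (root s) λ e → t≢s
      (≡.sym (distinct s t e))

  interpolate : Vector Carrier d → Poly
  interpolate v = sumₚ λ t → (v t * P′⁻¹ t) ·ₚ cofactor t

  eval-interpolate : ∀ v s → eval (interpolate v) (ρ s) ≈ v s
  eval-interpolate v s = begin
    eval (interpolate v) (ρ s)
      ≈⟨ eval-sumₚ {d} (λ t → (v t * P′⁻¹ t) ·ₚ cofactor t) (ρ s) ⟩
    sum (λ t → eval ((v t * P′⁻¹ t) ·ₚ cofactor t) (ρ s))
      ≈⟨ ∑-cong d (λ t → eval-· (v t * P′⁻¹ t) (cofactor t) (ρ s)) ⟩
    sum (λ t → v t * P′⁻¹ t * eval (cofactor t) (ρ s))
      ≈⟨ sum-single +-commutativeMonoid _ s (λ t t≢s → trans (*-congˡ (cofactor-other t s t≢s)) (zeroʳ _)) ⟩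
    v s * P′⁻¹ s * eval (cofactor s) (ρ s)
      ≈⟨ trans (*-assoc _ _ _) (trans (*-congˡ (cofactor-same s)) (*-identityʳ _)) ⟩
    v s ∎

  private
    -- Column t lists the coefficients of the t-th Lagrange basis polynomial, which is 1 at `ρ t`
    -- and 0 at the other roots.
    L : Fin d → Fin d → Carrier
    L j t = P′⁻¹ t * coeff (cofactor t) (toℕ j)

    W : Fin d → Fin d → Carrier
    W t j = ρ t ^ toℕ j

    -- Interpolating the values of T ^ j returns T ^ j itself, as j < d; the coefficients at i are
    -- compared.
    LW≈1 : ∀ i j → sum (λ t → L i t * W t j) ≈ 1ᴹ i j
    LW≈1 i j = begin
      sum (λ t → L i t * W t j)
        ≈⟨ ∑-cong d (λ t → trans (solve 3 (λ p c w → (p :* c) :* w := (w :* p) :* c) refl (P′⁻¹ t)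
            (coeff (cofactor t) (toℕ i)) (W t j))
             (sym (coeff-· (W t j * P′⁻¹ t) (cofactor t) (toℕ i)))) ⟩
      sum (λ t → coeff ((W t j * P′⁻¹ t) ·ₚ cofactor t) (toℕ i))
        ≈⟨ sym (coeff-sumₚ {d} (λ t → (W t j * P′⁻¹ t) ·ₚ cofactor t) (toℕ i)) ⟩
      coeff (interpolate λ t → W t j) (toℕ i)
        ≈⟨ coeff≈ (agreeing d (interpolate λ t → W t j) (monomial (toℕ j)) ρ distinct
             (Below-- d {interpolate λ t → W t j} {monomial (toℕ j)}
               (Below-sumₚ {d} d _ λ t → Below-· d (W t j * P′⁻¹ t) {cofactor t} (cofactor-Below t))
               λ e d≤e → coeff-monomial-other (toℕ j) e λ j≡e → ℕ.<-irrefl j≡e (ℕ.<-≤-trans (Fin.toℕ<n j) d≤e))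
             λ s → trans (eval-interpolate (λ t → W t j) s) (sym (eval-monomial (toℕ j) (ρ s)))) (toℕ i) ⟩
      coeff (monomial (toℕ j)) (toℕ i)
        ≈⟨ delta (i Fin.≟ j) ⟩
      1ᴹ i j ∎
      where
      delta : Dec (i ≡ j) → coeff (monomial (toℕ j)) (toℕ i) ≈ 1ᴹ i j
      delta (yes ≡.refl) = trans (coeff-monomial (toℕ j)) (sym (1ᴹ-diagonal j))
      delta (no i≢j)     = trans (coeff-monomial-other (toℕ j) (toℕ i)
          (i≢j ∘ ≡.sym ∘ Fin.toℕ-injective)) (sym (1ᴹ-off-diagonal i≢j))

    WL-diagonal : ∀ t → sum (λ i → L i t * W t i) ≈ 1#
    WL-diagonal t = begin
      sum (λ i → L i t * W t i)
        ≈⟨ ∑-cong d (λ i → *-assoc _ _ _) ⟩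
      sum {d} (λ i → P′⁻¹ t * (coeff (cofactor t) (toℕ i) * ρ t ^ toℕ i))
        ≈⟨ sym (*-distribˡ-sum (P′⁻¹ t) (λ (i : Fin d) → coeff (cofactor t) (toℕ i) * ρ t ^ toℕ i)) ⟩
      P′⁻¹ t * sum {d} (λ i → coeff (cofactor t) (toℕ i) * ρ t ^ toℕ i)
        ≈⟨ *-congˡ (sym (eval-sum d (cofactor t) (ρ t) (cofactor-Below t))) ⟩
      P′⁻¹ t * eval (cofactor t) (ρ t)
        ≈⟨ cofactor-same t ⟩
      1# ∎

  -- The Vandermonde matrix W diagonalizes the companion matrix, and L is its inverse.
  Tr-roots : ∀ f → Tr d P f ≈ sum λ t → eval f (ρ t)
  Tr-roots f = begin
    sum (λ j → E j j)
      ≈⟨ ∑-cong d (λ j → sym (∑-1ᴹʳ (E j) j)) ⟩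
    sum (λ j → sum λ i → E j i * 1ᴹ i j)
      ≈⟨ ∑-cong d (λ j → ∑-cong d λ i → trans (*-congˡ (sym (LW≈1 i j)))
          (*-distribˡ-sum (E j i) (λ t → L i t * W t j))) ⟩
    sum (λ j → sum λ i → sum λ t → E j i * (L i t * W t j))
      ≈⟨ ∑-cong d (λ j → ∑-comm (λ i t → E j i * (L i t * W t j))) ⟩
    sum (λ j → sum λ t → sum λ i → E j i * (L i t * W t j))
      ≈⟨ ∑-comm (λ j t → sum λ i → E j i * (L i t * W t j)) ⟩
    sum (λ t → sum λ j → sum λ i → E j i * (L i t * W t j))
      ≈⟨ ∑-cong d (λ t → ∑-comm (λ j i → E j i * (L i t * W t j))) ⟩
    sum (λ t → sum λ i → sum λ j → E j i * (L i t * W t j))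
      ≈⟨ ∑-cong d (λ t → ∑-cong d (row t)) ⟩
    sum (λ t → sum λ i → eval f (ρ t) * (L i t * W t i))
      ≈⟨ ∑-cong d (λ t → trans (sym (*-distribˡ-sum (eval f (ρ t)) (λ i → L i t * W t i)))
           (trans (*-congˡ (WL-diagonal t)) (*-identityʳ _))) ⟩
    sum (λ t → eval f (ρ t)) ∎
    where
    E = evalᴹ f (companion {d} P)
    row : ∀ t i → sum (λ j → E j i * (L i t * W t j)) ≈ eval f (ρ t) * (L i t * W t i)
    row t i = begin
      sum (λ j → E j i * (L i t * W t j))
        ≈⟨ ∑-cong d (λ j → solve 3 (λ e l w → e :* (l :* w) := l :* (w :* e)) refl (E j i) (L i t) (W t j)) ⟩
      sum (λ j → L i t * (W t j * E j i))
        ≈⟨ sym (*-distribˡ-sum (L i t) (λ j → W t j * E j i)) ⟩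
      L i t * sum (λ j → W t j * E j i)
        ≈⟨ *-congˡ (evalᴹ-eigenvector f (companion P) (ρ t) (W t)
            (companion-eigenvector d P (ρ t) monic (root t)) i) ⟩
      L i t * (eval f (ρ t) * W t i)
        ≈⟨ solve 3 (λ l f w → l :* (f :* w) := f :* (l :* w)) refl (L i t) (eval f (ρ t)) (W t i) ⟩
      eval f (ρ t) * (L i t * W t i) ∎

-- The Kostant-Weierstrass matrix: its eigenvectors and its cyclic vector

module KostantWeierstrass {c ℓ} (R : CommutativeRing c ℓ) {n : ℕ} (a : Vector (CommutativeRing.Carrier R) n)
  -- `K` agrees with the section only entrywise, so that the image under ι of such a matrix
  -- qualifies; `first` stands for the index 0, as n is not written as a successor.
  (K : Matrices.Matrix R n) (K≋ : Matrices._≋_ R K (Matrices.kostantWeierstrass R a))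
  (first : Fin n) (first≡0 : toℕ first ≡ 0)
  where
  open CommutativeRing R hiding (zero)
  open RawSemiringDefs (Semiring.rawSemiring semiring) using (sum)
  open PolynomialProperties R
  open Matrices R
  open MatrixProperties R
  open SemiringSum semiring using (∑-distrib-+)
  open Solver R
  open SetoidReasoning setoid

  private
    is-first : ∀ {i : Fin n} → toℕ i ≡ 0 → i ≡ first
    is-first e = Fin.toℕ-injective (≡.trans e (≡.sym first≡0))

    ≡ᵇ-true : ∀ m n → m ≡ n → (m ℕ.≡ᵇ n) ≡ true
    ≡ᵇ-true zero    zero    _ = ≡.refl
    ≡ᵇ-true (suc m) (suc n) e = ≡ᵇ-true m n (ℕ.suc-injective e)

    ≡ᵇ-false : ∀ m n → m ≢ n → (m ℕ.≡ᵇ n) ≡ false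
    ≡ᵇ-false zero    zero    ne = ⊥-elim (ne ≡.refl)
    ≡ᵇ-false zero    (suc n) ne = ≡.refl
    ≡ᵇ-false (suc m) zero    ne = ≡.refl
    ≡ᵇ-false (suc m) (suc n) ne = ≡ᵇ-false m n (ne ∘ ≡.cong suc)

    first-row : ∀ i j → toℕ i ≡ 0 → kostantWeierstrass a i j ≈ a j
    first-row i j e rewrite ≡ᵇ-true (toℕ i) 0 e = refl

    subdiagonal : ∀ i j → toℕ i ≢ 0 → suc (toℕ j) ≢ n → toℕ i ≡ suc (toℕ j) → kostantWeierstrass a i j ≈ 1#
    subdiagonal i j i≢0 j≢n e
      rewrite ≡ᵇ-false (toℕ i) 0 i≢0 | ≡ᵇ-false (suc (toℕ j)) n j≢n | ≡ᵇ-true (toℕ i) (suc (toℕ j)) e = refl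

    elsewhere : ∀ i j → toℕ i ≢ 0 → suc (toℕ j) ≢ n → toℕ i ≢ suc (toℕ j) → kostantWeierstrass a i j ≈ 0#
    elsewhere i j i≢0 j≢n ne
      rewrite ≡ᵇ-false (toℕ i) 0 i≢0 | ≡ᵇ-false (suc (toℕ j)) n j≢n | ≡ᵇ-false (toℕ i) (suc (toℕ j)) ne = refl

    column : ∀ j j′ → toℕ j′ ≡ suc (toℕ j) → ∀ l → K l j ≈ a j * 1ᴹ l first + 1ᴹ l j′
    column j j′ j′≡j+1 l = trans (K≋ l j) (decide (toℕ l ℕ.≟ 0) (toℕ l ℕ.≟ suc (toℕ j)))
      where
      j≢n : suc (toℕ j) ≢ n
      j≢n e = ℕ.<-irrefl (≡.trans j′≡j+1 e) (Fin.toℕ<n j′)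
      decide : Dec (toℕ l ≡ 0) → Dec (toℕ l ≡ suc (toℕ j)) → kostantWeierstrass a l j
          ≈ a j * 1ᴹ l first + 1ᴹ l j′
      decide (yes l≡0) _ = trans (first-row l j l≡0) (sym (trans (+-cong
        (*-congˡ (trans (reflexive (≡.cong (λ l → 1ᴹ l first) (is-first l≡0))) (1ᴹ-diagonal first)))
        (1ᴹ-off-diagonal λ l≡j′ → ℕ.0≢1+n (≡.trans (≡.sym l≡0) (≡.trans (≡.cong toℕ l≡j′) j′≡j+1))))
        (solve 1 (λ x → x :* :1 :+ :0 := x) refl (a j))))
      decide (no l≢0) (yes l≡j+1) = trans (subdiagonal l j l≢0 j≢n l≡j+1) (sym (trans (+-cong
        (*-congˡ (1ᴹ-off-diagonal λ l≡first → l≢0 (≡.trans (≡.cong toℕ l≡first) first≡0)))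
        (trans (reflexive (≡.cong (λ l → 1ᴹ l j′) (Fin.toℕ-injective (≡.trans l≡j+1 (≡.sym j′≡j+1)))))
            (1ᴹ-diagonal j′)))
        (solve 1 (λ x → x :* :0 :+ :1 := :1) refl (a j))))
      decide (no l≢0) (no l≢j+1) = trans (elsewhere l j l≢0 j≢n l≢j+1) (sym (trans (+-cong
        (*-congˡ (1ᴹ-off-diagonal λ l≡first → l≢0 (≡.trans (≡.cong toℕ l≡first) first≡0)))
        (1ᴹ-off-diagonal λ l≡j′ → l≢j+1 (≡.trans (≡.cong toℕ l≡j′) j′≡j+1)))
        (solve 1 (λ x → x :* :0 :+ :0 := :0) refl (a j))))

    -- Column j, not being the last, has only the entries `a j` on top and 1 below the diagonal. The
    -- eigenvector equation at j therefore yields the next entry.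
    eigenvector-step : ∀ ρ w → LeftEigenvector K ρ w → ∀ j j′ → toℕ j′ ≡ suc (toℕ j) →
      w j′ ≈ ρ * w j - a j * w first
    eigenvector-step ρ w e j j′ j′≡j+1 = begin
      w j′
        ≈⟨ solve 2 (λ x y → x := (y :+ x) :- y) refl (w j′) (a j * w first) ⟩
      (a j * w first + w j′) - a j * w first ≈⟨ +-congʳ (sym column-sum) ⟩
      sum (λ l → w l * K l j) - a j * w first ≈⟨ +-congʳ (e j) ⟩
      ρ * w j - a j * w first               ∎
      where
      column-sum : sum (λ l → w l * K l j) ≈ a j * w first + w j′
      column-sum = begin
        sum (λ l → w l * K l j)
          ≈⟨ ∑-cong n (λ l → trans (*-congˡ (column j j′ j′≡j+1 l))
               (solve 4 (λ w a x y → w :* (a :* x :+ y) := (a :* w) :* x :+ w :* y) refl (w l) (a j)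
                   (1ᴹ l first) (1ᴹ l j′))) ⟩
        sum (λ l → a j * w l * 1ᴹ l first + w l * 1ᴹ l j′)
          ≈⟨ ∑-distrib-+ (λ l → a j * w l * 1ᴹ l first) (λ l → w l * 1ᴹ l j′) ⟩
        sum (λ l → a j * w l * 1ᴹ l first) + sum (λ l → w l * 1ᴹ l j′)
          ≈⟨ +-cong (∑-1ᴹʳ (λ l → a j * w l) first) (∑-1ᴹʳ w j′) ⟩
        a j * w first + w j′ ∎

  -- Both rows obey the same linear recursion from their first entries. The proportion is
  -- cross-multiplied because a first entry is not known to be invertible.
  eigenvectors-proportional : ∀ ρ w w′ → LeftEigenvector K ρ w → LeftEigenvector K ρ w′ →
    ∀ j → w′ first * w j ≈ w first * w′ j
  eigenvectors-proportional ρ w w′ e e′ j = at (toℕ j) j ≡.refl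
    where
    at : ∀ N j → toℕ j ≡ N → w′ first * w j ≈ w first * w′ j
    at zero    j j≡0 = trans (reflexive (≡.cong (λ j → w′ first * w j) (is-first j≡0)))
      (trans (*-comm _ _) (reflexive (≡.cong (λ j → w first * w′ j) (≡.sym (is-first j≡0)))))
    at (suc N) j j≡N+1 = begin
      w′ first * w j
        ≈⟨ *-congˡ (eigenvector-step ρ w e i j j≡i+1) ⟩
      w′ first * (ρ * w i - a i * w first)
        ≈⟨ solve 5 (λ x ρ y a z → x :* (ρ :* y :- a :* z) := ρ :* (x :* y) :- a :* (x :* z)) refl
            (w′ first) ρ (w i) (a i) (w first) ⟩
      ρ * (w′ first * w i) - a i * (w′ first * w first)
        ≈⟨ +-congʳ (*-congˡ (at N i toℕ-i)) ⟩
      ρ * (w first * w′ i) - a i * (w′ first * w first)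
        ≈⟨ solve 5 (λ x ρ y a z → ρ :* (x :* y) :- a :* (z :* x) := x :* (ρ :* y :- a :* z)) refl
            (w first) ρ (w′ i) (a i) (w′ first) ⟩
      w first * (ρ * w′ i - a i * w′ first)
        ≈⟨ *-congˡ (sym (eigenvector-step ρ w′ e′ i j j≡i+1)) ⟩
      w first * w′ j ∎
      where
      N<n : N < n
      N<n = ℕ.<-trans (ℕ.n<1+n N) (≡.subst (_< n) j≡N+1 (Fin.toℕ<n j))
      i : Fin n
      i = fromℕ< N<n
      toℕ-i : toℕ i ≡ N
      toℕ-i = Fin.toℕ-fromℕ< N<n
      j≡i+1 : toℕ j ≡ suc (toℕ i)
      j≡i+1 = ≡.trans j≡N+1 (≡.cong suc (≡.sym toℕ-i))

  private
    evalᴹ-0 : ∀ f (A : Matrix n) → f ≈ₚ [] → ∀ i j → evalᴹ f A i j ≈ 0#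
    evalᴹ-0 []      A f≈0 i j = refl
    evalᴹ-0 (b ∷ f) A f≈0 i j = trans (+-cong (trans (*-congʳ (coeff≈ f≈0 0)) (zeroˡ _))
      (sum-ε +-commutativeMonoid (λ l → A i l * evalᴹ f A l j) λ l →
        trans (*-congˡ (evalᴹ-0 f A (mk≈ₚ (coeff≈ f≈0 ∘ suc)) l j)) (zeroʳ _))) (+-identityʳ 0#)

    -- Below its first row, K has a 1 just left of the diagonal and otherwise only entries in the
    -- last column; these meet the final 0 of x.
    shift : ∀ (x : Vector Carrier n) i i′ → toℕ i ≡ suc (toℕ i′) → (∀ l → suc (toℕ l) ≡ n → x l ≈ 0#) →
      sum (λ l → K i l * x l) ≈ x i′
    shift x i i′ i≡i′+1 last≈0 = trans (sum-single +-commutativeMonoid (λ l → K i l * x l) i′ other)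
        (trans (*-congʳ (trans (K≋ i i′) (subdiagonal i i′ i≢0 i′≢n i≡i′+1))) (*-identityˡ _))
      where
      i≢0 : toℕ i ≢ 0
      i≢0 e = ℕ.0≢1+n (≡.trans (≡.sym e) i≡i′+1)
      i′≢n : suc (toℕ i′) ≢ n
      i′≢n e = ℕ.<-irrefl (≡.trans i≡i′+1 e) (Fin.toℕ<n i)
      other : ∀ l → l ≢ i′ → K i l * x l ≈ 0#
      other l l≢i′ = decide (suc (toℕ l) ℕ.≟ n)
        where
        decide : Dec (suc (toℕ l) ≡ n) → K i l * x l ≈ 0#
        decide (yes last) = trans (*-congˡ (last≈0 l last)) (zeroʳ _)
        decide (no ¬last) = trans (*-congʳ (trans (K≋ i l) (elsewhere i l i≢0 ¬last
          λ e → l≢i′ (Fin.toℕ-injective (ℕ.suc-injective (≡.trans (≡.sym e) i≡i′+1)))))) (zeroˡ _)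

  -- Starting from e₁, each factor K moves the lowest nonzero entry down by one until the end is
  -- reached. The first row of K disturbs the entries above, so nothing is claimed about indices
  -- less than N.
  krylov : ∀ N f → N < n → Below (suc N) f → ∀ i → N ≤ toℕ i → evalᴹ f K i first ≈ coeff f (toℕ i)
  krylov N       []      N<n f≤N i N≤i = refl
  krylov zero    (b ∷ f) N<n f≤N i N≤i = trans
      (+-congˡ (sum-ε +-commutativeMonoid (λ l → K i l * evalᴹ f K l first) λ l → trans
          (*-congˡ (evalᴹ-0 f K f≈0 l first)) (zeroʳ _)))
      (trans (+-identityʳ _) (decide (toℕ i) ≡.refl))
    where
    f≈0 : f ≈ₚ []
    f≈0 = mk≈ₚ λ e → f≤N (suc e) (s≤s z≤n)
    decide : ∀ e → toℕ i ≡ e → b * 1ᴹ i first ≈ coeff (b ∷ f) e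
    decide zero    e = trans (*-congˡ
        (trans (reflexive (≡.cong (λ i → 1ᴹ i first) (is-first e))) (1ᴹ-diagonal first))) (*-identityʳ b)
    decide (suc m) e = trans (trans (*-congˡ (1ᴹ-off-diagonal λ i≡first →
      ℕ.0≢1+n (≡.trans (≡.sym first≡0) (≡.trans (≡.cong toℕ (≡.sym i≡first)) e)))) (zeroʳ b))
          (sym (coeff≈ f≈0 m))
  krylov (suc N) (b ∷ f) N+1<n f≤N i N+1≤i = decide (toℕ i) ≡.refl
    where
    N<n : N < n
    N<n = ℕ.<-trans (ℕ.n<1+n N) N+1<n
    f≤ : Below (suc N) f
    f≤ e N<e = f≤N (suc e) (s≤s N<e)
    decide : ∀ e → toℕ i ≡ e → b * 1ᴹ i first + sum (λ l → K i l * evalᴹ f K l first) ≈ coeff (b ∷ f) e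
    decide zero    i≡0   = ⊥-elim (ℕ.n≮0 (≡.subst (suc N ≤_) i≡0 N+1≤i))
    decide (suc m) i≡m+1 = begin
      b * 1ᴹ i first + sum (λ l → K i l * evalᴹ f K l first)
        ≈⟨ +-cong (trans (*-congˡ (1ᴹ-off-diagonal λ i≡first →
             ℕ.0≢1+n (≡.trans (≡.sym first≡0) (≡.trans (≡.cong toℕ (≡.sym i≡first)) i≡m+1)))) (zeroʳ b))
           (shift (λ l → evalᴹ f K l first) i i′ i≡i′+1 last≈0) ⟩
      0# + evalᴹ f K i′ first
        ≈⟨ trans (+-identityˡ _) (krylov N f N<n f≤ i′ (≡.subst (N ≤_) (≡.sym toℕ-i′) N≤m)) ⟩
      coeff f (toℕ i′)
        ≡⟨ ≡.cong (coeff f) toℕ-i′ ⟩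
      coeff f m ∎
      where
      N≤m : N ≤ m
      N≤m = ℕ.≤-pred (≡.subst (suc N ≤_) i≡m+1 N+1≤i)
      m<n : m < n
      m<n = ℕ.<-trans (ℕ.n<1+n m) (≡.subst (_< n) i≡m+1 (Fin.toℕ<n i))
      i′ : Fin n
      i′ = fromℕ< m<n
      toℕ-i′ : toℕ i′ ≡ m
      toℕ-i′ = Fin.toℕ-fromℕ< m<n
      i≡i′+1 : toℕ i ≡ suc (toℕ i′)
      i≡i′+1 = ≡.trans i≡m+1 (≡.cong suc (≡.sym toℕ-i′))
      -- As N + 1 < n, the last index exceeds the degree bound N of f, and the induction hypothesis
      -- gives 0 there.
      last≈0 : ∀ l → suc (toℕ l) ≡ n → evalᴹ f K l first ≈ 0#
      last≈0 l l+1≡n = trans (krylov N f N<n f≤ l (ℕ.<⇒≤ N<l)) (f≤ (toℕ l) N<l)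
        where
        N<l : N < toℕ l
        N<l = ℕ.≤-pred (≡.subst (suc (suc N) ≤_) (≡.sym l+1≡n) N+1<n)

module _ {c ℓ c′ ℓ′} (R : CommutativeRing c ℓ) (S : CommutativeRing c′ ℓ′)
  (h : CommutativeRing.Carrier R → CommutativeRing.Carrier S)
  (isRingHomomorphism : RingMorphisms.IsRingHomomorphism
    (CommutativeRing.rawRing R) (CommutativeRing.rawRing S) h)
  where
  open CommutativeRing S
  open Homomorphism R S h isRingHomomorphism using (1#-homo; 0#-homo)

  kostantWeierstrass-homo : ∀ {n} (a : Vector (CommutativeRing.Carrier R) n) i j →
    h (Matrices.kostantWeierstrass R a i j) ≈ Matrices.kostantWeierstrass S (h ∘ a) i j
  kostantWeierstrass-homo {n} a i j with toℕ i ℕ.≡ᵇ 0 | suc (toℕ j) ℕ.≡ᵇ n | toℕ i ℕ.≡ᵇ suc (toℕ j)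
  ... | true  | _     | _     = refl
  ... | false | true  | _     = refl
  ... | false | false | true  = 1#-homo
  ... | false | false | false = 0#-homo

-- The relative position

module Roots {c ℓ c′ ℓ′} (k : Field c ℓ) (q : ℕ) (size : HasSize k q)
  (2≉0 : ¬ Field._≈_ k (Field._+_ k (Field.1# k) (Field.1# k)) (Field.0# k))
  (k̄ : AlgebraicClosure k c′ ℓ′) where
  private
    module k where
      open Field k public
      open PolynomialProperties commutativeRing public
  open AlgebraicClosure k̄ hiding (zero)
  open Frobenius k q size k̄
  open Conjugates k q size k̄ using (module MinimalPolynomial)
  open QuadraticSymbol k q size 2≉0 k̄
  open QuadraticCharacter k q k̄ using (legendre)
  open RawSemiringDefs (Semiring.rawSemiring semiring) using (product; sum; _^_)
  open PolynomialProperties commutativeRing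
  open FieldProperties field̄
  open Exp commutativeSemiring using (^-congˡ; ^-distrib-*)
  open SetoidReasoning setoid

  -- The roots of p, sorted by irreducible factor

  module Factorization
    {n : ℕ} (p : k.Poly) (r : Vector Carrier n)
    (p-splits : ι[ p ] ≈ₚ productₚ λ i → T +ₚ (-ₚ const (r i)))
    (r-distinct : Distinct r)
    {m : ℕ} (P : Vector k.Poly m) (d : Fin m → ℕ)
    (P-monic : ∀ i → k.MonicOfDegree (d i) (P i))
    (P-irreducible : ∀ i → RawSemiringDefs.Irreducible (Semiring.rawSemiring k.Poly.semiring) (P i))
    (p-factors : p k.≈ₚ k.productₚ P)
    (δ : Vector Carrier m)
    (δ-root : ∀ i → eval ι[ P i ] (δ i) ≈ 0#)
    where
    p̄ : Poly
    p̄ = ι[ p ]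

    P̄ : Fin m → Poly
    P̄ i = ι[ P i ]

    p̄-monic : MonicOfDegree n p̄
    p̄-monic = Monic-cong {n} (Poly.sym p-splits) (Monic-productₚ r)

    p̄-r : ∀ l → eval p̄ (r l) ≈ 0#
    p̄-r l = trans (eval-congˡ _ _ (r l) p-splits)
        (trans (eval-productₚ r (r l)) (zero-product _ l (-‿inverseʳ (r l))))

    eval-p̄ : ∀ x → eval p̄ x ≈ product λ i → eval (P̄ i) x
    eval-p̄ x = trans (eval-congˡ _ _ x (Poly.trans (ι.map-cong p-factors) (ι.map-product P)))
        (eval-product P̄ x)

    p̄-root-is-r : ∀ x → eval p̄ x ≈ 0# → ∃[ l ] r l ≈ x
    p̄-root-is-r x p̄x≈0 = find (product-zero (λ l → x - r l)
        (trans (sym (trans (eval-congˡ _ _ x p-splits) (eval-productₚ r x))) p̄x≈0))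
      where
      find : ∃[ l ] x - r l ≈ 0# → ∃[ l ] r l ≈ x
      find (l , e) = l , sym (x-y≈0⇒x≈y x (r l) e)

    P̄-root : ∀ i x → eval (P̄ i) x ≈ 0# → eval p̄ x ≈ 0#
    P̄-root i x e = trans (eval-p̄ x) (zero-product _ i e)

    P̄-root-is-r : ∀ i x → eval (P̄ i) x ≈ 0# → ∃[ l ] r l ≈ x
    P̄-root-is-r i x e = p̄-root-is-r x (P̄-root i x e)

    module M (i : Fin m) = MinimalPolynomial (P i) (d i) (P-monic i) (P-irreducible i) (δ i)
        (δ-root i) n r (P̄-root-is-r i)

    ρ : (i : Fin m) → Fin (d i) → Carrier
    ρ i t = M.conjugate i t

    P̄-ρ : ∀ i t → eval (P̄ i) (ρ i t) ≈ 0#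
    P̄-ρ i t = M.root-conjugate i (P i) (δ-root i) t

    p̄-ρ : ∀ i t → eval p̄ (ρ i t) ≈ 0#
    p̄-ρ i t = P̄-root i (ρ i t) (P̄-ρ i t)

    ρ-of-root : ∀ x → eval p̄ x ≈ 0# → ∃[ i ] ∃[ t ] ρ i t ≈ x
    ρ-of-root x p̄x≈0 = find (product-zero (λ i → eval (P̄ i) x) (trans (sym (eval-p̄ x)) p̄x≈0))
      where
      find : ∃[ i ] eval (P̄ i) x ≈ 0# → ∃[ i ] ∃[ t ] ρ i t ≈ x
      find (i , e) = i , M.P-root i x e

    p̄′ : Carrier → Carrier
    p̄′ x = eval ι[ k.derivative p ] x

    p̄′-derivative : ∀ x → p̄′ x ≈ eval (derivative p̄) x
    p̄′-derivative x = eval-congˡ _ _ x (ι.derivative-map p)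

    p̄′-nonzero : ∀ x → eval p̄ x ≈ 0# → ¬ p̄′ x ≈ 0#
    p̄′-nonzero x p̄x≈0 p̄′x≈0 = at (p̄-root-is-r x p̄x≈0)
      where
      at : ¬ (∃[ l ] r l ≈ x)
      at (l , e) = derivative-nonzero r r-distinct l (begin
        eval (derivative (productₚ λ i → T +ₚ (-ₚ const (r i)))) (r l)
          ≈⟨ sym (derivative-cong p̄ _ (r l) p-splits) ⟩
        eval (derivative p̄) (r l)   ≈⟨ eval-congʳ (derivative p̄) e ⟩
        eval (derivative p̄) x       ≈⟨ sym (p̄′-derivative x) ⟩
        p̄′ x                         ≈⟨ p̄′x≈0 ⟩
        0#                          ∎)

    p̄′-factors : ∀ i x → eval (P̄ i) x ≈ 0# →
      p̄′ x ≈ eval ι[ k.derivative (P i) ] x * product (except i λ j → eval (P̄ j) x)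
    p̄′-factors i x e = begin
      p̄′ x                                         ≈⟨ p̄′-derivative x ⟩
      eval (derivative p̄) x
        ≈⟨ derivative-cong p̄ (productₚ P̄) x (Poly.trans (ι.map-cong p-factors) (ι.map-product P)) ⟩
      eval (derivative (productₚ P̄)) x            ≈⟨ derivative-product P̄ i x e ⟩
      eval (derivative (P̄ i)) x * product (except i λ j → eval (P̄ j) x)
        ≈⟨ *-congʳ (sym (eval-congˡ _ _ x (ι.derivative-map (P i)))) ⟩
      eval ι[ k.derivative (P i) ] x * product (except i λ j → eval (P̄ j) x) ∎

    -- Every root of p is simple, whereas at a common root the product formula for p′ would contain
    -- the vanishing factor P_j.
    P̄-disjoint : ∀ i j x → eval (P̄ i) x ≈ 0# → eval (P̄ j) x ≈ 0# → i ≡ j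
    P̄-disjoint i j x ei ej = decide (j Fin.≟ i)
        (λ j≢i → p̄′-nonzero x (P̄-root i x ei) (trans (p̄′-factors i x ei)
        (trans (*-congˡ (zero-product (except i λ j → eval (P̄ j) x) j (vanish j≢i))) (zeroʳ _))))
      where
      decide : Dec (j ≡ i) → ¬ (j ≢ i) → i ≡ j
      decide (yes j≡i) _  = ≡.sym j≡i
      decide (no j≢i)  ¬¬ = ⊥-elim (¬¬ j≢i)
      vanish : j ≢ i → except i (λ j → eval (P̄ j) x) j ≈ 0#
      vanish j≢i with j Fin.≟ i
      ... | yes j≡i = ⊥-elim (j≢i j≡i)
      ... | no  _   = ej

    ρ-disjoint : ∀ i j t s → ρ i t ≈ ρ j s → i ≡ j
    ρ-disjoint i j t s e = P̄-disjoint i j (ρ i t) (P̄-ρ i t) (trans (eval-congʳ (P̄ j) e) (P̄-ρ j s))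

    ρ-injective : ∀ i j t s → ρ i t ≈ ρ j s → _≡_ {A = ∃[ i ] Fin (d i)} (i , t) (j , s)
    ρ-injective i j t s e = same i j t s (ρ-disjoint i j t s e) e
      where
      same : ∀ i j t s → i ≡ j → ρ i t ≈ ρ j s → _≡_ {A = ∃[ i ] Fin (d i)} (i , t) (j , s)
      same i i t s ≡.refl e = ≡.cong (i ,_) (M.conjugate-distinct i t s e)

    sum-over-ρ : (f : (i : Fin m) → Fin (d i) → Carrier) → ∀ j s →
      (∀ i t → ¬ ρ i t ≈ ρ j s → f i t ≈ 0#) → sum (λ i → sum (f i)) ≈ f j s
    sum-over-ρ f j s zero-elsewhere = trans
      (sum-single +-commutativeMonoid (λ i → sum (f i)) j λ i i≢j →
        sum-ε +-commutativeMonoid (f i) λ t → zero-elsewhere i t λ e → i≢j (ρ-disjoint i j t s e))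
      (sum-single +-commutativeMonoid (f j) s λ t t≢s → zero-elsewhere j t λ e → t≢s
          (M.conjugate-distinct j t s e))

    -- The quadratic symbols of the class (η_i p′)

    module _ (η : Fin m → k.Poly) (η-nonzero : ∀ i → ¬ eval ι[ η i ] (δ i) ≈ 0#) where
      open Factors k q k̄ P d δ using (atδ; positionSign)

      relativeClass : Fin m → k.Poly
      relativeClass i = η i k.*ₚ k.derivative p

      eval-relativeClass : ∀ i x → eval ι[ relativeClass i ] x ≈ eval ι[ η i ] x * p̄′ x
      eval-relativeClass i x = trans (eval-congˡ _ _ x (ι.map-* (η i) (k.derivative p))) (eval-* ι[ η i ] _ x)

      private
        η̄ : Fin m → Carrier
        η̄ i = eval ι[ η i ] (δ i)

        p̄-δ : ∀ i → eval p̄ (δ i) ≈ 0#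
        p̄-δ i = P̄-root i (δ i) (δ-root i)

        rational-fixed : ∀ i f → frobenius (d i) (eval ι[ f ] (δ i)) ≈ eval ι[ f ] (δ i)
        rational-fixed i f = trans (frobenius-eval (d i) f (δ i)) (eval-congʳ ι[ f ] (M.d-period i))

      relativeClass-nonzero : ∀ i → ¬ eval ι[ relativeClass i ] (δ i) ≈ 0#
      relativeClass-nonzero i e = *-nonzero (η-nonzero i) (p̄′-nonzero (δ i) (p̄-δ i))
          (trans (sym (eval-relativeClass i (δ i))) e)

      private
        A B X : Fin m → Carrier
        A i = eval ι[ k.derivative (P i) ] (δ i) ^ H (d i)
        B i = η̄ i ^ H (d i)
        X i = product (except i λ j → eval (P̄ j) (δ i)) ^ H (d i)

        class-half : ∀ i → ε (legendre (d i) (atδ i (relativeClass i))) ≈ B i * (A i * X i)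
        class-half i = begin
          ε (legendre (d i) (atδ i (relativeClass i)))
            ≈⟨ euler (d i) _ (relativeClass-nonzero i) (rational-fixed i (relativeClass i)) ⟩
          eval ι[ relativeClass i ] (δ i) ^ H (d i)
            ≈⟨ ^-congˡ (H (d i)) (trans (eval-relativeClass i (δ i))
                (*-congˡ (p̄′-factors i (δ i) (δ-root i)))) ⟩
          (η̄ i * (eval ι[ k.derivative (P i) ] (δ i) * product (except i λ j → eval (P̄ j) (δ i)))) ^ H (d i)
            ≈⟨ trans (^-distrib-* _ _ (H (d i))) (*-congˡ (^-distrib-* _ _ (H (d i)))) ⟩
          B i * (A i * X i) ∎

        ε-power : ∀ e → ε (RawMonoidDefs._×_ Sign.*-1-rawMonoid e Sign.-) ≈ (- 1#) ^ e
        ε-power zero    = refl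
        ε-power (suc e) = trans (ε-* Sign.- (RawMonoidDefs._×_ Sign.*-1-rawMonoid e Sign.-))
            (*-congˡ (ε-power e))

        ε-product : ∀ {m} (s : Vector Sign m) → ε (RawMonoidDefs.sum Sign.*-1-rawMonoid s) ≈ product (ε ∘ s)
        ε-product = sum-homo {A = Sign.*-1-rawMonoid} *-commutativeMonoid ε refl ε-*

        ±1 : ∀ e → ¬ (- 1#) ^ e ≈ 0#
        ±1 e = ^-nonzero e λ -1≈0 → 1≉0 (trans (sym -1*-1) (trans (*-congˡ -1≈0) (zeroʳ _)))

        H1 : H 1 ≡ h₁
        H1 = ≡.trans (≡.cong (h₁ ℕ.+_) (ℕ.*-zeroʳ q)) (ℕ.+-identityʳ h₁)

        ε-sign : ∀ i → ε (legendre 1 (sign (d i))) ≈ sign (d i) ^ h₁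
        ε-sign i = trans (euler 1 (sign (d i)) (±1 ℕ.⌊ d i /2⌋)
            (trans (frobenius.^-homomorphic 1 (- 1#) ℕ.⌊ d i /2⌋)
          (^-congˡ ℕ.⌊ d i /2⌋ (trans (frobenius.-‿homo 1 1#) (-‿cong (frobenius.1#-homo 1))))))
              (^-≡ (sign (d i)) H1)

        lcm-fixedˡ : ∀ d e x → frobenius d x ≈ x → frobenius (lcm d e) x ≈ x
        lcm-fixedˡ d e x fixed = trans (reflexive
            (≡.cong (λ t → frobenius t x) (_∣_.equality (m∣lcm[m,n] d e))))
          (frobenius-multiple d x fixed (_∣_.quotient (m∣lcm[m,n] d e)))

        lcm-fixedʳ : ∀ d e x → frobenius e x ≈ x → frobenius (lcm d e) x ≈ x
        lcm-fixedʳ d e x fixed = trans (reflexive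
            (≡.cong (λ t → frobenius t x) (_∣_.equality (n∣lcm[m,n] d e))))
          (frobenius-multiple e x fixed (_∣_.quotient (n∣lcm[m,n] d e)))

        -- Euler's criterion in degree [d_i, d_j] asks that the differences be nonzero, which holds
        -- since P_i and P_j share no root, and that they lie in that field, which contains δ_i and
        -- the conjugates of δ_j.
        factor-half : ∀ i j → j ≢ i → ε (RawMonoidDefs.sum Sign.*-1-rawMonoid λ (t : Fin (gcd (d i) (d j))) →
            legendre (lcm (d i) (d j)) (δ i - δ j ^ (q ℕ.^ toℕ t))) ≈ eval (P̄ j) (δ i) ^ H (d i)
        factor-half i j j≢i = begin
          ε (RawMonoidDefs.sum Sign.*-1-rawMonoid λ (t : Fin G) → legendre L (δ i - frobenius (toℕ t) (δ j)))
            ≈⟨ ε-product {G} (λ t → legendre L (δ i - frobenius (toℕ t) (δ j))) ⟩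
          product {G} (λ t → ε (legendre L (δ i - frobenius (toℕ t) (δ j))))
            ≈⟨ product-cong G (λ t → euler L _ (nonzero t) (fixed t)) ⟩
          product {G} (λ t → (δ i - frobenius (toℕ t) (δ j)) ^ H L)
            ≈⟨ sym (norm-half (P j) (d j) (P-monic j) (P-irreducible j) (δ j) (δ-root j) n r
                (P̄-root-is-r j) (d i) (δ i) (M.d-period i)) ⟩
          eval (P̄ j) (δ i) ^ H (d i) ∎
          where
          G = gcd (d i) (d j)
          L = lcm (d i) (d j)
          P̄-frobenius : ∀ t → eval (P̄ j) (frobenius t (δ j)) ≈ 0#
          P̄-frobenius t = trans (sym (frobenius-eval t (P j) (δ j)))
              (trans (frobenius-cong t (δ-root j)) (frobenius.0#-homo t))
          nonzero : ∀ (t : Fin G) → ¬ δ i - frobenius (toℕ t) (δ j) ≈ 0#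
          nonzero t e = j≢i (P̄-disjoint j i (δ i)
              (trans (eval-congʳ (P̄ j) (x-y≈0⇒x≈y _ _ e)) (P̄-frobenius (toℕ t))) (δ-root i))
          fixed : ∀ (t : Fin G) → frobenius L (δ i - frobenius (toℕ t) (δ j)) ≈ δ i - frobenius (toℕ t) (δ j)
          fixed t = trans (frobenius.difference-homo L _ _)
              (+-cong (lcm-fixedˡ (d i) (d j) (δ i) (M.d-period i))
            (-‿cong (lcm-fixedʳ (d i) (d j) _ (begin
              frobenius (d j) (frobenius (toℕ t) (δ j))   ≈⟨ frobenius-+ (d j) (toℕ t) (δ j) ⟩
              frobenius (toℕ t ℕ.+ d j) (δ j)
                ≡⟨ ≡.cong (λ e → frobenius e (δ j)) (ℕ.+-comm (toℕ t) (d j)) ⟩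
              frobenius (d j ℕ.+ toℕ t) (δ j)             ≈⟨ sym (frobenius-+ (toℕ t) (d j) (δ j)) ⟩
              frobenius (toℕ t) (frobenius (d j) (δ j))   ≈⟨ frobenius-cong (toℕ t) (M.d-period j) ⟩
              frobenius (toℕ t) (δ j)                     ∎))))

        factors-half : ∀ i (s : Vector Sign m) → (∀ j → j ≢ i → ε (s j) ≈ eval (P̄ j) (δ i) ^ H (d i)) →
          ε (RawMonoidDefs.sum Sign.*-1-rawMonoid λ j → if does (j Fin.≟ i) then Sign.+ else s j) ≈ X i
        factors-half i s e = begin
          ε (RawMonoidDefs.sum Sign.*-1-rawMonoid λ j → if does (j Fin.≟ i) then Sign.+ else s j)
            ≈⟨ ε-product {m} (λ j → if does (j Fin.≟ i) then Sign.+ else s j) ⟩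
          product {m} (λ j → ε (if does (j Fin.≟ i) then Sign.+ else s j))
            ≈⟨ product-cong m entry ⟩
          product {m} (λ j → except i (λ j → eval (P̄ j) (δ i)) j ^ H (d i))
            ≈⟨ sym (product-^ {m} (except i λ j → eval (P̄ j) (δ i)) (H (d i))) ⟩
          X i ∎
          where
          entry : ∀ j → ε (if does (j Fin.≟ i) then Sign.+ else s j)
              ≈ except i (λ j → eval (P̄ j) (δ i)) j ^ H (d i)
          entry j with j Fin.≟ i
          ... | yes _   = sym (1^ (H (d i)))
          ... | no j≢i = e j j≢i

      -- Through `ε` the equality of signs becomes one of powers in k̄, where the factors of η_i p′
      -- separate. The derivative of P_i accounts for the first two factors of `positionSign`, the
      -- other P_j for the last.
      class-sign : ∀ i → legendre (d i) (atδ i (relativeClass i)) ≡ positionSign η i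
      class-sign i = ε-injective _ _ (begin
        ε (legendre (d i) (atδ i (relativeClass i)))
          ≈⟨ class-half i ⟩
        B i * (A i * X i)
          ≈⟨ *-congˡ (*-congʳ (derivative-half (P i) (d i) (P-monic i) (P-irreducible i) (δ i)
              (δ-root i) n r (P̄-root-is-r i))) ⟩
        B i * ((- 1#) ^ (d i ℕ.∸ 1) * sign (d i) ^ h₁ * X i)
          ≈⟨ solve 4 (λ b s t x → b :* (s :* t :* x) := s :* t :* b :* x) refl (B i)
              ((- 1#) ^ (d i ℕ.∸ 1)) (sign (d i) ^ h₁) (X i) ⟩
        (- 1#) ^ (d i ℕ.∸ 1) * sign (d i) ^ h₁ * B i * X i
          ≈⟨ sym (trans (ε-* (s₁ Sign.* s₂ Sign.* s₃) s₄) (*-cong (trans (ε-* (s₁ Sign.* s₂) s₃)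
               (*-cong (trans (ε-* s₁ s₂) (*-cong (ε-power (d i ℕ.∸ 1)) (ε-sign i)))
                 (euler (d i) (η̄ i) (η-nonzero i) (rational-fixed i (η i)))))
               (factors-half i factor (factor-half i)))) ⟩
        ε (s₁ Sign.* s₂ Sign.* s₃ Sign.* s₄) ∎)
        where
        open Solver commutativeRing
        s₁ s₂ s₃ s₄ : Sign
        factor : Fin m → Sign
        s₁ = RawMonoidDefs._×_ Sign.*-1-rawMonoid (d i ℕ.∸ 1) Sign.-
        s₂ = legendre 1 (sign (d i))
        s₃ = legendre (d i) (atδ i (η i))
        factor j = RawMonoidDefs.sum Sign.*-1-rawMonoid λ (t : Fin (gcd (d i) (d j))) →
          legendre (lcm (d i) (d j)) (δ i - δ j ^ (q ℕ.^ toℕ t))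
        s₄ = RawMonoidDefs.sum Sign.*-1-rawMonoid λ j → if does (j Fin.≟ i) then Sign.+ else factor j

firstIndex : ∀ {n} → Fin n → ∃[ i ] toℕ {n} i ≡ 0
firstIndex {suc n} _ = zero , ≡.refl

-- The cocycle of g and its Kummer class

module Position {c ℓ c′ ℓ′} (k : Field c ℓ) (q : ℕ) (size : HasSize k q)
  (2≉0 : ¬ Field._≈_ k (Field._+_ k (Field.1# k) (Field.1# k)) (Field.0# k))
  (k̄ : AlgebraicClosure k c′ ℓ′) where
  private
    module k where
      open Field k public
      open PolynomialProperties commutativeRing public
      open Matrices commutativeRing public
      open MatrixProperties commutativeRing public
      open RawSemiringDefs (Semiring.rawSemiring semiring) public using (sum)
  open AlgebraicClosure k̄ hiding (zero)
  open Frobenius k q size k̄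
  open RawSemiringDefs (Semiring.rawSemiring semiring) using (sum; _^_)
  open PolynomialProperties commutativeRing
  open FieldProperties field̄
  open Matrices commutativeRing
  open MatrixProperties commutativeRing
  open Galois k k̄
  open QuadraticSymbol k q size 2≉0 k̄ using (1≉-1; -1*-1; square-one)
  open SemiringSum semiring using (∑-comm; *-distribˡ-sum; *-distribʳ-sum)
  open Solver commutativeRing
  open Roots k q size 2≉0 k̄ using (module Factorization)
  open SetoidReasoning setoid

  module Conjugation
    {n : ℕ} (Λ : k.Matrix n) (p : k.Poly) (r : Vector Carrier n)
    (p-splits : ι[ p ] ≈ₚ productₚ λ i → T +ₚ (-ₚ const (r i)))
    (r-distinct : Distinct r)
    {m : ℕ} (P : Vector k.Poly m) (d : Fin m → ℕ)
    (P-monic : ∀ i → k.MonicOfDegree (d i) (P i))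
    (P-irreducible : ∀ i → RawSemiringDefs.Irreducible (Semiring.rawSemiring k.Poly.semiring) (P i))
    (p-factors : p k.≈ₚ k.productₚ P)
    (δ : Vector Carrier m)
    (δ-root : ∀ i → eval ι[ P i ] (δ i) ≈ 0#)
    (Φ : Vector k.Carrier n → Fin m → k.Poly)
    (Φ-isomorphism : LeftModuleMorphisms.IsLeftModuleIsomorphism
      (Factors.operatorModule k q k̄ P d δ Λ) (Factors.⊕kᵢ k q k̄ P d δ) Φ)
    (η : Vector k.Poly m) (η-unit : ∀ i → IsUnit (Factors.kᵢ k q k̄ P d δ i) (η i))
    (form : ∀ x y → k.⟨ x , y ⟩ k.≈ k.sum λ i → k.Tr (d i) (P i) (η i k.*ₚ Φ x i k.*ₚ Φ y i))
    (a : Vector k.Carrier n) (g : SO n)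
    (conjugation : (λ i j → ι (Λ i j)) ≋ SO.mat g *ᴹ (λ i j → ι (k.kostantWeierstrass a i j)) *ᴹ SO.inv g)
    where
    open SO g
    open Factors k q k̄ P d δ
    open Cohomology k k̄ p
    open Factorization p r p-splits r-distinct P d P-monic P-irreducible p-factors δ δ-root

    private
      module Φ = LeftModuleMorphisms.IsLeftModuleIsomorphism Φ-isomorphism
      module L̄ = CommutativeRing L̄
      module ιᴹ = MatrixHomomorphism k.commutativeRing commutativeRing ι ι-isHomomorphism

    Λ̄ K̄ : Matrix n
    Λ̄ i j = ι (Λ i j)
    K̄ i j = ι (k.kostantWeierstrass a i j)

    eval-kᵢ : ∀ i f g → CommutativeRing._≈_ (kᵢ i) f g → ∀ x → eval (P̄ i) x ≈ 0# →
      eval ι[ f ] x ≈ eval ι[ g ] x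
    eval-kᵢ i f g f≈g x P̄x≈0 = evaluate (k.≈mod⇒multiple (P i) f g f≈g)
      where
      evaluate : ∃[ u ] (u k.*ₚ P i) k.≈ₚ (f k.+ₚ (k.-ₚ g)) → eval ι[ f ] x ≈ eval ι[ g ] x
      evaluate (u , e) = x-y≈0⇒x≈y _ _ (begin
        eval ι[ f ] x - eval ι[ g ] x     ≈⟨ sym (eval-- ι[ f ] ι[ g ] x) ⟩
        eval (ι[ f ] +ₚ (-ₚ ι[ g ])) x
          ≈⟨ sym (eval-congˡ _ _ x (Poly.trans (ι.map-cong e) (ι.map-difference f g))) ⟩
        eval ι[ u k.*ₚ P i ] x
          ≈⟨ trans (eval-congˡ _ _ x (ι.map-* u (P i))) (eval-* ι[ u ] (P̄ i) x) ⟩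
        eval ι[ u ] x * eval (P̄ i) x      ≈⟨ trans (*-congˡ P̄x≈0) (zeroʳ _) ⟩
        0#                                ∎)

    L̄-≈ : ∀ f g → (∀ i t → eval f (ρ i t) ≈ eval g (ρ i t)) → f L̄.≈ g
    L̄-≈ f g e = agreeing-mod n p̄ r r-distinct p̄-monic p̄-r f g λ l → at-root l (ρ-of-root (r l) (p̄-r l))
      where
      at-root : ∀ l → ∃[ i ] ∃[ t ] ρ i t ≈ r l → eval f (r l) ≈ eval g (r l)
      at-root l (i , t , ρ≈r) = trans (eval-congʳ f (sym ρ≈r)) (trans (e i t) (eval-congʳ g ρ≈r))

    P̄-≈ : ∀ i f g → (∀ t → eval f (ρ i t) ≈ eval g (ρ i t)) →
        CommutativeRing._≈_ (quotient polyRing (P̄ i)) f g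
    P̄-≈ i = agreeing-mod (d i) (P̄ i) (ρ i) (M.conjugate-distinct i)
        (ι.Monic-map (d i) {P i} (P-monic i)) (P̄-ρ i)

    -- P_i is the minimal polynomial of δ_i, so over k the single root δ_i decides, whereas over k̄
    -- all conjugates are needed.
    kᵢ-≈ : ∀ i f g → atδ i f ≈ atδ i g → CommutativeRing._≈_ (kᵢ i) f g
    kᵢ-≈ i f g e = k.multiple⇒≈mod (P i) f g (M.root-divisible i (f k.+ₚ (k.-ₚ g)) (begin
      eval ι[ f k.+ₚ (k.-ₚ g) ] (δ i)    ≈⟨ eval-congˡ _ _ (δ i) (ι.map-difference f g) ⟩
      eval (ι[ f ] +ₚ (-ₚ ι[ g ])) (δ i) ≈⟨ trans (eval-- ι[ f ] ι[ g ] (δ i)) (x≈y⇒x-y≈0 e) ⟩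
      0#                                 ∎))

    -- The k-linear functionals on kⁿ ≅ ⊕ kᵢ given by evaluation at the roots;
    -- extended to k̄ⁿ, they are the eigenvectors of Λ.
    ψ : ∀ i → Fin (d i) → Vector k.Carrier n → Carrier
    ψ i t x = eval ι[ Φ x i ] (ρ i t)

    private
      ψ-cong : ∀ i t {x y} → (∀ l → x l k.≈ y l) → ψ i t x ≈ ψ i t y
      ψ-cong i t x≈y = eval-kᵢ i _ _ (Φ.⟦⟧-cong x≈y i) (ρ i t) (P̄-ρ i t)

      ψ-+ : ∀ i t x y → ψ i t (λ l → x l k.+ y l) ≈ ψ i t x + ψ i t y
      ψ-+ i t x y = trans (eval-kᵢ i _ _ (Φ.+ᴹ-homo x y i) (ρ i t) (P̄-ρ i t))
        (trans (eval-congˡ _ _ (ρ i t) (ι.map-+ (Φ x i) (Φ y i))) (eval-+ ι[ Φ x i ] _ (ρ i t)))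

      ψ-0 : ∀ i t → ψ i t (λ _ → k.0#) ≈ 0#
      ψ-0 i t = eval-kᵢ i (Φ (λ _ → k.0#) i) [] (Φ.0ᴹ-homo i) (ρ i t) (P̄-ρ i t)

      ψ-* : ∀ i t f x → ψ i t (k.evalᴹ f Λ k.*ᵛ x) ≈ eval ι[ f ] (ρ i t) * ψ i t x
      ψ-* i t f x = trans (eval-kᵢ i _ _ (Φ.*ₗ-homo f x i) (ρ i t) (P̄-ρ i t))
        (trans (eval-congˡ _ _ (ρ i t) (ι.map-* f (Φ x i))) (eval-* ι[ f ] ι[ Φ x i ] (ρ i t)))

      -- Scalars act as constant polynomials: `Φ` is linear over k[T], and its k-linearity has to be
      -- derived from that.
      ψ-scale : ∀ i t b x → ψ i t (λ l → b k.* x l) ≈ ι b * ψ i t x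
      ψ-scale i t b x = trans (ψ-cong i t λ l → k.sym (k.trans
          (k.∑-cong n λ j → k.trans (k.*-congʳ (k.evalᴹ-const b Λ l j)) (k.*-assoc _ _ _))
          (k.trans (k.sym (SemiringSum.*-distribˡ-sum k.semiring b (λ j → k.1ᴹ l j k.* x j)))
              (k.*-congˡ (k.∑-1ᴹˡ x l)))))
        (trans (ψ-* i t (k.const b) x) (*-congʳ (eval-const (ι b) (ρ i t))))

      ψ-T : ∀ i t x → ψ i t (Λ k.*ᵛ x) ≈ ρ i t * ψ i t x
      ψ-T i t x = trans (ψ-cong i t λ l → k.∑-cong n λ j → k.*-congʳ (k.sym (k.evalᴹ-T Λ l j)))
        (trans (ψ-* i t k.T x) (*-congʳ (trans (eval-congˡ _ _ (ρ i t) ι-T) (eval-T (ρ i t)))))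
        where
        ι-T : ι[ k.T ] ≈ₚ T
        ι-T = ∷-cong ι.0#-homo (∷-cong ι.1#-homo Poly.refl)

      ψ-sum : ∀ i t N (b : Vector k.Carrier N) (y : Fin N → Vector k.Carrier n) →
        ψ i t (λ l → k.sum (λ j → b j k.* y j l)) ≈ sum (λ j → ι (b j) * ψ i t (y j))
      ψ-sum i t zero    b y = ψ-0 i t
      ψ-sum i t (suc N) b y = trans (ψ-+ i t (λ l → b zero k.* y zero l)
          (λ l → k.sum (λ j → b (suc j) k.* y (suc j) l)))
        (+-cong (ψ-scale i t (b zero) (y zero)) (ψ-sum i t N (b ∘ suc) (y ∘ suc)))

      basis : Fin n → Vector k.Carrier n
      basis j l = k.1ᴹ l j

    φ : ∀ i → Fin (d i) → Vector Carrier n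
    φ i t j = ψ i t (basis j)

    φ-eigenvector : ∀ i t → LeftEigenvector Λ̄ (ρ i t) (φ i t)
    φ-eigenvector i t j = begin
      sum (λ l → φ i t l * ι (Λ l j))
        ≈⟨ ∑-cong n (λ l → *-comm _ _) ⟩
      sum (λ l → ι (Λ l j) * ψ i t (basis l))
        ≈⟨ sym (ψ-sum i t n (λ l → Λ l j) basis) ⟩
      ψ i t (λ l → k.sum (λ l′ → Λ l′ j k.* k.1ᴹ l l′))
        ≈⟨ ψ-cong i t (λ l → k.trans (k.trans (k.∑-cong n λ l′ → k.*-comm _ _)
            (k.∑-1ᴹˡ (λ l′ → Λ l′ j) l)) (k.sym (k.∑-1ᴹʳ (Λ l) j))) ⟩
      ψ i t (Λ k.*ᵛ basis j)
        ≈⟨ ψ-T i t (basis j) ⟩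
      ρ i t * φ i t j ∎

    η̄ : ∀ i → Fin (d i) → Carrier
    η̄ i t = eval ι[ η i ] (ρ i t)

    -- The form on basis vectors, with each trace expanded over the conjugates: the φ diagonalise it
    -- with weights η_i(ρ). The matrix of the form is antidiagonal, whence `opposite`.
    gram : ∀ j j′ → sum (λ i → sum λ t → η̄ i t * φ i t j * φ i t j′) ≈ 1ᴹ (opposite j) j′
    gram j j′ = begin
      sum (λ i → sum λ t → η̄ i t * φ i t j * φ i t j′)
        ≈⟨ ∑-cong m (λ i → sym (ι-Tr i)) ⟩
      sum (λ i → ι (k.Tr (d i) (P i) (F i)))
        ≈⟨ sym (ι.sum-homomorphic {m} (λ i → k.Tr (d i) (P i) (F i))) ⟩
      ι (k.sum λ i → k.Tr (d i) (P i) (F i))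
        ≈⟨ ι.⟦⟧-cong (k.sym (form (basis j) (basis j′))) ⟩
      ι (k.⟨ basis j , basis j′ ⟩)
        ≈⟨ ι.⟦⟧-cong (k.trans (k.∑-cong n λ l → k.*-comm _ _) (k.∑-1ᴹʳ (λ l → k.1ᴹ (opposite l) j′) j)) ⟩
      ι (k.1ᴹ (opposite j) j′)
        ≈⟨ ιᴹ.1ᴹ-homo (opposite j) j′ ⟩
      1ᴹ (opposite j) j′ ∎
      where
      F : Fin m → k.Poly
      F i = η i k.*ₚ Φ (basis j) i k.*ₚ Φ (basis j′) i
      eval-F : ∀ i t → eval ι[ F i ] (ρ i t) ≈ η̄ i t * φ i t j * φ i t j′
      eval-F i t = trans (eval-congˡ _ _ (ρ i t) (Poly.trans (ι.map-* (η i k.*ₚ Φ (basis j) i) (Φ (basis j′) i))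
          (Poly.*-congʳ {ι[ Φ (basis j′) i ]} (ι.map-* (η i) (Φ (basis j) i)))))
        (trans (eval-* (ι[ η i ] *ₚ ι[ Φ (basis j) i ]) ι[ Φ (basis j′) i ] (ρ i t))
          (*-congʳ (eval-* ι[ η i ] ι[ Φ (basis j) i ] (ρ i t))))
      ι-Tr : ∀ i → ι (k.Tr (d i) (P i) (F i)) ≈ sum λ t → η̄ i t * φ i t j * φ i t j′
      ι-Tr i = trans (ιᴹ.Tr-homo (d i) (P i) (F i)) (trans
        (Lagrange.Tr-roots field̄ (d i) (P̄ i) (ρ i) (M.conjugate-distinct i)
            (ι.Monic-map (d i) {P i} (P-monic i)) (P̄-ρ i) ι[ F i ])
        (∑-cong (d i) (eval-F i)))

    φ̂ : ∀ i → Fin (d i) → Vector Carrier n → Carrier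
    φ̂ i t x = sum λ j → φ i t j * x j

    private
      exchange : (b : ∀ i → Fin (d i) → Carrier) (x : Vector Carrier n) →
        sum (λ i → sum λ t → b i t * φ̂ i t x) ≈ sum λ j → sum (λ i → sum λ t → b i t * φ i t j) * x j
      exchange b x = begin
        sum (λ i → sum λ t → b i t * φ̂ i t x)
          ≈⟨ ∑-cong m (λ i → ∑-assoc (b i) (φ i) x) ⟩
        sum (λ i → sum λ j → sum (λ t → b i t * φ i t j) * x j)
          ≈⟨ ∑-comm (λ i j → sum (λ t → b i t * φ i t j) * x j) ⟩
        sum (λ j → sum λ i → sum (λ t → b i t * φ i t j) * x j)
          ≈⟨ ∑-cong n (λ j → sym (*-distribʳ-sum (x j) (λ i → sum (λ t → b i t * φ i t j)))) ⟩
        sum (λ j → sum (λ i → sum λ t → b i t * φ i t j) * x j) ∎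

    -- `gram`, extended linearly to k̄ⁿ. The coordinates of x are recovered from the values of the
    -- eigenvectors on x, which is the source of nondegeneracy.
    φ̂-dual : ∀ j x → sum (λ i → sum λ t → η̄ i t * φ i t j * φ̂ i t x) ≈ x (opposite j)
    φ̂-dual j x = trans (exchange (λ i t → η̄ i t * φ i t j) x)
      (trans (∑-cong n λ j′ → *-congʳ (gram j j′)) (∑-1ᴹˡ x (opposite j)))

    φ̂-form : ∀ x y → sum (λ i → sum λ t → η̄ i t * φ̂ i t y * φ̂ i t x) ≈ ⟨ x , y ⟩
    φ̂-form x y = trans (exchange (λ i t → η̄ i t * φ̂ i t y) x) (∑-cong n λ j → trans
      (*-congʳ (trans (∑-cong m λ i → ∑-cong (d i) λ t →
        solve 3 (λ a b c → a :* b :* c := a :* c :* b) refl (η̄ i t) (φ̂ i t y) (φ i t j)) (φ̂-dual j y)))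
      (*-comm _ _))

    φ̂-nondegenerate : ∀ x y → (∀ i t → φ̂ i t x ≈ φ̂ i t y) → ∀ j → x j ≈ y j
    φ̂-nondegenerate x y e j = begin
      x j                          ≡⟨ ≡.cong x (≡.sym (Fin.opposite-involutive j)) ⟩
      x (opposite (opposite j))    ≈⟨ sym (φ̂-dual (opposite j) x) ⟩
      sum (λ i → sum λ t → η̄ i t * φ i t (opposite j) * φ̂ i t x)
        ≈⟨ ∑-cong m (λ i → ∑-cong (d i) λ t → *-congˡ (e i t)) ⟩
      sum (λ i → sum λ t → η̄ i t * φ i t (opposite j) * φ̂ i t y)
        ≈⟨ φ̂-dual (opposite j) y ⟩
      y (opposite (opposite j))    ≡⟨ ≡.cong y (Fin.opposite-involutive j) ⟩
      y j                          ∎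

    -- The eigenvectors of Λ carried to Λ_KW by g
    u : ∀ i → Fin (d i) → Vector Carrier n
    u i t l = φ̂ i t (λ j → mat j l)

    u-sum : ∀ i t x → φ̂ i t (mat *ᵛ x) ≈ sum λ l → u i t l * x l
    u-sum i t x = ∑-assoc (φ i t) mat x

    private
      intertwines : mat *ᴹ K̄ ≋ Λ̄ *ᴹ mat
      intertwines i j = sym (begin
        (Λ̄ *ᴹ mat) i j                  ≈⟨ *ᴹ-congʳ mat conjugation i j ⟩
        (mat *ᴹ K̄ *ᴹ inv *ᴹ mat) i j    ≈⟨ *ᴹ-assoc (mat *ᴹ K̄) inv mat i j ⟩
        (mat *ᴹ K̄ *ᴹ (inv *ᴹ mat)) i j  ≈⟨ *ᴹ-congˡ (mat *ᴹ K̄) inverseˡ i j ⟩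
        (mat *ᴹ K̄ *ᴹ 1ᴹ) i j            ≈⟨ ∑-1ᴹʳ ((mat *ᴹ K̄) i) j ⟩
        (mat *ᴹ K̄) i j                  ∎)

    u-eigenvector : ∀ i t → LeftEigenvector K̄ (ρ i t) (u i t)
    u-eigenvector i t l = begin
      sum (λ j → u i t j * K̄ j l)                       ≈⟨ sym (u-sum i t (λ j → K̄ j l)) ⟩
      φ̂ i t (λ j → (mat *ᴹ K̄) j l)                      ≈⟨ ∑-cong n (λ j → *-congˡ (intertwines j l)) ⟩
      sum (λ j → φ i t j * sum λ h → Λ̄ j h * mat h l)   ≈⟨ ∑-assoc (φ i t) Λ̄ (λ h → mat h l) ⟩
      sum (λ h → sum (λ j → φ i t j * Λ̄ j h) * mat h l)
        ≈⟨ ∑-cong n (λ h → trans (*-congʳ (φ-eigenvector i t h)) (*-assoc _ _ _)) ⟩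
      sum (λ h → ρ i t * (φ i t h * mat h l))
        ≈⟨ sym (*-distribˡ-sum (ρ i t) (λ h → φ i t h * mat h l)) ⟩
      ρ i t * u i t l                                   ∎

    -- The value 0 for n = 0 is a convention that lets `s` be defined without an index at hand;
    -- wherever the value matters, `Fin n` has an element.
    head : ∀ {n} → Vector Carrier n → Carrier
    head {zero}  x = 0#
    head {suc n} x = x zero

    head-first : ∀ {n} (x : Vector Carrier n) i → toℕ i ≡ 0 → x i ≈ head x
    head-first x zero _ = refl

    s : ∀ i → Fin (d i) → Carrier
    s i t = head (u i t)

    -- The form of g F(Λ_KW) e₁ and g e₁ for F = p / (T − ρ), computed in
    -- two ways: the eigenvectors of Λ other than that for ρ do not contribute.
    s-square : ∀ i t → η̄ i t * s i t * (p̄′ (ρ i t) * s i t) ≈ 1#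
    s-square i t = compute (firstIndex (proj₁ (p̄-root-is-r (ρ i t) (p̄-ρ i t))))
      where
      compute : ∃[ o ] toℕ {n} o ≡ 0 → η̄ i t * s i t * (p̄′ (ρ i t) * s i t) ≈ 1#
      compute (o , o≡0) = begin
        η̄ i t * s i t * (p̄′ (ρ i t) * s i t)
          ≈⟨ *-cong (*-congˡ (sym (head-first (u i t) o o≡0))) (*-cong F-ρ (sym (head-first (u i t) o o≡0))) ⟩
        term i t
          ≈⟨ sym (sum-over-ρ term i t λ i′ t′ ne → trans (*-congˡ (trans (*-congʳ
               (eval-synthetic-other p̄ (ρ i t) (ρ i′ t′) (p̄-ρ i t) (p̄-ρ i′ t′) ne)) (zeroˡ _))) (zeroʳ _)) ⟩
        sum (λ i → sum (term i))
          ≈⟨ ∑-cong m (λ i → ∑-cong (d i) λ t → sym (*-cong (*-congˡ (trans (u-sum i t e₁) (∑-1ᴹʳ (u i t) o)))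
               (trans (u-sum i t x) (evalᴹ-eigenvector F K̄ (ρ i t) (u i t) (u-eigenvector i t) o)))) ⟩
        sum (λ i → sum λ t → η̄ i t * φ̂ i t (mat *ᵛ e₁) * φ̂ i t (mat *ᵛ x))
          ≈⟨ φ̂-form (mat *ᵛ x) (mat *ᵛ e₁) ⟩
        ⟨ mat *ᵛ x , mat *ᵛ e₁ ⟩
          ≈⟨ orthogonal x e₁ ⟩
        ⟨ x , e₁ ⟩
          ≈⟨ sum-single +-commutativeMonoid (λ j → x j * e₁ (opposite j)) (opposite o) (λ j j≢ → trans
               (*-congˡ (1ᴹ-off-diagonal λ e → j≢
                   (≡.trans (≡.sym (Fin.opposite-involutive j)) (≡.cong opposite e)))) (zeroʳ _)) ⟩
        x (opposite o) * e₁ (opposite (opposite o))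
          ≈⟨ trans (*-congˡ (trans (reflexive (≡.cong e₁ (Fin.opposite-involutive o))) (1ᴹ-diagonal o)))
              (*-identityʳ _) ⟩
        x (opposite o)
          -- `opposite o` is the last index N = n - 1, and the last entry of F(Λ_KW) e₁ is the
          -- leading coefficient of F.
          ≈⟨ krylov N F N<n (proj₂ F-monic) (opposite o) ℕ.≤-refl ⟩
        coeff F N
          ≈⟨ proj₁ F-monic ⟩
        1# ∎
        where
        open KostantWeierstrass commutativeRing (ι ∘ a) K̄
          (kostantWeierstrass-homo k.commutativeRing commutativeRing ι ι-isHomomorphism a) o o≡0
        N : ℕ
        N = toℕ (opposite o)
        N<n : N < n
        N<n = Fin.toℕ<n (opposite o)
        n≡N+1 : n ≡ suc N
        n≡N+1 = ≡.sym (≡.trans (≡.cong suc (≡.trans (Fin.opposite-prop o) (≡.cong (λ o → n ℕ.∸ suc o) o≡0)))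
          (≡.trans (≡.sym (ℕ.+-∸-assoc 1 (ℕ.≤-trans (s≤s z≤n) N<n))) ≡.refl))
        F : Poly
        F = synthetic p̄ (ρ i t)
        F-monic : MonicOfDegree N F
        F-monic = Monic-synthetic N p̄ (ρ i t) (≡.subst (λ n → MonicOfDegree n p̄) n≡N+1 p̄-monic)
        F-ρ : p̄′ (ρ i t) ≈ eval F (ρ i t)
        F-ρ = trans (p̄′-derivative (ρ i t)) (sym (eval-synthetic-derivative p̄ (ρ i t)))
        e₁ x : Vector Carrier n
        e₁ l = 1ᴹ l o
        x l = evalᴹ F K̄ l o
        term : ∀ i → Fin (d i) → Carrier
        term i t = η̄ i t * u i t o * (eval F (ρ i t) * u i t o)

    private
      η-nonzero : ∀ i → ¬ eval ι[ η i ] (δ i) ≈ 0#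
      η-nonzero i = nonzero (η-unit i)
        where
        nonzero : IsUnit (kᵢ i) (η i) → ¬ eval ι[ η i ] (δ i) ≈ 0#
        nonzero (y , yη≈1) = unit-nonzero (begin
          eval ι[ y ] (δ i) * eval ι[ η i ] (δ i)
            ≈⟨ sym (trans (eval-congˡ _ _ (δ i) (ι.map-* y (η i))) (eval-* ι[ y ] ι[ η i ] (δ i))) ⟩
          eval ι[ y k.*ₚ η i ] (δ i)
            ≈⟨ eval-kᵢ i (y k.*ₚ η i) (k.const k.1#) yη≈1 (δ i) (δ-root i) ⟩
          eval (const (ι k.1#)) (δ i)
            ≈⟨ trans (eval-const _ (δ i)) ι.1#-homo ⟩
          1# ∎)

    α : Fin m → k.Poly
    α = relativeClass η η-nonzero

    A : ∀ i → Fin (d i) → Carrier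
    A i t = eval ι[ α i ] (ρ i t)

    s²A≈1 : ∀ i t → s i t * s i t * A i t ≈ 1#
    s²A≈1 i t = begin
      s i t * s i t * A i t
        ≈⟨ *-congˡ (eval-relativeClass η η-nonzero i (ρ i t)) ⟩
      s i t * s i t * (η̄ i t * p̄′ (ρ i t))
        ≈⟨ solve 3 (λ s e d → s :* s :* (e :* d) := e :* s :* (d :* s)) refl (s i t) (η̄ i t) (p̄′ (ρ i t)) ⟩
      η̄ i t * s i t * (p̄′ (ρ i t) * s i t)
        ≈⟨ s-square i t ⟩
      1# ∎

    open Lagrange field̄ n p̄ r r-distinct p̄-monic p̄-r using (interpolate; eval-interpolate)

    -- The nodes of interpolation are the `r l`, each traced back to a pair (i , t) with root ρ i t.
    -- By `ρ-injective` this pair is unique, so the tracing does not affect the values.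
    fromValues : (∀ i → Fin (d i) → Carrier) → Poly
    fromValues v = interpolate λ l → v _ (proj₁ (proj₂ (ρ-of-root (r l) (p̄-r l))))

    eval-fromValues : ∀ v i t → eval (fromValues v) (ρ i t) ≈ v i t
    eval-fromValues v i t = evaluate (p̄-root-is-r (ρ i t) (p̄-ρ i t))
      where
      evaluate : ∃[ l ] r l ≈ ρ i t → eval (fromValues v) (ρ i t) ≈ v i t
      evaluate (l , r≈ρ) = trans (eval-congʳ (fromValues v) (sym r≈ρ)) (trans (eval-interpolate _ l)
        (same (ρ-of-root (r l) (p̄-r l))))
        where
        same : (x : ∃[ j ] ∃[ t ] ρ j t ≈ r l) → v _ (proj₁ (proj₂ x)) ≈ v i t
        same (j , t′ , ρ≈r) = reflexive (≡.cong (λ (i , t) → v i t) (ρ-injective j i t′ t (trans ρ≈r r≈ρ)))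

    -- In k̄[T] / (p), the square of b̄ is the class α, and s̄ is its inverse;
    -- s̄(Λ) carries the vector with all coordinates 1 in ⊕ kᵢ to g e₁.
    s̄ b̄ : Poly
    s̄ = fromValues s
    b̄ = fromValues λ i t → s i t * A i t

    eval-b̄ : ∀ i t → eval b̄ (ρ i t) ≈ s i t * A i t
    eval-b̄ = eval-fromValues λ i t → s i t * A i t

    s̄b̄≈1 : ∀ i t → s i t * (s i t * A i t) ≈ 1#
    s̄b̄≈1 i t = trans (sym (*-assoc _ _ _)) (s²A≈1 i t)

    private
      module Iso (σ : Gal) = RingMorphisms.IsRingIsomorphism (isRingIsomorphism σ)
      module Hom (σ : Gal) = Homomorphism commutativeRing commutativeRing ⟦ σ ⟧ (Iso.isRingHomomorphism σ)

      galois-eval : ∀ σ f x → ⟦ σ ⟧ (eval ι[ f ] x) ≈ eval ι[ f ] (⟦ σ ⟧ x)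
      galois-eval σ f x = trans (sym (Hom.eval-map σ ι[ f ] x)) (fixed f)
        where
        fixed : ∀ f → eval (List.map ⟦ σ ⟧ ι[ f ]) (⟦ σ ⟧ x) ≈ eval ι[ f ] (⟦ σ ⟧ x)
        fixed []      = refl
        fixed (b ∷ f) = +-cong (fixes σ b) (*-congˡ (fixed f))

      -- The value of σ ∙ f at ρ is σ applied to the value of f at σ⁻¹ρ, so that element is needed;
      -- it is a root of P_i because σ fixes the coefficients of P_i.
      preimage : ∀ σ i t → ∃[ t′ ] ⟦ σ ⟧ (ρ i t′) ≈ ρ i t
      preimage σ i t = find (Iso.surjective σ (ρ i t))
        where
        find : (∃[ x ] (∀ {z} → z ≈ x → ⟦ σ ⟧ z ≈ ρ i t)) → ∃[ t′ ] ⟦ σ ⟧ (ρ i t′) ≈ ρ i t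
        find (x , e) = conjugate-at (M.P-root i x (Iso.injective σ (begin
            ⟦ σ ⟧ (eval (P̄ i) x)   ≈⟨ galois-eval σ (P i) x ⟩
            eval (P̄ i) (⟦ σ ⟧ x)   ≈⟨ eval-congʳ (P̄ i) (e refl) ⟩
            eval (P̄ i) (ρ i t)     ≈⟨ P̄-ρ i t ⟩
            0#                     ≈⟨ sym (Hom.0#-homo σ) ⟩
            ⟦ σ ⟧ 0#               ∎)))
          where
          conjugate-at : ∃[ t′ ] ρ i t′ ≈ x → ∃[ t′ ] ⟦ σ ⟧ (ρ i t′) ≈ ρ i t
          conjugate-at (t′ , ρ≈x) = t′ , e ρ≈x

      eval-∙ : ∀ σ f {x y} → ⟦ σ ⟧ y ≈ x → eval (σ ∙ f) x ≈ ⟦ σ ⟧ (eval f y)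
      eval-∙ σ f e = trans (eval-congʳ (σ ∙ f) (sym e)) (Hom.eval-map σ f _)

    -- Since s̄ is inverse to b̄, this is b̄⁻¹ σ(b̄), a Kummer cocycle by construction; what needs
    -- an argument is that it represents g⁻¹ σ(g). At a root its value is s / σ(s), which is ±1 and
    -- hence also σ(s) / s.
    zPoly : Gal → Poly
    zPoly σ = s̄ *ₚ (σ ∙ b̄)

    private
      -- The class α has coefficients in k, so σ carries its value at σ⁻¹ρ to its value at ρ.
      eval-z : ∀ σ i t t′ → ⟦ σ ⟧ (ρ i t′) ≈ ρ i t → eval (zPoly σ) (ρ i t) ≈ s i t * (⟦ σ ⟧ (s i t′) * A i t)
      eval-z σ i t t′ e = trans (eval-* s̄ (σ ∙ b̄) (ρ i t)) (*-cong (eval-fromValues s i t)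
        (trans (eval-∙ σ b̄ e) (trans (Gal.⟦⟧-cong σ (eval-b̄ i t′)) (trans (Hom.*-homo σ _ _) (*-congˡ
          (trans (galois-eval σ (α i) (ρ i t′)) (eval-congʳ ι[ α i ] e)))))))

      σs²A≈1 : ∀ σ i t t′ → ⟦ σ ⟧ (ρ i t′) ≈ ρ i t → ⟦ σ ⟧ (s i t′) * ⟦ σ ⟧ (s i t′) * A i t ≈ 1#
      σs²A≈1 σ i t t′ e = begin
        ⟦ σ ⟧ (s i t′) * ⟦ σ ⟧ (s i t′) * A i t
          ≈⟨ *-cong (sym (Hom.*-homo σ _ _))
              (sym (trans (galois-eval σ (α i) (ρ i t′)) (eval-congʳ ι[ α i ] e))) ⟩
        ⟦ σ ⟧ (s i t′ * s i t′) * ⟦ σ ⟧ (A i t′)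
          ≈⟨ sym (Hom.*-homo σ _ _) ⟩
        ⟦ σ ⟧ (s i t′ * s i t′ * A i t′)
          ≈⟨ trans (Gal.⟦⟧-cong σ (s²A≈1 i t′)) (Hom.1#-homo σ) ⟩
        1# ∎

      z²≈1 : ∀ σ → (zPoly σ *ₚ zPoly σ) L̄.≈ L̄.1#
      z²≈1 σ = L̄-≈ (zPoly σ *ₚ zPoly σ) (const 1#) λ i t → square i t (preimage σ i t)
        where
        square : ∀ i t → ∃[ t′ ] ⟦ σ ⟧ (ρ i t′) ≈ ρ i t → eval (zPoly σ *ₚ zPoly σ) (ρ i t)
            ≈ eval (const 1#) (ρ i t)
        square i t (t′ , e) = begin
          eval (zPoly σ *ₚ zPoly σ) (ρ i t)
            ≈⟨ trans (eval-* (zPoly σ) (zPoly σ) (ρ i t)) (*-cong (eval-z σ i t t′ e) (eval-z σ i t t′ e)) ⟩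
          s i t * (x * A i t) * (s i t * (x * A i t))
            ≈⟨ solve 3 (λ s x a → s :* (x :* a) :* (s :* (x :* a)) :=
                (s :* s :* a) :* (x :* x :* a)) refl (s i t) x (A i t) ⟩
          (s i t * s i t * A i t) * (x * x * A i t)
            ≈⟨ *-cong (s²A≈1 i t) (σs²A≈1 σ i t t′ e) ⟩
          1# * 1#
            ≈⟨ trans (*-identityˡ 1#) (sym (eval-const 1# (ρ i t))) ⟩
          eval (const 1#) (ρ i t) ∎
          where
          x = ⟦ σ ⟧ (s i t′)

      z-cocycle : ∀ σ τ → zPoly (σ ⊚ τ) L̄.≈ (zPoly σ *ₚ (σ ∙ zPoly τ))
      z-cocycle σ τ = L̄-≈ (zPoly (σ ⊚ τ)) (zPoly σ *ₚ (σ ∙ zPoly τ)) λ i t → compose i t (preimage σ i t)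
        where
        compose : ∀ i t → ∃[ t′ ] ⟦ σ ⟧ (ρ i t′) ≈ ρ i t →
          eval (zPoly (σ ⊚ τ)) (ρ i t) ≈ eval (zPoly σ *ₚ (σ ∙ zPoly τ)) (ρ i t)
        compose i t (t₁ , e₁) = compose′ (preimage τ i t₁)
          where
          compose′ : ∃[ t′ ] ⟦ τ ⟧ (ρ i t′) ≈ ρ i t₁ →
            eval (zPoly (σ ⊚ τ)) (ρ i t) ≈ eval (zPoly σ *ₚ (σ ∙ zPoly τ)) (ρ i t)
          compose′ (t₂ , e₂) = begin
            eval (zPoly (σ ⊚ τ)) (ρ i t)
              ≈⟨ eval-z (σ ⊚ τ) i t t₂ (trans (Gal.⟦⟧-cong σ e₂) e₁) ⟩
            s i t * (y * A i t)
              -- A factor x² A = 1 is inserted, one x going to each of the two cocycle values.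
              ≈⟨ trans (sym (*-identityʳ _)) (*-congˡ (sym (σs²A≈1 σ i t t₁ e₁))) ⟩
            s i t * (y * A i t) * (x * x * A i t)
              ≈⟨ solve 4 (λ s x y a → s :* (y :* a) :* (x :* x :* a) :=
                  s :* (x :* a) :* (x :* (y :* a))) refl (s i t) x y (A i t) ⟩
            s i t * (x * A i t) * (x * (y * A i t))
              ≈⟨ *-congˡ (sym (trans (Gal.⟦⟧-cong σ (eval-z τ i t₁ t₂ e₂)) (trans (Hom.*-homo σ _ _) (*-congˡ
                   (trans (Hom.*-homo σ _ _) (*-congˡ
                       (trans (galois-eval σ (α i) (ρ i t₁)) (eval-congʳ ι[ α i ] e₁)))))))) ⟩
            s i t * (x * A i t) * ⟦ σ ⟧ (eval (zPoly τ) (ρ i t₁))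
              ≈⟨ sym (*-cong (eval-z σ i t t₁ e₁) (eval-∙ σ (zPoly τ) e₁)) ⟩
            eval (zPoly σ) (ρ i t) * eval (σ ∙ zPoly τ) (ρ i t)
              ≈⟨ sym (eval-* (zPoly σ) (σ ∙ zPoly τ) (ρ i t)) ⟩
            eval (zPoly σ *ₚ (σ ∙ zPoly τ)) (ρ i t) ∎
            where
            x = ⟦ σ ⟧ (s i t₁)
            y = ⟦ σ ⟧ (⟦ τ ⟧ (s i t₂))

      ∙-agree : ∀ σ τ f → All (λ x → ⟦ τ ⟧ x ≈ ⟦ σ ⟧ x) f → (τ ∙ f) ≈ₚ (σ ∙ f)
      ∙-agree σ τ []      []       = Poly.refl
      ∙-agree σ τ (b ∷ f) (e ∷ es) = ∷-cong e (∙-agree σ τ f es)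

    z : Cocycle
    z = record
      { at         = λ σ → zPoly σ , z²≈1 σ
      ; cocycle    = z-cocycle
      -- `zPoly σ` depends on σ only through its values on the finitely many coefficients of b̄.
      ; continuous = λ σ → b̄ , λ τ agree → L̄-≈ (zPoly τ) (zPoly σ) λ i t →
          eval-congˡ (zPoly τ) (zPoly σ) (ρ i t) (Poly.*-congˡ {s̄} (∙-agree σ τ b̄ agree))
      }

    -- After multiplication by g, columns are compared through the functionals φ, which determine a
    -- vector. On one side a polynomial in Λ_KW acts on u by its value at ρ; the other side gives
    -- the σ-image of the row u for σ⁻¹ρ.
    z-position : ∀ σ → evalᴹ (zPoly σ) K̄ ≋ inv *ᴹ (λ i j → ⟦ σ ⟧ (mat i j))
    z-position σ i j = sym (begin
      (inv *ᴹ σmat) i j         ≈⟨ *ᴹ-congˡ inv (λ h l → sym (gE≋σmat l h)) i j ⟩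
      (inv *ᴹ (mat *ᴹ E)) i j   ≈⟨ sym (*ᴹ-assoc inv mat E i j) ⟩
      (inv *ᴹ mat *ᴹ E) i j     ≈⟨ *ᴹ-congʳ E inverseˡ i j ⟩
      (1ᴹ *ᴹ E) i j             ≈⟨ ∑-1ᴹˡ (λ l → E l j) i ⟩
      E i j                     ∎)
      where
      σmat E : Matrix n
      σmat i j = ⟦ σ ⟧ (mat i j)
      E = evalᴹ (zPoly σ) K̄

      gE≋σmat : ∀ l h → (mat *ᴹ E) h l ≈ σmat h l
      gE≋σmat l = φ̂-nondegenerate (λ h → (mat *ᴹ E) h l) (λ h → σmat h l) λ i t →
          compare i t (preimage σ i t) (firstIndex l)
        where
        compare : ∀ i t → ∃[ t′ ] ⟦ σ ⟧ (ρ i t′) ≈ ρ i t → ∃[ o ] toℕ {n} o ≡ 0 →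
          φ̂ i t (λ h → (mat *ᴹ E) h l) ≈ φ̂ i t (λ h → σmat h l)
        compare i t (t′ , e) (o , o≡0) = begin
          φ̂ i t (λ h → (mat *ᴹ E) h l)
            ≈⟨ u-sum i t (λ h → E h l) ⟩
          sum (λ h → u i t h * E h l)
            ≈⟨ evalᴹ-eigenvector (zPoly σ) K̄ (ρ i t) (u i t) (u-eigenvector i t) l ⟩
          eval (zPoly σ) (ρ i t) * u i t l
            ≈⟨ *-congʳ (eval-z σ i t t′ e) ⟩
          s i t * (⟦ σ ⟧ (s i t′) * A i t) * u i t l
            ≈⟨ solve 4 (λ s x a u → s :* (x :* a) :* u := s :* a :* (x :* u)) refl (s i t)
                (⟦ σ ⟧ (s i t′)) (A i t) (u i t l) ⟩
          s i t * A i t * (⟦ σ ⟧ (s i t′) * u i t l)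
            -- Proportionality of u and the σ-image u′, cross-multiplied by their first entries s
            -- and σ(s).
            ≈⟨ *-congˡ (trans (*-congʳ (Gal.⟦⟧-cong σ (sym (head-first (u i t′) o o≡0))))
                 (trans (eigenvectors-proportional (ρ i t) (u i t) u′ (u-eigenvector i t) u′-eigenvector l)
                   (*-congʳ (head-first (u i t) o o≡0)))) ⟩
          s i t * A i t * (s i t * u′ l)
            ≈⟨ solve 3 (λ s a u → s :* a :* (s :* u) := s :* s :* a :* u) refl (s i t) (A i t) (u′ l) ⟩
          s i t * s i t * A i t * u′ l
            ≈⟨ trans (*-congʳ (s²A≈1 i t)) (*-identityˡ _) ⟩
          u′ l
            ≈⟨ trans (Hom.sum-homomorphic σ {n} (λ h → φ i t′ h * mat h l))
                (∑-cong n λ h → trans (Hom.*-homo σ _ _)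
                 (*-congʳ (trans (galois-eval σ (Φ (basis h) i) (ρ i t′)) (eval-congʳ ι[ Φ (basis h) i ] e)))) ⟩
          φ̂ i t (λ h → σmat h l) ∎
          where
          open KostantWeierstrass commutativeRing (ι ∘ a) K̄
            (kostantWeierstrass-homo k.commutativeRing commutativeRing ι ι-isHomomorphism a) o o≡0
          u′ : Vector Carrier n
          u′ l = ⟦ σ ⟧ (u i t′ l)
          u′-eigenvector : LeftEigenvector K̄ (ρ i t) u′
          u′-eigenvector j = begin
            sum (λ l → u′ l * K̄ l j)
              ≈⟨ ∑-cong n (λ l → trans (*-congˡ (sym (fixes σ _))) (sym (Hom.*-homo σ _ _))) ⟩
            sum (λ l → ⟦ σ ⟧ (u i t′ l * K̄ l j))
              ≈⟨ sym (Hom.sum-homomorphic σ {n} (λ l → u i t′ l * K̄ l j)) ⟩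
            ⟦ σ ⟧ (sum λ l → u i t′ l * K̄ l j)
              ≈⟨ Gal.⟦⟧-cong σ (u-eigenvector i t′ j) ⟩
            ⟦ σ ⟧ (ρ i t′ * u i t′ j)
              ≈⟨ trans (Hom.*-homo σ _ _) (*-congʳ e) ⟩
            ρ i t * u′ j ∎

    z-kummer : Kummer P α z
    z-kummer = b̄ , (s̄ , L̄-≈ (s̄ *ₚ b̄) (const 1#) λ i t → s̄b̄ i t)
      , (λ i → P̄-≈ i (b̄ *ₚ b̄) ι[ α i ] λ t → begin
          eval (b̄ *ₚ b̄) (ρ i t)
            ≈⟨ trans (eval-* b̄ b̄ (ρ i t)) (*-cong (eval-b̄ i t) (eval-b̄ i t)) ⟩
          s i t * A i t * (s i t * A i t)
            ≈⟨ solve 2 (λ s a → s :* a :* (s :* a) := s :* s :* a :* a) refl (s i t) (A i t) ⟩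
          s i t * s i t * A i t * A i t
            ≈⟨ trans (*-congʳ (s²A≈1 i t)) (*-identityˡ _) ⟩
          A i t ∎)
      , λ σ → L̄-≈ (b̄ *ₚ zPoly σ) (σ ∙ b̄) λ i t → begin
          eval (b̄ *ₚ zPoly σ) (ρ i t)
            ≈⟨ trans (eval-* b̄ (zPoly σ) (ρ i t)) (*-congˡ (eval-* s̄ (σ ∙ b̄) (ρ i t))) ⟩
          eval b̄ (ρ i t) * (eval s̄ (ρ i t) * eval (σ ∙ b̄) (ρ i t))
            ≈⟨ solve 3 (λ b s x → b :* (s :* x) := s :* b :* x) refl (eval b̄ (ρ i t)) (eval s̄ (ρ i t))
                (eval (σ ∙ b̄) (ρ i t)) ⟩
          eval s̄ (ρ i t) * eval b̄ (ρ i t) * eval (σ ∙ b̄) (ρ i t)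
            ≈⟨ trans (*-congʳ (trans (sym (eval-* s̄ b̄ (ρ i t)))
                (trans (s̄b̄ i t) (eval-const 1# (ρ i t))))) (*-identityˡ _) ⟩
          eval (σ ∙ b̄) (ρ i t) ∎
      where
      s̄b̄ : ∀ i t → eval (s̄ *ₚ b̄) (ρ i t) ≈ eval (const 1#) (ρ i t)
      s̄b̄ i t = trans (eval-* s̄ b̄ (ρ i t)) (trans (*-cong (eval-fromValues s i t) (eval-b̄ i t))
        (trans (s̄b̄≈1 i t) (sym (eval-const 1# (ρ i t)))))

    -- The cocycle is already in Kummer form and serves as its own representative, with trivial
    -- coboundary.
    z∼z : Cohomologous z z
    z∼z = AbelianGroup.ε (μ₂ L̄) , λ σ → L̄-≈ (zPoly σ) (const 1# *ₚ zPoly σ *ₚ (σ ∙ const 1#)) λ i t →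
      eval-congˡ (zPoly σ) (const 1# *ₚ zPoly σ *ₚ (σ ∙ const 1#)) (ρ i t) (Poly.sym (Poly.trans
        (Poly.*-cong (Poly.*-identityˡ (zPoly σ)) (∷-cong (Hom.1#-homo σ) Poly.refl))
            (Poly.*-identityʳ (zPoly σ))))

    private
      -- The inverse is f ^ (q ^ d_i - 2): the value of f at δ_i is fixed by the d_i-th iterate of
      -- Frobenius, and values at δ_i decide equality in k_i.
      kᵢ-unit : ∀ i f → ¬ atδ i f ≈ 0# → IsUnit (kᵢ i) f
      kᵢ-unit i f f≉0 = invert (q ℕ.^ d i) refl 1<q^d
        where
        open MonoidSum *-commutativeMonoid using () renaming (sum-replicate to product-replicate)
        1<q^d : 1 < q ℕ.^ d i
        1<q^d = ℕ.<-≤-trans (FiniteField.1<q k q size) (ℕ.≤-trans (ℕ.≤-reflexive (≡.sym (ℕ.^-identityʳ q)))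
          (ℕ.^-monoʳ-≤ q {{ℕ.>-nonZero (ℕ.<-trans (s≤s z≤n) (FiniteField.1<q k q size))}} (M.d-positive i)))
        power : ℕ → k.Poly
        power N = k.productₚ {N} λ _ → f
        eval-power : ∀ N → atδ i (power N) ≈ atδ i f ^ N
        eval-power N = trans (eval-congˡ _ _ (δ i) (ι.map-product {N} λ _ → f))
          (trans (eval-product {N} (λ _ → ι[ f ]) (δ i)) (product-replicate N))
        fixed : atδ i f ^ (q ℕ.^ d i) ≈ atδ i f
        fixed = trans (frobenius-eval (d i) f (δ i)) (eval-congʳ ι[ f ] (M.d-period i))
        invert : ∀ N → atδ i f ^ (q ℕ.^ d i) ≈ atδ i f ^ N → 1 < N → IsUnit (kᵢ i) f
        invert (suc (suc N)) e _ = power N , kᵢ-≈ i (power N k.*ₚ f) (k.const k.1#) (begin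
          atδ i (power N k.*ₚ f)
            ≈⟨ trans (eval-congˡ _ _ (δ i) (ι.map-* (power N) f)) (eval-* ι[ power N ] ι[ f ] (δ i)) ⟩
          atδ i (power N) * atδ i f   ≈⟨ trans (*-congʳ (eval-power N)) (*-comm _ _) ⟩
          atδ i f ^ suc N
            ≈⟨ *-cancelˡ (atδ i f) f≉0 (trans (sym e) (trans fixed (sym (*-identityʳ _)))) ⟩
          1#                          ≈⟨ sym (trans (eval-const (ι k.1#) (δ i)) ι.1#-homo) ⟩
          atδ i (k.const k.1#)        ∎)
        invert (suc zero) _ (s≤s ())

    α-unit : ∀ i → IsUnit (kᵢ i) (α i)
    α-unit i = kᵢ-unit i (α i) (relativeClass-nonzero η η-nonzero i)

    -- As k_i is a field, μ₂(k_i) is ±1, so signs on the c_i may be prescribed freely; an element is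
    -- read off as ±1 from its value at δ_i.
    module _ (w : Fin m → Sign) where
      open MonoidSum Sign.*-commutativeMonoid using () renaming (∑-distrib-+ to product-distrib-*)
      private
        module C = AbelianGroup C

        -- The character of {±1} ⊆ k̄ taking −1 to w
        atSign : Sign → Carrier → Sign
        atSign w v = if does (v ≟ 1#) then Sign.+ else w

        atSign-1 : ∀ w v → v ≈ 1# → atSign w v ≡ Sign.+
        atSign-1 w v v≈1 with v ≟ 1#
        ... | yes _  = ≡.refl
        ... | no v≉1 = ⊥-elim (v≉1 v≈1)

        atSign-≉1 : ∀ w v → ¬ v ≈ 1# → atSign w v ≡ w
        atSign-≉1 w v v≉1 with v ≟ 1#
        ... | yes v≈1 = ⊥-elim (v≉1 v≈1)
        ... | no _    = ≡.refl

        atSign-cong : ∀ w v v′ → v ≈ v′ → atSign w v ≡ atSign w v′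
        atSign-cong w v v′ e = decide (v′ ≟ 1#)
          where
          decide : Dec (v′ ≈ 1#) → atSign w v ≡ atSign w v′
          decide (yes v′≈1) = ≡.trans (atSign-1 w v (trans e v′≈1)) (≡.sym (atSign-1 w v′ v′≈1))
          decide (no v′≉1)  = ≡.trans (atSign-≉1 w v λ v≈1 → v′≉1 (trans (sym e) v≈1))
              (≡.sym (atSign-≉1 w v′ v′≉1))

        atSign-* : ∀ w v v′ → v * v ≈ 1# → v′ * v′ ≈ 1# → atSign w (v * v′) ≡ atSign w v Sign.* atSign w v′
        atSign-* w v v′ v²≈1 v′²≈1 = decide (v ≟ 1#) (v′ ≟ 1#)
          where
          decide : Dec (v ≈ 1#) → Dec (v′ ≈ 1#) → atSign w (v * v′) ≡ atSign w v Sign.* atSign w v′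
          decide (yes v≈1) _ = ≡.trans (atSign-cong w (v * v′) v′ (trans (*-congʳ v≈1) (*-identityˡ v′)))
            (≡.cong (Sign._* atSign w v′) (≡.sym (atSign-1 w v v≈1)))
          decide (no v≉1) (yes v′≈1) = ≡.trans (atSign-cong w (v * v′) v (trans (*-congˡ v′≈1) (*-identityʳ v)))
            (≡.trans (≡.sym (Sign.*-identityʳ _)) (≡.cong (atSign w v Sign.*_) (≡.sym (atSign-1 w v′ v′≈1))))
          decide (no v≉1) (no v′≉1) = ≡.trans
            (atSign-1 w (v * v′) (trans (*-cong (square-one v v²≈1 v≉1) (square-one v′ v′²≈1 v′≉1)) -1*-1))
            (≡.trans (≡.sym (Sign.s*s≡+ w))
                (≡.sym (≡.cong₂ Sign._*_ (atSign-≉1 w v v≉1) (atSign-≉1 w v′ v′≉1))))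

        ∏ˢ : ∀ {m} → Vector Sign m → Sign
        ∏ˢ = RawMonoidDefs.sum Sign.*-1-rawMonoid

        coordinate : C.Carrier → Fin m → Carrier
        coordinate x i = atδ i (proj₁ (x i))

        coordinate-cong : ∀ x y → x C.≈ y → ∀ i → coordinate x i ≈ coordinate y i
        coordinate-cong x y e i = eval-kᵢ i _ _ (e i) (δ i) (δ-root i)

        coordinate-* : ∀ x y i → coordinate (x C.∙ y) i ≈ coordinate x i * coordinate y i
        coordinate-* x y i = trans (eval-congˡ _ _ (δ i) (ι.map-* (proj₁ (x i)) (proj₁ (y i))))
          (eval-* ι[ proj₁ (x i) ] ι[ proj₁ (y i) ] (δ i))

        atδ-1 : ∀ i → atδ i (k.const k.1#) ≈ 1#
        atδ-1 i = trans (eval-const _ (δ i)) ι.1#-homo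

        coordinate-square : ∀ x i → coordinate x i * coordinate x i ≈ 1#
        coordinate-square x i = trans (sym (coordinate-* x x i))
          (trans (eval-kᵢ i (proj₁ (x i) k.*ₚ proj₁ (x i)) (k.const k.1#) (proj₂ (x i)) (δ i)
              (δ-root i)) (atδ-1 i))

        value : C.Carrier → Sign
        value x = ∏ˢ λ i → atSign (w i) (coordinate x i)

        value-cong : ∀ x y → x C.≈ y → value x ≡ value y
        value-cong x y e = sum-cong Sign.*-commutativeMonoid m λ i →
          atSign-cong (w i) (coordinate x i) (coordinate y i) (coordinate-cong x y e i)

        value-* : ∀ x y → value (x C.∙ y) ≡ value x Sign.* value y
        value-* x y = ≡.trans
          (sum-cong Sign.*-commutativeMonoid m λ i → ≡.trans
            (atSign-cong (w i) (coordinate (x C.∙ y) i) (coordinate x i * coordinate y i) (coordinate-* x y i))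
            (atSign-* (w i) (coordinate x i) (coordinate y i) (coordinate-square x i) (coordinate-square y i)))
          (product-distrib-* {m} (λ i → atSign (w i) (coordinate x i)) (λ i → atSign (w i) (coordinate y i)))

        value-ε : value C.ε ≡ Sign.+
        value-ε = sum-ε Sign.*-commutativeMonoid {m} (λ i → atSign (w i) (coordinate C.ε i)) λ i →
          atSign-1 (w i) (coordinate C.ε i) (atδ-1 i)

      characterWithSigns : Character C
      characterWithSigns = record
        { ⟦_⟧ = value
        ; isGroupHomomorphism = record
          { isMonoidHomomorphism = record
            { isMagmaHomomorphism = record
              { isRelHomomorphism = record { cong = λ {x} {y} → value-cong x y }
              ; homo = value-*
              }
            ; ε-homo = value-ε
            }
          ; ⁻¹-homo = λ _ → ≡.refl
          }
        }

      characterWithSigns-defined : DefinedBy characterWithSigns w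
      characterWithSigns-defined i = ≡.trans
          (sum-single Sign.*-commutativeMonoid (λ j → atSign (w j) (coordinate (cᵢ i) j)) i other) here
        where
        -- The decision inside `cᵢ` is made an argument, so that both outcomes can be matched on.
        at-choice : ∀ j → Dec (i ≡ j) → Carrier
        at-choice j i≟j = atδ j (proj₁ (if does i≟j then minusOne (kᵢ j) else AbelianGroup.ε (μ₂ (kᵢ j))))
        trivial : ∀ j i≟j → j ≢ i → at-choice j i≟j ≈ 1#
        trivial j (yes i≡j) j≢i = ⊥-elim (j≢i (≡.sym i≡j))
        trivial j (no _)    j≢i = atδ-1 j
        nontrivial : ∀ i≟i → at-choice i i≟i ≈ - 1#
        nontrivial (no i≢i) = ⊥-elim (i≢i ≡.refl)
        nontrivial (yes _)  = trans (eval-congˡ _ _ (δ i) (ι.map-neg (k.const k.1#)))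
          (trans (eval-neg ι[ k.const k.1# ] (δ i)) (-‿cong (atδ-1 i)))
        other : ∀ j → j ≢ i → atSign (w j) (coordinate (cᵢ i) j) ≡ Sign.+
        other j j≢i = atSign-1 (w j) (coordinate (cᵢ i) j) (trivial j (i Fin.≟ j) j≢i)
        here : atSign (w i) (coordinate (cᵢ i) i) ≡ w i
        here = atSign-≉1 (w i) (coordinate (cᵢ i) i) λ v≈1 → 1≉-1 (trans (sym v≈1) (nontrivial (i Fin.≟ i)))

    private
      w : Fin m → Sign
      w i = QuadraticCharacter.legendre k q k̄ (d i) (atδ i (α i))

    relativePosition : RelativePosition k q k̄ p P d δ (k.kostantWeierstrass a) g (characterWithSigns w)
    relativePosition = record
      { z          = z
      ; z-position = z-position
      ; a          = α
      ; a-unit     = α-unit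
      ; κ          = z
      ; κ-kummer   = z-kummer
      ; z∼κ        = z∼z
      ; duality    = characterWithSigns-defined w
      }

    position : ∃[ χ ] RelativePosition k q k̄ p P d δ (k.kostantWeierstrass a) g χ × DefinedBy χ
        (positionSign η)
    position = characterWithSigns w , relativePosition ,
      λ i → ≡.trans (characterWithSigns-defined w i) (class-sign η η-nonzero i)

open import Algebra.Definitions.RawSemiring using (Irreducible; sum; product)
open import Data.List.Base using (map)

proposition1p8 :
  ∀ {c ℓ c′ ℓ′} (k : Field c ℓ) (q : ℕ) → HasSize k q →
  (char : ℕ) → HasCharacteristic k char → 2 < char →
  (k̄ : AlgebraicClosure k c′ ℓ′) →
  let module k = Field k
      module k̄ = AlgebraicClosure k̄
      module Mat = Matrices k.commutativeRing
      module Mat̄ = Matrices k̄.commutativeRing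
      module Pol = Polynomials k.commutativeRing
      module Pol̄ = Polynomials k̄.commutativeRing
      k[T] = Semiring.rawSemiring (CommutativeRing.semiring Pol.polyRing)
      k̄[T] = Semiring.rawSemiring (CommutativeRing.semiring Pol̄.polyRing)
  in
  {n : ℕ} (Λ : Mat.Matrix n) → Mat.SelfAdjoint Λ →
  let p = Pol.charPoly Λ in
  -- p has distinct roots in k̄
  (r : Fin n → k̄.Carrier) →
  map k̄.ι p Pol̄.≈ₚ product k̄[T] (λ i → Pol̄.T Pol̄.+ₚ (Pol̄.-ₚ Pol̄.const (r i))) →
  (∀ i j → r i k̄.≈ r j → i ≡ j) →
  -- p = ∏ Pᵢ with Pᵢ irreducible of degree dᵢ, and δᵢ is a root of Pᵢ
  {m : ℕ} (P : Fin m → Pol.Poly) (d : Fin m → ℕ) →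
  (∀ i → Pol.MonicOfDegree (d i) (P i)) →
  (∀ i → Irreducible k[T] (P i)) →
  p Pol.≈ₚ product k[T] P →
  (δ : Fin m → k̄.Carrier) → (∀ i → Pol̄.eval (map k̄.ι (P i)) (δ i) k̄.≈ k̄.0#) →
  let open Factors k q k̄ P d δ in
  -- V ≅ ⊕ kᵢ as k[T]-modules, with ⟨x,y⟩ = Σ Tr (ηᵢ xᵢ yᵢ)
  (Φ : Vector k.Carrier n → Fin m → Pol.Poly) →
  LeftModuleMorphisms.IsLeftModuleIsomorphism (operatorModule Λ) ⊕kᵢ Φ →
  (η : Fin m → Pol.Poly) → (∀ i → IsUnit (kᵢ i) (η i)) →
  (∀ x y → Mat.⟨ x , y ⟩ k.≈
    sum (Semiring.rawSemiring k.semiring)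
      (λ i → Pol.Tr (d i) (P i) (η i Pol.*ₚ Φ x i Pol.*ₚ Φ y i))) →
  -- Λ = g Λ_KW g⁻¹
  (a : Vector k.Carrier n) →
  let Λ-KW = Mat.kostantWeierstrass a in
  Pol.charPoly Λ-KW Pol.≈ₚ p →
  (g : Mat̄.SO n) →
  (λ i j → k̄.ι (Λ i j))
    Mat̄.≋ Mat̄.SO.mat g Mat̄.*ᴹ (λ i j → k̄.ι (Λ-KW i j)) Mat̄.*ᴹ Mat̄.SO.inv g →
  ∃[ χ ] RelativePosition k q k̄ p P d δ Λ-KW g χ × DefinedBy χ (positionSign η)
proposition1p8 k q size char hasChar 2<char k̄ Λ _ r p-splits r-distinct P d P-monic P-irreducible p-factors δ δ-root
  Φ Φ-isomorphism η η-unit form a _ g conjugation =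
  Position.Conjugation.position k q size 2≉0 k̄ Λ (Polynomials.charPoly k.commutativeRing Λ) r p-splits r-distinct
    P d P-monic P-irreducible p-factors δ δ-root Φ Φ-isomorphism η η-unit form a g conjugation
  where
  module k = Field k
  2≉0 : ¬ k.1# k.+ k.1# k.≈ k.0#
  -- 2 is positive and below the characteristic, so it does not kill 1; the double of 1 unfolds to 1
  -- + (1 + 0).
  2≉0 e = HasCharacteristic.minimal hasChar 2 (s≤s z≤n) 2<char
    (k.trans (k.+-congˡ (k.+-identityʳ k.1#)) e)
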